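{- Let $n$ and $m$ be positive integers. Let $\mathbf{c}\in\mathbb{Z}[t]^n$, $A\in\mathbb{Z}[t]^{m\times n}$ and $\mathbf{b}\in\mathbb{Z}[t]^m$. For every positive integer $t$, let $R(t):=\{\mathbf{x}\in\mathbb{R}^n \mid \mathbf{x}\ge\mathbf{0} \wedge A(t)\mathbf{x}=\mathbf{b}(t)\}$ and $L(t):=R(t)\cap\mathbb{Z}^n$. Assume that $R(t)$ is bounded for all positive integers $t$. For all positive integers $\ell$, let $f_\ell(t)$ be the $\ell^{\text{th}}$ largest value (with multiplicity) of $\mathbf{c}^{\intercal}(t)\mathbf{x}$ for $\mathbf{x}\in L(t)$, or $-\infty$ if $|L(t)|<\ell$. Then for all positive integers $\ell$, $f_\ell$ is eventually quasi-polynomial.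
   Context: Inequalities between vectors are coordinate-wise. The variables $t$ and $\ell$ range over positive integers. The $\ell^{\text{th}}$ largest value with multiplicity means the $\ell^{\text{th}}$ largest element of the multiset $\{\mathbf{c}^{\intercal}(t)\mathbf{x} : \mathbf{x}\in L(t)\}$ (one entry for each $\mathbf{x}\in L(t)$). A function $g$ is eventually quasi-polynomial if its domain is a subset of $\mathbb{Z}$ containing all sufficiently large integers and there exist a positive integer $d$ and polynomials $P_0,\ldots,P_{d-1}\in\mathbb{R}[t]$ such that for all sufficiently large $t$, $g(t)=P_{t \bmod d}(t)$. By convention the constant function $-\infty$ counts as a polynomial, so each $P_j$ is allowed to be the constant $-\infty$. -}

module Defs where

open import Algebra.Bundles using (RawRing)
open import Data.Fin.Base using (Fin; fromℕ<)
open import Data.Integer.Base as ℤ using (ℤ; +_; 0ℤ)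
import Data.Integer.DivMod as ℤ
import Data.Integer.Properties as ℤ
open import Data.List.Base as List using (List; []; _∷_)
open import Data.List.Membership.Propositional using (_∈_)
open import Data.List.Membership.Propositional.Properties
  using (∈-cartesianProductWith⁺; ∈-filter⁺; ∈-filter⁻; ∈-map⁺; ∈-upTo⁺)
open import Data.List.Relation.Unary.Any using (here)
open import Data.List.Relation.Unary.Unique.Propositional using (Unique)
import Data.List.Relation.Unary.Unique.Propositional.Properties as Unique
import Data.List.Relation.Unary.All as ListAll
import Data.List.Relation.Unary.AllPairs as AllPairs
import Data.List.Sort
open import Data.Maybe.Base as Maybe using ()
open import Data.Nat.Base as ℕ using (ℕ; zero; suc)
import Data.Nat.Properties as ℕ
open import Data.Product using (Σ; _×_; _,_; ∃-syntax; proj₁; proj₂; uncurry)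
open import Data.Sum.Base using (inj₁; inj₂)
open import Data.Rational.Base as ℚ using (ℚ; 0ℚ; 1ℚ)
import Data.Rational.Properties as ℚ
import Data.Rational.Unnormalised.Base as ℚᵘ
import Data.Rational.Unnormalised.Properties as ℚᵘ
open import Data.Rational.Solver using (module +-*-Solver)
open import Data.Vec.Base as Vec using (Vec; []; _∷_)
import Data.Vec.Properties as Vec
open import Data.Vec.Relation.Binary.Pointwise.Inductive as Pointwise
  using (Pointwise; []; _∷_)
open import Data.Vec.Relation.Unary.All as All using (All; []; _∷_)
open import Function.Bundles using (_⇔_; mk⇔)
open import Level using (Level; 0ℓ)
open import Relation.Binary.Construct.Flip.EqAndOrd using (decTotalOrder)
import Relation.Binary.Construct.Add.Infimum.Equality as InfimumEquality
open import Relation.Binary.PropositionalEquality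
  using (_≡_; refl; sym; trans; cong; cong₂; subst; subst₂)
open import Relation.Nullary.Construct.Add.Infimum using (_₋)
open import Relation.Nullary.Decidable using (Dec; yes; no; map′; _×-dec_)
open import Relation.Nullary.Negation using (contradiction)
open import Relation.Unary using (Pred; Decidable)

------------------------------------------------------------------------
-- Real numbers: Cauchy sequences of rationals, with explicit moduli
-- and with the setoid equality _≈_ (same limit)

record ℝ : Set where
  field
    seq    : ℕ → ℚ
    cauchy : ∀ ε → 0ℚ ℚ.< ε → ∃[ N ] ∀ m n → N ℕ.≤ m → N ℕ.≤ n →
             ℚ.∣ seq m ℚ.- seq n ∣ ℚ.≤ ε

open ℝ public

infix 4 _≈_ _≤_

_≈_ : ℝ → ℝ → Set
x ≈ y = ∀ ε → 0ℚ ℚ.< ε → ∃[ N ] ∀ n → N ℕ.≤ n →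
        ℚ.∣ seq x n ℚ.- seq y n ∣ ℚ.≤ ε

_≤_ : ℝ → ℝ → Set
x ≤ y = ∀ ε → 0ℚ ℚ.< ε → ∃[ N ] ∀ n → N ℕ.≤ n →
        seq x n ℚ.≤ seq y n ℚ.+ ε

module _ where
  open +-*-Solver
  open ℚ.≤-Reasoning

  p≡p-q+q : ∀ p q → p ≡ (p ℚ.- q) ℚ.+ q
  p≡p-q+q = solve 2 (λ p q → p := (p :- q) :+ q) refl

  +-split : ∀ p q r s → (p ℚ.+ q) ℚ.- (r ℚ.+ s) ≡ (p ℚ.- r) ℚ.+ (q ℚ.- s)
  +-split = solve 4 (λ p q r s → (p :+ q) :- (r :+ s) := (p :- r) :+ (q :- s)) refl

  *-split : ∀ p q r s →
            p ℚ.* q ℚ.- r ℚ.* s ≡ p ℚ.* (q ℚ.- s) ℚ.+ s ℚ.* (p ℚ.- r)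
  *-split = solve 4 (λ p q r s → p :* q :- r :* s := p :* (q :- s) :+ s :* (p :- r)) refl

  ∣p∣≤ : ∀ {p q β} → ℚ.∣ p ℚ.- q ∣ ℚ.≤ β → ℚ.∣ p ∣ ℚ.≤ β ℚ.+ ℚ.∣ q ∣
  ∣p∣≤ {p} {q} {β} p-q≤β = begin
    ℚ.∣ p ∣                        ≡⟨ cong ℚ.∣_∣ (p≡p-q+q p q) ⟩
    ℚ.∣ (p ℚ.- q) ℚ.+ q ∣          ≤⟨ ℚ.∣p+q∣≤∣p∣+∣q∣ (p ℚ.- q) q ⟩
    ℚ.∣ p ℚ.- q ∣ ℚ.+ ℚ.∣ q ∣      ≤⟨ ℚ.+-monoˡ-≤ ℚ.∣ q ∣ p-q≤β ⟩
    β ℚ.+ ℚ.∣ q ∣                  ∎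

  +-close : ∀ {p q r s δ} → ℚ.∣ p ℚ.- r ∣ ℚ.≤ δ → ℚ.∣ q ℚ.- s ∣ ℚ.≤ δ →
            ℚ.∣ (p ℚ.+ q) ℚ.- (r ℚ.+ s) ∣ ℚ.≤ δ ℚ.+ δ
  +-close {p} {q} {r} {s} {δ} p-r≤δ q-s≤δ = begin
    ℚ.∣ (p ℚ.+ q) ℚ.- (r ℚ.+ s) ∣        ≡⟨ cong ℚ.∣_∣ (+-split p q r s) ⟩
    ℚ.∣ (p ℚ.- r) ℚ.+ (q ℚ.- s) ∣        ≤⟨ ℚ.∣p+q∣≤∣p∣+∣q∣ (p ℚ.- r) (q ℚ.- s) ⟩
    ℚ.∣ p ℚ.- r ∣ ℚ.+ ℚ.∣ q ℚ.- s ∣      ≤⟨ ℚ.+-mono-≤ p-r≤δ q-s≤δ ⟩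
    δ ℚ.+ δ                              ∎

  neg-close : ∀ {p q ε} → ℚ.∣ p ℚ.- q ∣ ℚ.≤ ε → ℚ.∣ (ℚ.- p) ℚ.- (ℚ.- q) ∣ ℚ.≤ ε
  neg-close {p} {q} {ε} p-q≤ε = begin
    ℚ.∣ (ℚ.- p) ℚ.- (ℚ.- q) ∣  ≡⟨ cong ℚ.∣_∣ (ℚ.neg-distrib-+ p (ℚ.- q)) ⟨
    ℚ.∣ ℚ.- (p ℚ.- q) ∣        ≡⟨ ℚ.∣-p∣≡∣p∣ (p ℚ.- q) ⟩
    ℚ.∣ p ℚ.- q ∣              ≤⟨ p-q≤ε ⟩
    ε                          ∎

  ∣*∣-mono : ∀ {p q β δ} → .{{ℚ.Positive β}} → ℚ.∣ p ∣ ℚ.≤ β → ℚ.∣ q ∣ ℚ.≤ δ →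
             ℚ.∣ p ℚ.* q ∣ ℚ.≤ β ℚ.* δ
  ∣*∣-mono {p} {q} {β} {δ} p≤β q≤δ = begin
    ℚ.∣ p ℚ.* q ∣          ≡⟨ ℚ.∣p*q∣≡∣p∣*∣q∣ p q ⟩
    ℚ.∣ p ∣ ℚ.* ℚ.∣ q ∣    ≤⟨ ℚ.*-monoʳ-≤-nonNeg ℚ.∣ q ∣ {{ℚ.∣-∣-nonNeg q}} p≤β ⟩
    β ℚ.* ℚ.∣ q ∣          ≤⟨ ℚ.*-monoˡ-≤-nonNeg β {{ℚ.pos⇒nonNeg β}} q≤δ ⟩
    β ℚ.* δ                ∎

  *-close : ∀ {p q r s β γ δ} → .{{ℚ.Positive β}} → .{{ℚ.Positive γ}} →
            ℚ.∣ p ∣ ℚ.≤ β → ℚ.∣ s ∣ ℚ.≤ γ →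
            ℚ.∣ p ℚ.- r ∣ ℚ.≤ δ → ℚ.∣ q ℚ.- s ∣ ℚ.≤ δ →
            ℚ.∣ p ℚ.* q ℚ.- r ℚ.* s ∣ ℚ.≤ (β ℚ.+ γ) ℚ.* δ
  *-close {p} {q} {r} {s} {β} {γ} {δ} p≤β s≤γ p-r≤δ q-s≤δ = begin
    ℚ.∣ p ℚ.* q ℚ.- r ℚ.* s ∣
      ≡⟨ cong ℚ.∣_∣ (*-split p q r s) ⟩
    ℚ.∣ p ℚ.* (q ℚ.- s) ℚ.+ s ℚ.* (p ℚ.- r) ∣
      ≤⟨ ℚ.∣p+q∣≤∣p∣+∣q∣ (p ℚ.* (q ℚ.- s)) (s ℚ.* (p ℚ.- r)) ⟩
    ℚ.∣ p ℚ.* (q ℚ.- s) ∣ ℚ.+ ℚ.∣ s ℚ.* (p ℚ.- r) ∣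
      ≤⟨ ℚ.+-mono-≤ (∣*∣-mono {p} {q ℚ.- s} p≤β q-s≤δ) (∣*∣-mono {s} {p ℚ.- r} s≤γ p-r≤δ) ⟩
    β ℚ.* δ ℚ.+ γ ℚ.* δ
      ≡⟨ ℚ.*-distribʳ-+ δ β γ ⟨
    (β ℚ.+ γ) ℚ.* δ ∎

0<1 : 0ℚ ℚ.< 1ℚ
0<1 = ℚ.positive⁻¹ 1ℚ

-- For β > 0 there is δ > 0 with β δ = ε.
divide : ∀ β ε → .{{ℚ.Positive β}} → 0ℚ ℚ.< ε → ∃[ δ ] 0ℚ ℚ.< δ × β ℚ.* δ ≡ ε
divide β ε ε>0 = δ , ℚ.positive⁻¹ δ {{ℚ.pos*pos⇒pos (ℚ.1/ β) ε}} , βδ≡ε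
  where
  instance
    _ = ℚ.positive ε>0
    _ = ℚ.pos⇒nonZero β
    _ = ℚ.1/pos⇒pos β
  δ = ℚ.1/ β ℚ.* ε
  βδ≡ε : β ℚ.* δ ≡ ε
  βδ≡ε = trans (sym (ℚ.*-assoc β (ℚ.1/ β) ε))
        (trans (cong (ℚ._* ε) (ℚ.*-inverseʳ β)) (ℚ.*-identityˡ ε))

eventuallyBounded : ∀ x → ∃[ β ] ℚ.Positive β ×
  ∃[ N ] ∀ n → N ℕ.≤ n → ℚ.∣ seq x n ∣ ℚ.≤ β
eventuallyBounded x =
  let N , close = cauchy x 1ℚ 0<1
      q = seq x N
  in 1ℚ ℚ.+ ℚ.∣ q ∣
   , ℚ.positive (ℚ.+-mono-<-≤ 0<1 (ℚ.0≤∣p∣ q))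
   , N , λ n N≤n → ∣p∣≤ {seq x n} {q} (close n N N≤n ℕ.≤-refl)

const : ℚ → ℝ
const p .seq    _     = p
const p .cauchy ε ε>0 = 0 , λ _ _ _ _ →
  ℚ.≤-trans (ℚ.≤-reflexive (cong ℚ.∣_∣ (ℚ.+-inverseʳ p))) (ℚ.<⇒≤ ε>0)

infixl 6 _+_
infixl 7 _*_
infix  8 -_

_+_ : ℝ → ℝ → ℝ
(x + y) .seq n = seq x n ℚ.+ seq y n
(x + y) .cauchy ε ε>0 =
  let δ , δ>0 , 2δ≡ε = divide (1ℚ ℚ.+ 1ℚ) ε ε>0
      M , closeˣ = cauchy x δ δ>0
      N , closeʸ = cauchy y δ δ>0
      δ+δ≡ε = trans (sym (trans (ℚ.*-distribʳ-+ δ 1ℚ 1ℚ)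
                (cong₂ ℚ._+_ (ℚ.*-identityˡ δ) (ℚ.*-identityˡ δ)))) 2δ≡ε
  in M ℕ.⊔ N , λ m n ≤m ≤n →
     subst (_ ℚ.≤_) δ+δ≡ε
       (+-close {seq x m} {seq y m} {seq x n} {seq y n}
         (closeˣ m n (ℕ.m⊔n≤o⇒m≤o M N ≤m) (ℕ.m⊔n≤o⇒m≤o M N ≤n))
         (closeʸ m n (ℕ.m⊔n≤o⇒n≤o M N ≤m) (ℕ.m⊔n≤o⇒n≤o M N ≤n)))

-_ : ℝ → ℝ
(- x) .seq n = ℚ.- seq x n
(- x) .cauchy ε ε>0 =
  let N , close = cauchy x ε ε>0
  in N , λ m n N≤m N≤n → neg-close {seq x m} {seq x n} (close m n N≤m N≤n)

_*_ : ℝ → ℝ → ℝ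
(x * y) .seq n = seq x n ℚ.* seq y n
(x * y) .cauchy ε ε>0 =
  let β , β>0 , K , x≤β = eventuallyBounded x
      γ , γ>0 , L , y≤γ = eventuallyBounded y
      δ , δ>0 , [β+γ]δ≡ε = divide (β ℚ.+ γ) ε {{ℚ.pos+pos⇒pos β {{β>0}} γ {{γ>0}}}} ε>0
      M , closeˣ = cauchy x δ δ>0
      N , closeʸ = cauchy y δ δ>0
      KL = K ℕ.⊔ L
      MN = M ℕ.⊔ N
  in KL ℕ.⊔ MN , λ m n ≤m ≤n →
     let MN≤m = ℕ.m⊔n≤o⇒n≤o KL MN ≤m
         MN≤n = ℕ.m⊔n≤o⇒n≤o KL MN ≤n
     in subst (_ ℚ.≤_) [β+γ]δ≡ε
       (*-close {seq x m} {seq y m} {seq x n} {seq y n} {{β>0}} {{γ>0}}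
         (x≤β m (ℕ.m⊔n≤o⇒m≤o K L (ℕ.m⊔n≤o⇒m≤o KL MN ≤m)))
         (y≤γ n (ℕ.m⊔n≤o⇒n≤o K L (ℕ.m⊔n≤o⇒m≤o KL MN ≤n)))
         (closeˣ m n (ℕ.m⊔n≤o⇒m≤o M N MN≤m) (ℕ.m⊔n≤o⇒m≤o M N MN≤n))
         (closeʸ m n (ℕ.m⊔n≤o⇒n≤o M N MN≤m) (ℕ.m⊔n≤o⇒n≤o M N MN≤n)))

ℝ-rawRing : RawRing 0ℓ 0ℓ
ℝ-rawRing = record
  { Carrier = ℝ ; _≈_ = _≈_ ; _+_ = _+_ ; _*_ = _*_ ; -_ = -_
  ; 0# = const 0ℚ ; 1# = const 1ℚ
  }

-- The inclusion ℤ ⊆ ℝ.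
ι : ℤ → ℝ
ι i = const (i ℚ./ 1)

p≤∣p∣ : ∀ p → p ℚ.≤ ℚ.∣ p ∣
p≤∣p∣ p with ℚ.≤-total 0ℚ p
... | inj₁ 0≤p = ℚ.≤-reflexive (sym (ℚ.0≤p⇒∣p∣≡p 0≤p))
... | inj₂ p≤0 = ℚ.≤-trans p≤0 (ℚ.0≤∣p∣ p)

const-cancel-≤ : ∀ {p q} → const p ≤ const q → p ℚ.≤ q
const-cancel-≤ {p} {q} p≤q with p ℚ.≤? q
... | yes p≤q′ = p≤q′
... | no  p≰q  =
  let r , q<r , r<p = ℚ.<-dense (ℚ.≰⇒> p≰q)
      ε>0 = subst (ℚ._< r ℚ.- q) (ℚ.+-inverseʳ q) (ℚ.+-monoˡ-< (ℚ.- q) q<r)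
      N , below = p≤q (r ℚ.- q) ε>0
      q+[r-q]≡r = trans (ℚ.+-comm q (r ℚ.- q)) (sym (p≡p-q+q r q))
  in contradiction
    (ℚ.<-≤-trans r<p (subst (p ℚ.≤_) q+[r-q]≡r (below N ℕ.≤-refl))) (ℚ.<-irrefl refl)

const-mono-≤ : ∀ {p q} → p ℚ.≤ q → const p ≤ const q
const-mono-≤ {p} {q} p≤q ε ε>0 = 0 , λ _ _ →
  subst (ℚ._≤ q ℚ.+ ε) (ℚ.+-identityʳ p) (ℚ.+-mono-≤ p≤q (ℚ.<⇒≤ ε>0))

≈⇒≤ : ∀ {x y} → x ≈ y → x ≤ y
≈⇒≤ {x} {y} x≈y ε ε>0 =
  let N , close = x≈y ε ε>0
  in N , λ n N≤n → begin
    seq x n                          ≡⟨ p≡p-q+q (seq x n) (seq y n) ⟩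
    (seq x n ℚ.- seq y n) ℚ.+ seq y n
      ≤⟨ ℚ.+-monoˡ-≤ (seq y n) (ℚ.≤-trans (p≤∣p∣ _) (close n N≤n)) ⟩
    ε ℚ.+ seq y n                    ≡⟨ ℚ.+-comm ε (seq y n) ⟩
    seq y n ℚ.+ ε                    ∎
  where open ℚ.≤-Reasoning

≈-sym : ∀ {x y} → x ≈ y → y ≈ x
≈-sym {x} {y} x≈y ε ε>0 =
  let N , close = x≈y ε ε>0
  in N , λ n N≤n → subst (ℚ._≤ ε) (∣p-q∣≡∣q-p∣ (seq x n) (seq y n)) (close n N≤n)
  where
  ∣p-q∣≡∣q-p∣ : ∀ p q → ℚ.∣ p ℚ.- q ∣ ≡ ℚ.∣ q ℚ.- p ∣
  ∣p-q∣≡∣q-p∣ p q = trans (sym (ℚ.∣-p∣≡∣p∣ (p ℚ.- q))) (cong ℚ.∣_∣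
    (trans (ℚ.neg-distrib-+ p (ℚ.- q))
    (trans (cong (ℚ.- p ℚ.+_) (neg-involutive q)) (ℚ.+-comm (ℚ.- p) q))))
    where open import Algebra.Properties.Group ℚ.+-0-group
            using () renaming (⁻¹-involutive to neg-involutive)

-- A sequence that is constantly p represents p.
constant-≈ : ∀ {x p q} → (∀ n → seq x n ≡ p) → p ≡ q → x ≈ const q
constant-≈ {x} {p} x≡p refl ε ε>0 = 0 , λ n _ →
  subst (λ z → ℚ.∣ z ℚ.- p ∣ ℚ.≤ ε) (sym (x≡p n))
    (ℚ.≤-trans (ℚ.≤-reflexive (cong ℚ.∣_∣ (ℚ.+-inverseʳ p))) (ℚ.<⇒≤ ε>0))

constant-≈⁻ : ∀ {x p q} → (∀ n → seq x n ≡ p) → x ≈ const q → p ≡ q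
constant-≈⁻ {x} {p} {q} x≡p x≈q = ℚ.≤-antisym
  (const-cancel-≤ (≈⇒≤ {const p} {const q} p≈q))
  (const-cancel-≤ (≈⇒≤ {const q} {const p} (≈-sym {const p} {const q} p≈q)))
  where
  p≈q : const p ≈ const q
  p≈q ε ε>0 =
    let N , close = x≈q ε ε>0
    in N , λ n N≤n → subst (λ z → ℚ.∣ z ℚ.- q ∣ ℚ.≤ ε) (x≡p n) (close n N≤n)

toℚᵘ-/1 : ∀ i → ℚ.toℚᵘ (i ℚ./ 1) ℚᵘ.≃ ℚᵘ.mkℚᵘ i 0
toℚᵘ-/1 i = ℚ.toℚᵘ-fromℚᵘ (ℚᵘ.mkℚᵘ i 0)

/1-cancel-≤ : ∀ {i j} → i ℚ./ 1 ℚ.≤ j ℚ./ 1 → i ℤ.≤ j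
/1-cancel-≤ {i} {j} i≤j
  with ℚᵘ.≤-respˡ-≃ (toℚᵘ-/1 i) (ℚᵘ.≤-respʳ-≃ (toℚᵘ-/1 j) (ℚ.toℚᵘ-mono-≤ i≤j))
... | ℚᵘ.*≤* i*1≤j*1 = subst₂ ℤ._≤_ (ℤ.*-identityʳ i) (ℤ.*-identityʳ j) i*1≤j*1

/1-mono-≤ : ∀ {i j} → i ℤ.≤ j → i ℚ./ 1 ℚ.≤ j ℚ./ 1
/1-mono-≤ {i} {j} i≤j = ℚ.toℚᵘ-cancel-≤
  (ℚᵘ.≤-respˡ-≃ (ℚᵘ.≃-sym (toℚᵘ-/1 i)) (ℚᵘ.≤-respʳ-≃ (ℚᵘ.≃-sym (toℚᵘ-/1 j))
    (ℚᵘ.*≤* (subst₂ ℤ._≤_ (sym (ℤ.*-identityʳ i)) (sym (ℤ.*-identityʳ j)) i≤j))))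

/1-injective : ∀ {i j} → i ℚ./ 1 ≡ j ℚ./ 1 → i ≡ j
/1-injective i≡j = ℤ.≤-antisym (/1-cancel-≤ (ℚ.≤-reflexive i≡j))
                               (/1-cancel-≤ (ℚ.≤-reflexive (sym i≡j)))

/1-+ : ∀ i j → i ℚ./ 1 ℚ.+ j ℚ./ 1 ≡ (i ℤ.+ j) ℚ./ 1
/1-+ i j = ℚ.toℚᵘ-injective
  (ℚᵘ.≃-trans (ℚ.toℚᵘ-homo-+ (i ℚ./ 1) (j ℚ./ 1))
  (ℚᵘ.≃-trans (ℚᵘ.+-cong (toℚᵘ-/1 i) (toℚᵘ-/1 j))
  (ℚᵘ.≃-trans (ℚᵘ.≃-reflexive (cong (λ k → ℚᵘ.mkℚᵘ k 0)
                (cong₂ ℤ._+_ (ℤ.*-identityʳ i) (ℤ.*-identityʳ j))))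
  (ℚᵘ.≃-sym (toℚᵘ-/1 (i ℤ.+ j))))))

/1-* : ∀ i j → (i ℚ./ 1) ℚ.* (j ℚ./ 1) ≡ (i ℤ.* j) ℚ./ 1
/1-* i j = ℚ.toℚᵘ-injective
  (ℚᵘ.≃-trans (ℚ.toℚᵘ-homo-* (i ℚ./ 1) (j ℚ./ 1))
  (ℚᵘ.≃-trans (ℚᵘ.*-cong (toℚᵘ-/1 i) (toℚᵘ-/1 j))
  (ℚᵘ.≃-sym (toℚᵘ-/1 (i ℤ.* j)))))

-- An integer bound for a real upper bound.
archimedean : ∀ M → ∃[ N ] ∀ k → ι (+ k) ≤ M → k ℕ.≤ N
archimedean M =
  let β , _ , K , M≤β = eventuallyBounded M
  in ℤ.∣ ℚ.↥ β ∣ , λ k k≤M → lemma β k (const-cancel-≤ (bound β K M≤β k k≤M))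
  where
  bound : ∀ β K → (∀ n → K ℕ.≤ n → ℚ.∣ seq M n ∣ ℚ.≤ β) →
          ∀ k → ι (+ k) ≤ M → ι (+ k) ≤ const β
  bound β K M≤β k k≤M ε ε>0 =
    let N , below = k≤M ε ε>0
    in K ℕ.⊔ N , λ n ≤n → ℚ.≤-trans (below n (ℕ.m⊔n≤o⇒n≤o K N ≤n))
         (ℚ.+-monoˡ-≤ ε (ℚ.≤-trans (p≤∣p∣ (seq M n))
           (M≤β n (ℕ.m⊔n≤o⇒m≤o K N ≤n))))
  lemma : ∀ β k → (+ k) ℚ./ 1 ℚ.≤ β → k ℕ.≤ ℤ.∣ ℚ.↥ β ∣
  lemma β@(ℚ.mkℚ _ _ _) k k≤β with ℚᵘ.≤-respˡ-≃ (toℚᵘ-/1 (+ k)) (ℚ.toℚᵘ-mono-≤ k≤β)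
  ... | ℚᵘ.*≤* kd≤n = ℕ.≤-trans (ℕ.m≤m*n k (suc (ℚ.denominator-1 β)))
    (ℤ.drop‿+≤+ (ℤ.≤-trans
      (subst₂ ℤ._≤_ (sym (ℤ.pos-* k _)) (ℤ.*-identityʳ (ℚ.↥ β)) kd≤n)
      (i≤∣i∣ (ℚ.↥ β))))
    where
    i≤∣i∣ : ∀ i → i ℤ.≤ + ℤ.∣ i ∣
    i≤∣i∣ (+ n)      = ℤ.≤-refl
    i≤∣i∣ ℤ.-[1+ n ] = ℤ.-≤+

------------------------------------------------------------------------
-- Polynomials and vectors over a ring

-- A polynomial is the list of its coefficients, constant term first;
-- trailing zeros are allowed.
Poly : ∀ {c} → Set c → Set c
Poly = List

module _ {c ℓ : Level} (R : RawRing c ℓ) where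
  open RawRing R using (Carrier; 0#) renaming (_+_ to _⊕_; _*_ to _⊗_)

  eval : Poly Carrier → Carrier → Carrier
  eval []      t = 0#
  eval (a ∷ p) t = a ⊕ t ⊗ eval p t

  dot : ∀ {n} → Vec Carrier n → Vec Carrier n → Carrier
  dot u v = Vec.foldr′ _⊕_ 0# (Vec.zipWith _⊗_ u v)

  mulVec : ∀ {m n} → Vec (Vec Carrier n) m → Vec Carrier n → Vec Carrier m
  mulVec A x = Vec.map (λ row → dot row x) A

_⟨_⟩ : Poly ℤ → ℤ → ℤ
p ⟨ t ⟩ = eval ℤ.+-*-rawRing p t

------------------------------------------------------------------------
-- Polyhedra and their integer points

Polyhedron : ∀ {m n} → Vec (Vec ℤ n) m → Vec ℤ m → Pred (Vec ℝ n) 0ℓ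
Polyhedron A b x =
  All (ι 0ℤ ≤_) x ×
  Pointwise _≈_ (mulVec ℝ-rawRing (Vec.map (Vec.map ι) A) x) (Vec.map ι b)

Bounded : ∀ {n} → Pred (Vec ℝ n) 0ℓ → Set
Bounded S = ∃[ M ] ∀ x → S x → All (λ y → - M ≤ y × y ≤ M) x

IntegerPoints : ∀ {n} → Pred (Vec ℝ n) 0ℓ → Pred (Vec ℤ n) 0ℓ
IntegerPoints S x = S (Vec.map ι x)

dot-ι : ∀ {n} (u v : Vec ℤ n) k →
        seq (dot ℝ-rawRing (Vec.map ι u) (Vec.map ι v)) k ≡
        dot ℤ.+-*-rawRing u v ℚ./ 1
dot-ι []      []      k = refl
dot-ι (i ∷ u) (j ∷ v) k = trans (cong₂ ℚ._+_ (/1-* i j) (dot-ι u v k)) (/1-+ (i ℤ.* j) _)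

nonneg? : ∀ {n} (x : Vec ℤ n) → Dec (All (ι 0ℤ ≤_) (Vec.map ι x))
nonneg? []      = yes []
nonneg? (i ∷ x) = map′ (uncurry _∷_) All.uncons
  (map′ (λ 0≤i → const-mono-≤ (/1-mono-≤ 0≤i)) (λ 0≤i → /1-cancel-≤ (const-cancel-≤ 0≤i))
    (0ℤ ℤ.≤? i) ×-dec nonneg? x)

solution? : ∀ {m n} (A : Vec (Vec ℤ n) m) (b : Vec ℤ m) (x : Vec ℤ n) →
  Dec (Pointwise _≈_ (mulVec ℝ-rawRing (Vec.map (Vec.map ι) A) (Vec.map ι x)) (Vec.map ι b))
solution? []      []      x = yes []
solution? (r ∷ A) (b ∷ bs) x = map′ (uncurry _∷_) Pointwise.uncons
  (map′ (λ eq → constant-≈ {row} (dot-ι r x) (cong (ℚ._/ 1) eq))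
        (λ eq → /1-injective (constant-≈⁻ {row} (dot-ι r x) eq))
    (dot ℤ.+-*-rawRing r x ℤ.≟ b) ×-dec solution? A bs x)
  where row = dot ℝ-rawRing (Vec.map ι r) (Vec.map ι x)

box : ℕ → ∀ n → List (Vec ℤ n)
box N zero    = [] ∷ []
box N (suc n) = List.cartesianProductWith _∷_ (List.map +_ (List.upTo (suc N))) (box N n)

box-unique : ∀ N n → Unique (box N n)
box-unique N zero    = ListAll.[] AllPairs.∷ AllPairs.[]
box-unique N (suc n) = Unique.cartesianProductWith⁺ _∷_ Vec.∷-injective
  (Unique.map⁺ ℤ.+-injective (Unique.upTo⁺ (suc N))) (box-unique N n)

∈-box : ∀ N {n} (x : Vec ℤ n) → All (λ i → 0ℤ ℤ.≤ i × ℤ.∣ i ∣ ℕ.≤ N) x → x ∈ box N n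
∈-box N []        []                    = here refl
∈-box N (+ k ∷ x) ((_ , k≤N) ∷ x≤N) =
  ∈-cartesianProductWith⁺ _∷_ (∈-map⁺ +_ (∈-upTo⁺ (ℕ.s≤s k≤N))) (∈-box N x x≤N)

integerPoints? : ∀ {m n} (A : Vec (Vec ℤ n) m) (b : Vec ℤ m) →
                 Decidable (IntegerPoints (Polyhedron A b))
integerPoints? A b x = nonneg? x ×-dec solution? A b x

enumerate : ∀ {m n} (A : Vec (Vec ℤ n) m) (b : Vec ℤ m) → Bounded (Polyhedron A b) →
            Σ (List (Vec ℤ n)) λ xs →
              Unique xs × (∀ x → x ∈ xs ⇔ IntegerPoints (Polyhedron A b) x)
enumerate {n = n} A b (M , bounded) =
  let N , bound = archimedean M in
    List.filter (integerPoints? A b) (box N n)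
  , Unique.filter⁺ (integerPoints? A b) (box-unique N n)
  , λ x → mk⇔ (λ x∈ → proj₂ (∈-filter⁻ (integerPoints? A b) {xs = box N n} x∈))
              (λ x∈L → ∈-filter⁺ (integerPoints? A b)
                         (∈-box N x (inBox N bound x (proj₁ x∈L) (bounded (Vec.map ι x) x∈L))) x∈L)
  where
  inBox : ∀ N → (∀ k → ι (+ k) ≤ M → k ℕ.≤ N) → ∀ {k} (x : Vec ℤ k) →
          All (ι 0ℤ ≤_) (Vec.map ι x) → All (λ y → - M ≤ y × y ≤ M) (Vec.map ι x) →
          All (λ i → 0ℤ ℤ.≤ i × ℤ.∣ i ∣ ℕ.≤ N) x
  inBox N bound []      _           _                 = []
  inBox N bound (i ∷ x) (0≤i ∷ 0≤x) ((_ , i≤M) ∷ x≤M) =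
    (0≤i′ , bound ℤ.∣ i ∣ (subst (λ j → ι j ≤ M) (sym (ℤ.0≤i⇒+∣i∣≡i 0≤i′)) i≤M))
    ∷ inBox N bound x 0≤x x≤M
    where 0≤i′ = /1-cancel-≤ (const-cancel-≤ 0≤i)

------------------------------------------------------------------------
-- Parametric integer programs

-- Sorting with respect to the reversed order, i.e. in decreasing order.
open Data.List.Sort (decTotalOrder ℤ.≤-decTotalOrder) using () renaming (sort to sort↓)

-- Positions are counted from 1.  ℤ ₋ is ℤ with -∞ adjoined, and its
-- element -∞ is what head returns on the empty list.
nthLargest : (ℓ : ℕ) → .{{ℕ.NonZero ℓ}} → List ℤ → ℤ ₋
nthLargest ℓ vs = List.head (List.drop (ℕ.pred ℓ) (sort↓ vs))

R : ∀ {m n} → Vec (Vec (Poly ℤ) n) m → Vec (Poly ℤ) m → ℤ → Pred (Vec ℝ n) 0ℓ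
R A b t = Polyhedron (Vec.map (Vec.map _⟨ t ⟩) A) (Vec.map _⟨ t ⟩ b)

f : ∀ {m n} (c : Vec (Poly ℤ) n) (A : Vec (Vec (Poly ℤ) n) m) (b : Vec (Poly ℤ) m) →
    (∀ t → 0ℤ ℤ.< t → Bounded (R A b t)) →
    (ℓ : ℕ) → .{{ℕ.NonZero ℓ}} → (t : ℤ) → 0ℤ ℤ.< t → ℤ ₋
f c A b bounded ℓ t t>0 =
  nthLargest ℓ (List.map (dot ℤ.+-*-rawRing (Vec.map _⟨ t ⟩ c)) L)
  where L = proj₁ (enumerate _ _ (bounded t t>0))

------------------------------------------------------------------------
-- Eventually quasi-polynomial functions

-- The functions g have domain D ⊆ ℤ and values in ℝ ∪ {-∞}; the latter
-- element is also admitted as a constituent "polynomial".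
EventuallyQuasiPolynomial : (D : Pred ℤ 0ℓ) → (∀ t → D t → ℝ ₋) → Set
EventuallyQuasiPolynomial D g =
  (∃[ N ] ∀ t → N ℤ.≤ t → D t) ×
  Σ ℕ λ d → Σ (ℕ.NonZero d) λ d≢0 → let instance _ = d≢0 in
  Σ (Fin d → Poly ℝ ₋) λ P →
  ∃[ N ] ∀ t → N ℤ.≤ t → (t∈D : D t) →
    g t t∈D ≈₋ Maybe.map (λ p → eval ℝ-rawRing p (ι t)) (P (fromℕ< (ℤ.n%ℕd<d t d)))
  where open InfimumEquality _≈_ using (_≈₋_)

-- Boundedness of R(t) bounds its integer points by a power of t: rows are
-- eliminated one at a time by pairing columns on which the row has opposite
-- signs, and a surviving combination would be a recession direction.  Writing
-- x in base t with digits 0 ≤ z < t and guessing the bounded carries turns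
-- A(t) x = b(t) into finitely many systems whose coefficients do not depend on t
-- and whose right-hand sides are polynomials in t.  Such a system is solved by
-- eliminating variables as in Cooper's algorithm: for any linear objective, each
-- point is within constant slack of some constraint or is beaten by ℓ points that
-- are, and fixing that slack determines one variable.  What remains is, on each
-- residue class of t, a finite list of points with rational polynomial coordinates
-- containing ℓ best ones for every objective; for large t their objective values
-- have a constant order.

module Submission where

open import Defs hiding (_≤_; _+_; _*_; -_)
import Defs as ℝ
open import Data.Empty using (⊥-elim)
import Data.Fin.Base as Fin
import Data.Fin.Properties as Fin
open import Data.Integer.Base as ℤ using (ℤ; +_; -[1+_]; 0ℤ; 1ℤ; -1ℤ; _+_; _*_; -_; _-_; _≤_; _<_; ∣_∣)
open import Data.Integer.Divisibility.Signed
  using (_∣_; divides; _∣?_; ∣-trans; ∣m∣n⇒∣m+n; ∣n⇒∣m*n; ∣m⇒∣m*n; ∣m+n∣m⇒∣n; *-monoˡ-∣; *-cancelʳ-∣; ∣-refl; ∣m⇒∣-m; m∣∣m∣)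
import Data.Integer.DivMod as ℤ
import Data.Integer.Properties as ℤ
open import Algebra.Properties.AbelianGroup ℤ.+-0-abelianGroup using () renaming (∙-cancelˡ to +-cancelˡ; ∙-cancelʳ to +-cancelʳ)
open import Data.Integer.Tactic.RingSolver using (solve-∀)
open import Data.List.Base as List using (List; []; _∷_; _++_; length; upTo; applyUpTo)
import Data.List.Properties as List
import Data.List.Sort
open import Data.List.Membership.Propositional using (_∈_; _∉_; find; lose)
open import Data.List.Membership.Propositional.Properties using (∈-++⁺ˡ; ∈-++⁺ʳ; ∈-map⁺; ∈-upTo⁺)
open import Data.List.Relation.Binary.Permutation.Propositional as ↭ using (_↭_; ↭-sym; ↭-trans)
import Data.List.Relation.Binary.Permutation.Propositional.Properties as ↭
open import Data.List.Relation.Unary.All as ListAll using ([]; _∷_) renaming (All to ListAll)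
import Data.List.Relation.Unary.All.Properties as ListAll
open import Data.List.Relation.Unary.AllPairs using (AllPairs; []; _∷_)
open import Data.List.Relation.Unary.Any as Any using (Any; here; there)
open import Data.List.Relation.Unary.Sorted.TotalOrder.Properties using (Sorted⇒AllPairs)
open import Data.List.Relation.Unary.Unique.Propositional using (Unique)
import Data.List.Relation.Unary.Unique.Propositional.Properties as Unique
open import Data.Maybe.Base as Maybe using (Maybe; just; nothing)
open import Data.Maybe.Relation.Unary.All as MaybeAll using (just; nothing) renaming (All to MaybeAll)
open import Data.Nat.Base as ℕ using (ℕ; zero; suc; _^_; _%_; _/_; _⊔_; _∸_)
import Data.Nat.Divisibility as ℕ
import Data.Nat.DivMod as ℕ
import Data.Nat.Properties as ℕ
import Data.Nat.Tactic.RingSolver as ℕ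
open import Data.Product using (Σ; _×_; _,_; ∃-syntax; proj₁; proj₂)
open import Data.Rational.Base as ℚ using (ℚ)
import Data.Rational.Properties as ℚ
open import Data.Rational.Solver using (module +-*-Solver)
open import Data.Sum.Base using (_⊎_; inj₁; inj₂)
open import Data.Vec.Base as Vec using (Vec; []; _∷_)
import Data.Vec.Properties as Vec
open import Data.Vec.Relation.Binary.Pointwise.Inductive using (Pointwise; []; _∷_)
open import Data.Vec.Relation.Unary.All as All using (All; []; _∷_)
import Data.Vec.Relation.Unary.All.Properties as All
open import Function.Base using (_∘_; case_of_)
open import Function.Bundles using (Equivalence)
open import Level using (0ℓ)
open import Relation.Binary.Bundles using (DecTotalOrder)
import Relation.Binary.Construct.Add.Infimum.Equality as InfimumEquality
open import Relation.Binary.Construct.Flip.EqAndOrd using (decTotalOrder)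
open import Relation.Binary.Definitions using (tri<; tri≈; tri>)
open import Relation.Binary.PropositionalEquality
  using (_≡_; _≢_; refl; sym; trans; cong; cong₂; subst; subst₂; ≢-sym; module ≡-Reasoning)
open import Relation.Nullary.Construct.Add.Infimum using (_₋)
open import Relation.Nullary.Decidable using (Dec; yes; no)
open import Relation.Nullary.Negation using (¬_; contradiction)
open import Relation.Unary as Unary using (Pred; _⊆_)

-- The obstacle is that `A` depends on `t`: eliminating a variable turns coefficients into moduli
-- and into numbers of cases, and these must not vary with `t`. The objective poses no such problem.
-- A cover has to serve every vector `v`, so at each fixed `t` the objective may be replaced by its
-- pullback under a change of variables (on digits, the products of its entries with powers of `t`),
-- and `c(t)` itself enters only when the final list of values is sorted.
--
-- Boundedness is assumed for each `t` separately and carries no uniform bound by itself. For the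
-- size of points it serves only to exclude recession directions; the bound then obtained is an
-- explicit expression in the entries of `A(t)` and `b(t)`, hence polynomial in `t`.
--
-- Values are counted once per point, so every change of variables is a bijection between sets of
-- integer points, and the slack allowed near a constraint grows with `ℓ`, because `ℓ` distinct
-- points must be kept instead of one optimum.

≤-of-difference : ∀ {i j e} → 0ℤ ≤ e → j - i ≡ e → i ≤ j
≤-of-difference 0≤e eq = ℤ.0≤i-j⇒j≤i (subst (0ℤ ≤_) (sym eq) 0≤e)

0≤+ : ∀ {i j} → 0ℤ ≤ i → 0ℤ ≤ j → 0ℤ ≤ i + j
0≤+ = ℤ.+-mono-≤

0≤* : ∀ {i j} → 0ℤ ≤ i → 0ℤ ≤ j → 0ℤ ≤ i * j
0≤* {+ m} {+ n} _ _ = subst (0ℤ ≤_) (ℤ.pos-* m n) (ℤ.+≤+ ℕ.z≤n)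

i*i≥0 : ∀ i → 0ℤ ≤ i * i
i*i≥0 (+ n)     = 0≤* {+ n} {+ n} (ℤ.+≤+ ℕ.z≤n) (ℤ.+≤+ ℕ.z≤n)
i*i≥0 -[1+ n ] = ℤ.+≤+ ℕ.z≤n

i*i>0 : ∀ i → .{{ℤ.NonZero i}} → 0ℤ < i * i
i*i>0 (+ suc n)  = ℤ.+<+ (ℕ.s≤s ℕ.z≤n)
i*i>0 -[1+ n ]   = ℤ.+<+ (ℕ.s≤s ℕ.z≤n)

nonZero⁻¹ : ∀ i → .{{ℤ.NonZero i}} → i ≢ 0ℤ
nonZero⁻¹ (+ suc n)  ()
nonZero⁻¹ -[1+ n ] ()

i≤∣i∣ : ∀ i → i ≤ + ∣ i ∣
i≤∣i∣ (+ n)     = ℤ.≤-refl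
i≤∣i∣ -[1+ n ] = ℤ.-≤+

-∣i∣≤i : ∀ i → - + ∣ i ∣ ≤ i
-∣i∣≤i (+ n)     = ℤ.neg-≤-pos
-∣i∣≤i -[1+ n ] = ℤ.≤-refl

∣i∣≤ : ∀ {i n} → - + n ≤ i → i ≤ + n → ∣ i ∣ ℕ.≤ n
∣i∣≤ {+ m}      _     (ℤ.+≤+ m≤n) = m≤n
∣i∣≤ { -[1+ m ]} {suc n} (ℤ.-≤- m≤n) _ = ℕ.s≤s m≤n

-- Vectors

infix 7 _·_
_·_ : ∀ {n} → Vec ℤ n → Vec ℤ n → ℤ
_·_ = dot ℤ.+-*-rawRing

comb : ∀ {n} → ℤ → Vec ℤ n → ℤ → Vec ℤ n → Vec ℤ n
comb j u k v = Vec.zipWith (λ x y → j * x + k * y) u v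

·-comm : ∀ {n} (u v : Vec ℤ n) → u · v ≡ v · u
·-comm []      []      = refl
·-comm (x ∷ u) (y ∷ v) = cong₂ _+_ (ℤ.*-comm x y) (·-comm u v)

comb-· : ∀ {n} j (u : Vec ℤ n) k v z → comb j u k v · z ≡ j * (u · z) + k * (v · z)
comb-· j []      k []      []      = lemma j k
  where
  lemma : ∀ j k → 0ℤ ≡ j * 0ℤ + k * 0ℤ
  lemma = solve-∀
comb-· j (x ∷ u) k (y ∷ v) (z ∷ w) =
  trans (cong (λ e → (j * x + k * y) * z + e) (comb-· j u k v w)) (lemma j x k y z (u · w) (v · w))
  where
  lemma : ∀ j x k y z U V → (j * x + k * y) * z + (j * U + k * V) ≡ j * (x * z + U) + k * (y * z + V)
  lemma = solve-∀

·-comb : ∀ {n} (z : Vec ℤ n) j u k v → z · comb j u k v ≡ j * (z · u) + k * (z · v)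
·-comb z j u k v = trans (·-comm z (comb j u k v)) (trans (comb-· j u k v z)
  (cong₂ (λ x y → j * x + k * y) (·-comm u z) (·-comm v z)))

0-· : ∀ {n} (z : Vec ℤ n) → Vec.replicate n 0ℤ · z ≡ 0ℤ
0-· []      = refl
0-· (x ∷ z) = trans (ℤ.+-identityˡ _) (0-· z)

∥_∥ : ∀ {n} → Vec ℤ n → ℕ
∥ [] ∥    = 0
∥ x ∷ u ∥ = ∣ x ∣ ℕ.+ ∥ u ∥

∣·∣≤ : ∀ {n} (u z : Vec ℤ n) t → All (λ i → ∣ i ∣ ℕ.≤ t) z → ∣ u · z ∣ ℕ.≤ ∥ u ∥ ℕ.* t
∣·∣≤ []      []      t []       = ℕ.z≤n
∣·∣≤ (x ∷ u) (z ∷ w) t (z≤t ∷ w≤t) = begin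
  ∣ x * z + u · w ∣              ≤⟨ ℤ.∣i+j∣≤∣i∣+∣j∣ (x * z) (u · w) ⟩
  ∣ x * z ∣ ℕ.+ ∣ u · w ∣        ≡⟨ cong (ℕ._+ ∣ u · w ∣) (ℤ.abs-* x z) ⟩
  ∣ x ∣ ℕ.* ∣ z ∣ ℕ.+ ∣ u · w ∣  ≤⟨ ℕ.+-mono-≤ (ℕ.*-monoʳ-≤ ∣ x ∣ z≤t) (∣·∣≤ u w t w≤t) ⟩
  ∣ x ∣ ℕ.* t ℕ.+ ∥ u ∥ ℕ.* t    ≡⟨ ℕ.*-distribʳ-+ t ∣ x ∣ ∥ u ∥ ⟨
  (∣ x ∣ ℕ.+ ∥ u ∥) ℕ.* t        ∎
  where open ℕ.≤-Reasoning

-- Polynomials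

infixl 6 _⊞_
infixl 7 _⊠_

scale : ℤ → Poly ℤ → Poly ℤ
scale k = List.map (k *_)

_⊞_ : Poly ℤ → Poly ℤ → Poly ℤ
[]      ⊞ q       = q
(a ∷ p) ⊞ []      = a ∷ p
(a ∷ p) ⊞ (b ∷ q) = (a + b) ∷ (p ⊞ q)

_⊠_ : Poly ℤ → Poly ℤ → Poly ℤ
[]      ⊠ q = []
(a ∷ p) ⊠ q = scale a q ⊞ (0ℤ ∷ p ⊠ q)

scale-eval : ∀ k p t → scale k p ⟨ t ⟩ ≡ k * p ⟨ t ⟩
scale-eval k []      t = sym (ℤ.*-zeroʳ k)
scale-eval k (a ∷ p) t = trans (cong (λ y → k * a + t * y) (scale-eval k p t)) (lemma k a t (p ⟨ t ⟩))
  where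
  lemma : ∀ k a t P → k * a + t * (k * P) ≡ k * (a + t * P)
  lemma = solve-∀

⊞-eval : ∀ p q t → (p ⊞ q) ⟨ t ⟩ ≡ p ⟨ t ⟩ + q ⟨ t ⟩
⊞-eval []      q       t = sym (ℤ.+-identityˡ _)
⊞-eval (a ∷ p) []      t = sym (ℤ.+-identityʳ _)
⊞-eval (a ∷ p) (b ∷ q) t = trans (cong (λ y → a + b + t * y) (⊞-eval p q t)) (lemma a b t (p ⟨ t ⟩) (q ⟨ t ⟩))
  where
  lemma : ∀ a b t P Q → a + b + t * (P + Q) ≡ (a + t * P) + (b + t * Q)
  lemma = solve-∀

⊠-eval : ∀ p q t → (p ⊠ q) ⟨ t ⟩ ≡ p ⟨ t ⟩ * q ⟨ t ⟩
⊠-eval []      q t = sym (ℤ.*-zeroˡ (q ⟨ t ⟩))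
⊠-eval (a ∷ p) q t =
  trans (⊞-eval (scale a q) (0ℤ ∷ p ⊠ q) t)
  (trans (cong₂ (λ x y → x + (0ℤ + t * y)) (scale-eval a q t) (⊠-eval p q t)) (lemma a t (p ⟨ t ⟩) (q ⟨ t ⟩)))
  where
  lemma : ∀ a t P Q → a * Q + (0ℤ + t * (P * Q)) ≡ (a + t * P) * Q
  lemma = solve-∀

constant : ℤ → Poly ℤ
constant a = a ∷ []

constant-eval : ∀ a t → constant a ⟨ t ⟩ ≡ a
constant-eval a t = trans (cong (λ y → a + y) (ℤ.*-zeroʳ t)) (ℤ.+-identityʳ a)

SignOn : (ℕ → Set) → (ℕ → ℤ) → Set
SignOn D u = (∀ t → D t → u t ≡ 0ℤ) ⊎ (∀ t → D t → 0ℤ < u t) ⊎ (∀ t → D t → u t < 0ℤ)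

-- In Horner's form `a + t * p(t)` the tail decides unless it vanishes: a nonzero integer has
-- absolute value at least 1, so `t > |a|` makes the second summand outweigh `a`.
poly-sign : ∀ p → ∃[ N ] SignOn (N ℕ.≤_) (λ t → p ⟨ + t ⟩)
poly-sign [] = 0 , inj₁ λ _ _ → refl
poly-sign (a ∷ p) with poly-sign p
... | N , inj₁ p≡0 = N , helper (ℤ.<-cmp a 0ℤ)
  where
  value : ∀ t → N ℕ.≤ t → a ≡ (a ∷ p) ⟨ + t ⟩
  value t N≤t = trans (lemma a (+ t)) (cong (λ y → a + + t * y) (sym (p≡0 t N≤t)))
    where
    lemma : ∀ a t → a ≡ a + t * 0ℤ
    lemma = solve-∀
  helper : _ → SignOn (N ℕ.≤_) (λ t → (a ∷ p) ⟨ + t ⟩)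
  helper (tri< a<0 _ _) = inj₂ (inj₂ λ t N≤t → subst (_< 0ℤ) (value t N≤t) a<0)
  helper (tri≈ _ a≡0 _) = inj₁ λ t N≤t → trans (sym (value t N≤t)) a≡0
  helper (tri> _ _ a>0) = inj₂ (inj₁ λ t N≤t → subst (0ℤ <_) (value t N≤t) a>0)
... | N , inj₂ (inj₁ p>0) = N ℕ.⊔ suc ∣ a ∣ , inj₂ (inj₁ λ t ≤t →
    let N≤t = ℕ.m⊔n≤o⇒m≤o N _ ≤t
        a<t = ℕ.m⊔n≤o⇒n≤o N _ ≤t
        open ℤ.≤-Reasoning
    in begin-strict
      0ℤ                    ≡⟨ ℤ.+-inverseˡ (+ ∣ a ∣) ⟨
      - + ∣ a ∣ + + ∣ a ∣   <⟨ ℤ.+-mono-≤-< (-∣i∣≤i a) (ℤ.+<+ a<t) ⟩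
      a + + t               ≡⟨ cong (λ y → a + y) (ℤ.*-identityʳ (+ t)) ⟨
      a + + t * 1ℤ          ≤⟨ ℤ.+-monoʳ-≤ a (ℤ.*-monoˡ-≤-nonNeg (+ t) (ℤ.i<j⇒suc[i]≤j (p>0 t N≤t))) ⟩
      a + + t * p ⟨ + t ⟩   ∎)
... | N , inj₂ (inj₂ p<0) = N ℕ.⊔ suc ∣ a ∣ , inj₂ (inj₂ λ t ≤t →
    let N≤t = ℕ.m⊔n≤o⇒m≤o N _ ≤t
        a<t = ℕ.m⊔n≤o⇒n≤o N _ ≤t
        open ℤ.≤-Reasoning
    in begin-strict
      a + + t * p ⟨ + t ⟩   ≤⟨ ℤ.+-monoʳ-≤ a (ℤ.*-monoˡ-≤-nonNeg (+ t) (ℤ.i<j⇒i≤pred[j] (p<0 t N≤t))) ⟩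
      a + + t * -1ℤ         ≡⟨ cong (λ y → a + y) (trans (ℤ.*-comm (+ t) -1ℤ) (ℤ.-1*i≡-i (+ t))) ⟩
      a + - + t             <⟨ ℤ.+-mono-≤-< (i≤∣i∣ a) (ℤ.neg-mono-< (ℤ.+<+ a<t)) ⟩
      + ∣ a ∣ + - + ∣ a ∣   ≡⟨ ℤ.+-inverseʳ (+ ∣ a ∣) ⟩
      0ℤ                    ∎)

-- Statements that hold eventually on each residue class

Domain : Set₁
Domain = Pred ℕ 0ℓ

residue : (d : ℕ) → .{{ℕ.NonZero d}} → ℕ → ℕ → Domain
residue d r N t = N ℕ.≤ t × t % d ≡ r

Piecewise : (Domain → Set) → Set
Piecewise Φ = Σ ℕ λ d → Σ (ℕ.NonZero d) λ d≢0 → let instance _ = d≢0 in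
  ∀ r → ∃[ N ] Φ (residue d r N)

Antitone : (Domain → Set) → Set₁
Antitone Φ = ∀ {D E : Domain} → E ⊆ D → Φ D → Φ E

piecewise-map : ∀ {Φ Ψ : Domain → Set} → (∀ D → Φ D → Ψ D) → Piecewise Φ → Piecewise Ψ
piecewise-map f (d , d≢0 , φ) = d , d≢0 , λ r → let N , x = φ r in N , f _ x

piecewise-eventually : ∀ {Φ Ψ : Domain → Set} → Antitone Φ →
  (∀ {D} → Φ D → ∃[ N ] Ψ (λ t → N ℕ.≤ t × D t)) → Antitone Ψ →
  Piecewise Φ → Piecewise Ψ
piecewise-eventually antiΦ f antiΨ (d , d≢0 , φ) = d , d≢0 , λ r →
  let M , x = φ r ; N , y = f x
  in M ⊔ N , antiΨ (λ (≤t , ≡r) → ℕ.m⊔n≤o⇒n≤o M N ≤t , ℕ.m⊔n≤o⇒m≤o M N ≤t , ≡r) y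

-- The residue of `t` modulo `d * e` determines its residues modulo `d` and `e`, so both families
-- can be restricted to the classes of the product modulus.
piecewise-× : ∀ {Φ Ψ : Domain → Set} → Antitone Φ → Antitone Ψ →
  Piecewise Φ → Piecewise Ψ → Piecewise (λ D → Φ D × Ψ D)
piecewise-× antiΦ antiΨ (d , d≢0 , φ) (e , e≢0 , ψ) = d ℕ.* e , de≢0 , λ r →
  let M , x = φ (r % d) ; N , y = ψ (r % e)
  in M ⊔ N
   , antiΦ (λ {t} (≤t , ≡r) → ℕ.m⊔n≤o⇒m≤o M N ≤t ,
       trans (sym (ℕ.m∣n⇒o%n%m≡o%m d (d ℕ.* e) t (ℕ.m∣m*n e))) (cong (_% d) ≡r)) x
   , antiΨ (λ {t} (≤t , ≡r) → ℕ.m⊔n≤o⇒n≤o M N ≤t ,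
       trans (sym (ℕ.m∣n⇒o%n%m≡o%m e (d ℕ.* e) t (ℕ.n∣m*n d))) (cong (_% e) ≡r)) y
  where
  instance
    _ = d≢0
    _ = e≢0
    de≢0 : ℕ.NonZero (d ℕ.* e)
    de≢0 = ℕ.m*n≢0 d e

piecewise-const : ∀ {Φ : Domain → Set} → ∃[ N ] Φ (N ℕ.≤_) → Antitone Φ → Piecewise Φ
piecewise-const (N , x) anti = 1 , ℕ.nonZero , λ r → N , anti proj₁ x

-- On D, u is a polynomial with rational coefficients of common denominator m.
Rep : Domain → (ℕ → ℤ) → Set
Rep D u = Σ ℤ λ m → m ≢ 0ℤ × ∃[ p ] ∀ t → D t → m * u t ≡ p ⟨ + t ⟩

rep-anti : ∀ {u} → Antitone (λ D → Rep D u)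
rep-anti E⊆D (m , m≢0 , p , eq) = m , m≢0 , p , λ t t∈E → eq t (E⊆D t∈E)

rep-poly : ∀ {D} p → Rep D (λ t → p ⟨ + t ⟩)
rep-poly p = 1ℤ , (λ ()) , p , λ t _ → ℤ.*-identityˡ _

rep-cong : ∀ {D u v} → (∀ t → D t → u t ≡ v t) → Rep D u → Rep D v
rep-cong u≡v (m , m≢0 , p , eq) = m , m≢0 , p , λ t t∈D →
  trans (cong (m *_) (sym (u≡v t t∈D))) (eq t t∈D)

*≢0 : ∀ {i j} → i ≢ 0ℤ → j ≢ 0ℤ → i * j ≢ 0ℤ
*≢0 {i} i≢0 j≢0 ij≡0 with ℤ.i*j≡0⇒i≡0∨j≡0 i ij≡0
... | inj₁ i≡0 = i≢0 i≡0
... | inj₂ j≡0 = j≢0 j≡0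

rep-+ : ∀ {D u v} → Rep D u → Rep D v → Rep D (λ t → u t + v t)
rep-+ {u = u} {v} (m , m≢0 , p , eq) (k , k≢0 , q , eq′) =
  m * k , *≢0 m≢0 k≢0 , scale k p ⊞ scale m q , λ t t∈D →
    trans (lemma m k (u t) (v t)) (trans (cong₂ (λ x y → k * x + m * y) (eq t t∈D) (eq′ t t∈D))
    (sym (trans (⊞-eval (scale k p) (scale m q) (+ t))
      (cong₂ _+_ (scale-eval k p (+ t)) (scale-eval m q (+ t))))))
  where
  lemma : ∀ m k u v → m * k * (u + v) ≡ k * (m * u) + m * (k * v)
  lemma = solve-∀

rep-* : ∀ {D u v} → Rep D u → Rep D v → Rep D (λ t → u t * v t)
rep-* {u = u} {v} (m , m≢0 , p , eq) (k , k≢0 , q , eq′) =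
  m * k , *≢0 m≢0 k≢0 , p ⊠ q , λ t t∈D →
    trans (lemma m k (u t) (v t)) (trans (cong₂ _*_ (eq t t∈D) (eq′ t t∈D)) (sym (⊠-eval p q (+ t))))
  where
  lemma : ∀ m k u v → m * k * (u * v) ≡ m * u * (k * v)
  lemma = solve-∀

rep-const : ∀ {D} a → Rep D (λ _ → a)
rep-const a = rep-cong (λ t _ → constant-eval a (+ t)) (rep-poly (constant a))

-- The source of denominators: an eliminated coordinate is known only through its multiple by a
-- coefficient.
rep-cancel : ∀ {D u} k → k ≢ 0ℤ → Rep D (λ t → k * u t) → Rep D u
rep-cancel {u = u} k k≢0 (m , m≢0 , p , eq) = m * k , *≢0 m≢0 k≢0 , p , λ t t∈D →
  trans (ℤ.*-assoc m k (u t)) (eq t t∈D)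

Curve : ℕ → Set
Curve n = Vec (ℕ → ℤ) n

at : ∀ {n} → Curve n → ℕ → Vec ℤ n
at g t = Vec.map (λ u → u t) g

values : ∀ {n} → List (Curve n) → ℕ → List (Vec ℤ n)
values G t = List.map (λ g → at g t) G

rep-· : ∀ {D n} (P : Vec (Poly ℤ) n) (g : Curve n) → All (Rep D) g →
  Rep D (λ t → Vec.map _⟨ + t ⟩ P · at g t)
rep-· []      []      []      = rep-const 0ℤ
rep-· (p ∷ P) (u ∷ g) (x ∷ xs) = rep-+ (rep-* (rep-poly p) x) (rep-· P g xs)

rep-·-const : ∀ {D n} (a : Vec ℤ n) (g : Curve n) → All (Rep D) g → Rep D (λ t → a · at g t)
rep-·-const []      []      []      = rep-const 0ℤ
rep-·-const (k ∷ a) (u ∷ g) (x ∷ xs) = rep-+ (rep-* (rep-const k) x) (rep-·-const a g xs)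

-- The denominator `m` may be negative, so the sign is read off `m * p`, which equals `m * m * u` on
-- `D`.
rep-sign : ∀ {D u} → Rep D u → ∃[ N ] SignOn (λ t → N ℕ.≤ t × D t) u
rep-sign {D} {u} (m , m≢0 , p , eq) = N , result (proj₂ (poly-sign (scale m p)))
  where
  instance
    _ : ℤ.NonZero m
    _ = ℤ.≢-nonZero m≢0
    _ : ℤ.NonNegative (m * m)
    _ = ℤ.nonNegative (i*i≥0 m)
    _ : ℤ.Positive (m * m)
    _ = ℤ.positive (i*i>0 m)
  N = proj₁ (poly-sign (scale m p))
  value : ∀ t → D t → m * m * u t ≡ scale m p ⟨ + t ⟩
  value t t∈D = trans (ℤ.*-assoc m m (u t)) (trans (cong (m *_) (eq t t∈D)) (sym (scale-eval m p (+ t))))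
  result : SignOn (N ℕ.≤_) (λ t → scale m p ⟨ + t ⟩) → SignOn (λ t → N ℕ.≤ t × D t) u
  result (inj₁ ≡0) = inj₁ λ t (N≤t , t∈D) →
    ℤ.*-cancelˡ-≡ (m * m) (u t) 0ℤ {{ℤ.≢-nonZero (*≢0 m≢0 m≢0)}}
      (trans (value t t∈D) (trans (≡0 t N≤t) (sym (ℤ.*-zeroʳ (m * m)))))
  result (inj₂ (inj₁ >0)) = inj₂ (inj₁ λ t (N≤t , t∈D) → ℤ.*-cancelˡ-<-nonNeg (m * m)
    (subst₂ _<_ (sym (ℤ.*-zeroʳ (m * m))) (sym (value t t∈D)) (>0 t N≤t)))
  result (inj₂ (inj₂ <0)) = inj₂ (inj₂ λ t (N≤t , t∈D) → ℤ.*-cancelˡ-<-nonNeg (m * m)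
    (subst₂ _<_ (sym (value t t∈D)) (sym (ℤ.*-zeroʳ (m * m))) (<0 t N≤t)))

-- Covers

module _ (ℓ : ℕ) where

  Dominated : ∀ {n} → Pred (Vec ℤ n) 0ℓ → Vec ℤ n → Vec ℤ n → Set
  Dominated T v z = ∃[ ys ] Unique ys × length ys ≡ ℓ × ListAll (λ y → T y × v · z ≤ v · y) ys

  -- The condition is required for every objective v and is insensitive to ties, so
  -- that covers compose and covers of the pieces of a union may overlap.
  Covers : ∀ {n} → Pred (Vec ℤ n) 0ℓ → Pred (Vec ℤ n) 0ℓ → Set
  Covers S T = ∀ v z → S z → T z ⊎ Dominated T v z

  dominated-⊆ : ∀ {n} {T T′ : Pred (Vec ℤ n) 0ℓ} {v z} → T ⊆ T′ → Dominated T v z → Dominated T′ v z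
  dominated-⊆ T⊆T′ (ys , uniq , len , all) =
    ys , uniq , len , ListAll.map (λ (y∈T , z≤y) → T⊆T′ y∈T , z≤y) all

  all-or-any : ∀ {A : Set} {P Q R : A → Set} → (∀ x → P x → Q x ⊎ R x) →
    ∀ {xs} → ListAll P xs → ListAll Q xs ⊎ Any (λ x → P x × R x) xs
  all-or-any f [] = inj₁ []
  all-or-any f (p ∷ ps) with f _ p | all-or-any f ps
  ... | inj₂ r | _       = inj₂ (here (p , r))
  ... | inj₁ q | inj₁ qs = inj₁ (q ∷ qs)
  ... | inj₁ q | inj₂ rs = inj₂ (there rs)

  -- Each of the `ℓ` dominating points of `T` lies in `G` or is dominated by `ℓ` points of `G`. If
  -- all lie in `G`, they still dominate `z`; otherwise the dominators of a single exceptional one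
  -- already suffice, so no points from different lists have to be combined or counted.
  covers-trans : ∀ {n} {S T G : Pred (Vec ℤ n) 0ℓ} → Covers S T → Covers T G → Covers S G
  covers-trans {T = T} {G} S▷T T▷G v z z∈S with S▷T v z z∈S
  ... | inj₁ z∈T = T▷G v z z∈T
  ... | inj₂ (ys , uniq , len , all)
    with all-or-any {Q = λ y → G y × v · z ≤ v · y} {R = Dominated G v}
           (λ y (y∈T , z≤y) → case T▷G v y y∈T of λ where
             (inj₁ y∈G) → inj₁ (y∈G , z≤y)
             (inj₂ dom) → inj₂ dom) all
  ... | inj₁ all′ = inj₂ (ys , uniq , len , all′)
  ... | inj₂ some with Any.satisfied some
  ... | y , (_ , z≤y) , ys′ , uniq′ , len′ , all′ =
    inj₂ (ys′ , uniq′ , len′ , ListAll.map (λ (y′∈G , y≤y′) → y′∈G , ℤ.≤-trans z≤y y≤y′) all′)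

  Family : ℕ → Set₁
  Family n = ℕ → Pred (Vec ℤ n) 0ℓ

  -- Curves of `G` may meet or coincide: only membership matters here, and repetitions are removed
  -- just before values are counted.
  GoodOn : ∀ {n} → Family n → Domain → Set
  GoodOn S D = ∃[ G ] ListAll (All (Rep D)) G ×
    ∀ t → D t → ListAll (S t) (values G t) × Covers (S t) (_∈ values G t)

  Good : ∀ {n} → Family n → Set
  Good S = Piecewise (GoodOn S)

  goodOn-anti : ∀ {n} {S : Family n} → Antitone (GoodOn S)
  goodOn-anti E⊆D (G , rep , good) =
    G , ListAll.map (All.map (λ {u} → rep-anti {u} E⊆D)) rep , λ t t∈E → good t (E⊆D t∈E)

  good-cover : ∀ {n} {S T : Family n} → ∃[ N ] (∀ t → N ℕ.≤ t → T t ⊆ S t × Covers (S t) (T t)) →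
    Good T → Good S
  good-cover {S = S} {T} (N , ev) = piecewise-eventually (goodOn-anti {S = T})
    (λ (G , rep , good) → N , G ,
      ListAll.map (All.map (λ {u} → rep-anti {u} proj₂)) rep , λ t (N≤t , t∈D) →
        let T⊆S , S▷T = ev t N≤t ; G⊆T , T▷G = good t t∈D
        in ListAll.map T⊆S G⊆T , covers-trans S▷T T▷G)
    (goodOn-anti {S = S})

  good-ext : ∀ {n} {S T : Family n} → (∀ t → T t ⊆ S t) → (∀ t → S t ⊆ T t) → Good T → Good S
  good-ext T⊆S S⊆T = good-cover (0 , λ t _ → T⊆S t , λ v z z∈S → inj₁ (S⊆T t z∈S))

  good-∅ : ∀ {n} {S : Family n} → (∀ t z → ¬ S t z) → Good S
  good-∅ {S = S} empty = piecewise-const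
    (0 , [] , [] , λ t _ → [] , λ v z z∈S → inj₁ (⊥-elim (empty t z z∈S))) (goodOn-anti {S = S})

  good-∪ : ∀ {n} {S T : Family n} → Good S → Good T → Good (λ t z → S t z ⊎ T t z)
  good-∪ {n} {S} {T} goodS goodT = piecewise-map union
    (piecewise-× (goodOn-anti {S = S}) (goodOn-anti {S = T}) goodS goodT)
    where
    union : ∀ D → GoodOn S D × GoodOn T D → GoodOn (λ t z → S t z ⊎ T t z) D
    union D ((G , repG , goodG) , (H , repH , goodH)) = G ++ H , ListAll.++⁺ repG repH , λ t t∈D →
      let G⊆S , S▷G = goodG t t∈D ; H⊆T , T▷H = goodH t t∈D
          eq : values (G ++ H) t ≡ values G t ++ values H t
          eq = List.map-++ (λ g → at g t) G H
          fromG : ∀ {z} → z ∈ values G t → z ∈ values (G ++ H) t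
          fromG z∈ = subst (_ ∈_) (sym eq) (∈-++⁺ˡ z∈)
          fromH : ∀ {z} → z ∈ values H t → z ∈ values (G ++ H) t
          fromH z∈ = subst (_ ∈_) (sym eq) (∈-++⁺ʳ (values G t) z∈)
      in subst (ListAll _) (sym eq) (ListAll.++⁺ (ListAll.map inj₁ G⊆S) (ListAll.map inj₂ H⊆T))
       , λ where
           v z (inj₁ z∈S) → lift {values G t} {v = v} fromG (S▷G v z z∈S)
           v z (inj₂ z∈T) → lift {values H t} {v = v} fromH (T▷H v z z∈T)
      where
      lift : ∀ {xs ys v z} → (∀ {z} → z ∈ xs → z ∈ ys) →
        z ∈ xs ⊎ Dominated (_∈ xs) v z → z ∈ ys ⊎ Dominated (_∈ ys) v z
      lift xs⊆ys (inj₁ z∈)  = inj₁ (xs⊆ys z∈)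
      lift {v = v} xs⊆ys (inj₂ dom) = inj₂ (dominated-⊆ {v = v} xs⊆ys dom)

  good-⋃ : ∀ {n} {X : Set} (xs : List X) {S : X → Family n} → (∀ x → Good (S x)) →
    Good (λ t z → Any (λ x → S x t z) xs)
  good-⋃ []       good = good-∅ λ t z ()
  good-⋃ (x ∷ xs) {S} good = good-ext
    (λ t → λ where (inj₁ z∈) → here z∈ ; (inj₂ z∈) → there z∈)
    (λ t → λ where (here z∈) → inj₁ z∈ ; (there z∈) → inj₂ z∈)
    (good-∪ (good x) (good-⋃ xs {S} good))

  unique-map : ∀ {A B : Set} {P : A → Set} (φ : A → B) →
    (∀ {x y} → P x → P y → φ x ≡ φ y → x ≡ y) →
    ∀ {xs} → ListAll P xs → Unique xs → Unique (List.map φ xs)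
  unique-map φ inj []       []           = []
  unique-map φ inj (p ∷ ps) (x∉xs ∷ uniq) =
    ListAll.map⁺ (ListAll.zipWith (λ (q , x≢y) φx≡φy → x≢y (inj p q φx≡φy)) (ps , x∉xs)) ∷ unique-map φ inj ps uniq

  -- Injectivity keeps `ℓ` dominating points distinct. The pulled-back objective `w` only has to
  -- respect the order on `S t`, so it may be rescaled, shifted by a constant and chosen anew for
  -- each `t`; this is where covers for all objectives are used.
  good-image : ∀ {n m} {S : Family n} {T : Family m} (φ : ℕ → Vec ℤ n → Vec ℤ m) →
    (∀ t z → S t z → T t (φ t z)) →
    (∀ t x → T t x → ∃[ z ] S t z × φ t z ≡ x) →
    (∀ t {z z′} → S t z → S t z′ → φ t z ≡ φ t z′ → z ≡ z′) →
    (∀ t v → ∃[ w ] ∀ {z z′} → S t z → S t z′ → w · z ≤ w · z′ → v · φ t z ≤ v · φ t z′) →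
    (∀ {D} g → All (Rep D) g → (∀ t → D t → S t (at g t)) →
      ∃[ h ] All (Rep D) h × ∀ t → D t → at h t ≡ φ t (at g t)) →
    Good S → Good T
  good-image {n} {m} {S} {T} φ to from inj obj rep = piecewise-map image
    where
    image : ∀ D → GoodOn S D → GoodOn T D
    image D (G , repG , good) = proj₁ transport , proj₁ (proj₂ transport) , λ t t∈D →
      let G⊆S , S▷G = good t t∈D
          eq = proj₂ (proj₂ transport) t t∈D
      in subst (ListAll (T t)) (sym eq) (ListAll.map⁺ (ListAll.map (λ {z} → to t z) G⊆S))
       , λ v x x∈T →
           let z , z∈S , φz≡x = from t x x∈T ; w , mono = obj t v in
           subst (λ zs → x ∈ zs ⊎ Dominated (_∈ zs) v x) (sym eq)
             (subst (λ x → x ∈ _ ⊎ Dominated (_∈ _) v x) φz≡x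
               (push {t} {values G t} {v} {w} G⊆S z∈S mono (S▷G w z z∈S)))
      where
      push : ∀ {t zs v w z} → ListAll (S t) zs → S t z →
        (∀ {z z′} → S t z → S t z′ → w · z ≤ w · z′ → v · φ t z ≤ v · φ t z′) →
        z ∈ zs ⊎ Dominated (_∈ zs) w z →
        φ t z ∈ List.map (φ t) zs ⊎ Dominated (_∈ List.map (φ t) zs) v (φ t z)
      push {t} zs⊆S z∈S mono (inj₁ z∈zs) = inj₁ (∈-map⁺ (φ t) z∈zs)
      push {t} zs⊆S z∈S mono (inj₂ (ys , uniq , len , all)) = inj₂
        ( List.map (φ t) ys
        , unique-map (φ t) (inj t) (ListAll.map (λ (y∈ , _) → ListAll.lookup zs⊆S y∈) all) uniq
        , trans (List.length-map (φ t) ys) len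
        , ListAll.map⁺ (ListAll.map (λ (y∈ , z≤y) →
            ∈-map⁺ (φ t) y∈ , mono z∈S (ListAll.lookup zs⊆S y∈) z≤y) all))
      transport : ∃[ H ] ListAll (All (Rep D)) H × ∀ t → D t → values H t ≡ List.map (φ t) (values G t)
      transport = go G repG (λ t t∈D → proj₁ (good t t∈D))
        where
        go : ∀ G → ListAll (All (Rep D)) G → (∀ t → D t → ListAll (S t) (values G t)) →
          ∃[ H ] ListAll (All (Rep D)) H × ∀ t → D t → values H t ≡ List.map (φ t) (values G t)
        go []      []         _   = [] , [] , λ _ _ → refl
        go (g ∷ G) (rg ∷ rG) G⊆S =
          let h , rh , eq  = rep g rg (λ t t∈D → ListAll.head (G⊆S t t∈D))
              H , rH , eqs = go G rG (λ t t∈D → ListAll.tail (G⊆S t t∈D))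
          in h ∷ H , rh ∷ rH , λ t t∈D → cong₂ _∷_ (eq t t∈D) (eqs t t∈D)

-- Linear systems with congruences

Lin : ℕ → Set
Lin n = Vec ℤ n × Poly ℤ

⟦_⟧ : ∀ {n} → Lin n → ℕ → Vec ℤ n → ℤ
⟦ a , p ⟧ t z = a · z + p ⟨ + t ⟩

record Congruence (n : ℕ) : Set where
  constructor _⋮_
  field
    modulus     : ℤ
    form        : Lin n
    .{{nonZero}} : ℤ.NonZero modulus

open Congruence

Box : ∀ {n} → ℕ → Vec ℤ n → Set
Box t = All (λ i → 0ℤ ≤ i × i < + t)

Nonneg : ∀ {n} → List (Lin n) → ℕ → Vec ℤ n → Set
Nonneg Γ t z = ListAll (λ l → 0ℤ ≤ ⟦ l ⟧ t z) Γ

Divisible : ∀ {n} → List (Congruence n) → ℕ → Vec ℤ n → Set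
Divisible Κ t z = ListAll (λ κ → modulus κ ∣ ⟦ form κ ⟧ t z) Κ

System : ∀ {n} → List (Lin n) → List (Congruence n) → ℕ → Vec ℤ n → Set
System Γ Κ t z = Box t z × Nonneg Γ t z × Divisible Κ t z

-- Conditions on `t` alone

Decided : (ℕ → Set) → Domain → Set
Decided P D = (∀ t → D t → P t) ⊎ (∀ t → D t → ¬ P t)

decided-anti : ∀ {P} → Antitone (Decided P)
decided-anti E⊆D (inj₁ all)  = inj₁ λ t t∈E → all t (E⊆D t∈E)
decided-anti E⊆D (inj₂ none) = inj₂ λ t t∈E → none t (E⊆D t∈E)

decided-× : ∀ {P Q} → Piecewise (Decided P) → Piecewise (Decided Q) → Piecewise (Decided (λ t → P t × Q t))
decided-× {P} {Q} p q = piecewise-map both (piecewise-× (decided-anti {P}) (decided-anti {Q}) p q)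
  where
  both : ∀ D → Decided P D × Decided Q D → Decided (λ t → P t × Q t) D
  both D (inj₁ x , inj₁ y) = inj₁ λ t t∈D → x t t∈D , y t t∈D
  both D (inj₁ x , inj₂ y) = inj₂ λ t t∈D → y t t∈D ∘ proj₂
  both D (inj₂ x , _)      = inj₂ λ t t∈D → x t t∈D ∘ proj₁

decided-cong : ∀ {P Q} → (∀ t → P t → Q t) → (∀ t → Q t → P t) →
  Piecewise (Decided P) → Piecewise (Decided Q)
decided-cong {P} {Q} f g = piecewise-map {Decided P} {Decided Q} λ D → λ where
  (inj₁ x) → inj₁ λ t t∈D → f t (x t t∈D)
  (inj₂ x) → inj₂ λ t t∈D → x t t∈D ∘ g t

decided-All : ∀ {A : Set} {P : A → ℕ → Set} → (∀ x → Piecewise (Decided (P x))) →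
  ∀ xs → Piecewise (Decided (λ t → ListAll (λ x → P x t) xs))
decided-All {P = P} p []       = piecewise-const (0 , inj₁ λ _ _ → []) (decided-anti {λ t → ListAll (λ x → P x t) []})
decided-All {P = P} p (x ∷ xs) = decided-cong {λ t → P x t × ListAll (λ x → P x t) xs}
  (λ t (q , qs) → q ∷ qs) (λ { t (q ∷ qs) → q , qs }) (decided-× {P x} (p x) (decided-All p xs))

decided-nonneg : ∀ p → Piecewise (Decided (λ t → 0ℤ ≤ p ⟨ + t ⟩))
decided-nonneg p = piecewise-const (N , result s) (decided-anti {λ t → 0ℤ ≤ p ⟨ + t ⟩})
  where
  N = proj₁ (poly-sign p)
  s = proj₂ (poly-sign p)
  result : SignOn (N ℕ.≤_) (λ t → p ⟨ + t ⟩) → Decided (λ t → 0ℤ ≤ p ⟨ + t ⟩) (N ℕ.≤_)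
  result (inj₁ ≡0)        = inj₁ λ t N≤t → ℤ.≤-reflexive (sym (≡0 t N≤t))
  result (inj₂ (inj₁ >0)) = inj₁ λ t N≤t → ℤ.<⇒≤ (>0 t N≤t)
  result (inj₂ (inj₂ <0)) = inj₂ λ t N≤t → ℤ.<⇒≱ (<0 t N≤t)

poly-periodic : ∀ {q} p i j → q ∣ i - j → q ∣ p ⟨ i ⟩ - p ⟨ j ⟩
poly-periodic []      i j q∣ = divides 0ℤ refl
poly-periodic {q} (a ∷ p) i j q∣ = subst (q ∣_) (lemma a i j (p ⟨ i ⟩) (p ⟨ j ⟩))
  (∣m∣n⇒∣m+n (∣n⇒∣m*n i (poly-periodic p i j q∣)) (∣m⇒∣m*n (p ⟨ j ⟩) q∣))
  where
  lemma : ∀ a i j P Q → i * (P - Q) + (i - j) * Q ≡ (a + i * P) - (a + j * Q)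
  lemma = solve-∀

-- An integer polynomial respects congruences modulo `q`, so the residue of `t` modulo `|q|` settles
-- the condition without any threshold.
decided-divides : ∀ q → .{{ℤ.NonZero q}} → ∀ p → Piecewise (Decided (λ t → q ∣ p ⟨ + t ⟩))
decided-divides q p = ∣ q ∣ , ∣q∣≢0 , λ r → 0 , decide r (q ∣? p ⟨ + r ⟩)
  where
  instance
    ∣q∣≢0 : ℕ.NonZero ∣ q ∣
    ∣q∣≢0 = ℕ.≢-nonZero λ eq → nonZero⁻¹ q (ℤ.∣i∣≡0⇒i≡0 eq)
  quotient-form : ∀ {t r} → t % ∣ q ∣ ≡ r → + t - + r ≡ + (t / ∣ q ∣) * + ∣ q ∣
  quotient-form {t} {r} refl = trans (cong (λ s → + s - + r) (ℕ.m≡m%n+[m/n]*n t ∣ q ∣))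
    (trans (cong (_- + r) (trans (ℤ.pos-+ r _) (cong (λ s → + r + s) (ℤ.pos-* (t / ∣ q ∣) ∣ q ∣)))) (lemma (+ r) _))
    where
    lemma : ∀ r s → r + s - r ≡ s
    lemma = solve-∀
  congruent : ∀ {t r} → t % ∣ q ∣ ≡ r → q ∣ p ⟨ + t ⟩ - p ⟨ + r ⟩
  congruent ≡r = poly-periodic p _ _ (∣-trans m∣∣m∣ (divides (+ (_ / ∣ q ∣)) (quotient-form ≡r)))
  decide : ∀ r → Dec (q ∣ p ⟨ + r ⟩) → Decided (λ t → q ∣ p ⟨ + t ⟩) (residue ∣ q ∣ r 0)
  decide r (yes q∣) = inj₁ λ t (_ , ≡r) →
    subst (q ∣_) (lemma (p ⟨ + t ⟩) (p ⟨ + r ⟩)) (∣m∣n⇒∣m+n (congruent {t} ≡r) q∣)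
    where
    lemma : ∀ P R → P - R + R ≡ P
    lemma = solve-∀
  decide r (no q∤) = inj₂ λ t (_ , ≡r) q∣ →
    q∤ (subst (q ∣_) (lemma (p ⟨ + t ⟩) (p ⟨ + r ⟩)) (∣m∣n⇒∣m+n q∣ (∣m⇒∣-m (congruent {t} ≡r))))
    where
    lemma : ∀ P R → P + - (P - R) ≡ R
    lemma = solve-∀

combLin : ∀ {n} → ℤ → Lin n → ℤ → Lin n → Lin n
combLin j (a , p) k (b , q) = comb j a k b , scale j p ⊞ scale k q

combLin-⟦⟧ : ∀ {n} j (l : Lin n) k m t z → ⟦ combLin j l k m ⟧ t z ≡ j * ⟦ l ⟧ t z + k * ⟦ m ⟧ t z
combLin-⟦⟧ j (a , p) k (b , q) t z =
  trans (cong₂ _+_ (comb-· j a k b z) (trans (⊞-eval (scale j p) (scale k q) (+ t))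
    (cong₂ _+_ (scale-eval j p (+ t)) (scale-eval k q (+ t)))))
  (lemma j (a · z) (p ⟨ + t ⟩) k (b · z) (q ⟨ + t ⟩))
  where
  lemma : ∀ j A P k B Q → (j * A + k * B) + (j * P + k * Q) ≡ j * (A + P) + k * (B + Q)
  lemma = solve-∀

rep-⟦⟧ : ∀ {D n} (l : Lin n) (g : Curve n) → All (Rep D) g → Rep D (λ t → ⟦ l ⟧ t (at g t))
rep-⟦⟧ (a , p) g rg = rep-+ (rep-·-const a g rg) (rep-poly p)

-- The value 0 is a mere default that keeps division total: on the points of a reduced system
-- divisibility is one of its congruences.
quot : ℤ → ℤ → ℤ
quot n d with d ∣? n
... | yes (divides q _) = q
... | no _              = 0ℤ

quot-exact : ∀ {n d} → d ∣ n → n ≡ quot n d * d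
quot-exact {n} {d} d∣n with d ∣? n
... | yes (divides q eq) = eq
... | no d∤n             = contradiction d∣n d∤n

first-failure : ∀ {P : ℕ → Set} → Unary.Decidable P → P 0 → ∀ n → ¬ P n →
  ∃[ J ] (∀ j → j ℕ.≤ J → P j) × ¬ P (suc J)
first-failure {P} P? p₀ n ¬pₙ = case search n of λ
  { (inj₁ all)   → contradiction (all n ℕ.≤-refl) ¬pₙ
  ; (inj₂ found) → found }
  where
  search : ∀ n → (∀ j → j ℕ.≤ n → P j) ⊎ ∃[ J ] (∀ j → j ℕ.≤ J → P j) × ¬ P (suc J)
  search zero = inj₁ λ { j ℕ.z≤n → p₀ }
  search (suc n) with search n
  ... | inj₂ found = inj₂ found
  ... | inj₁ all with P? (suc n)
  ...   | no ¬p = inj₂ (n , all , ¬p)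
  ...   | yes p = inj₁ λ j j≤ → case ℕ.m≤n⇒m<n∨m≡n j≤ of λ where
    (inj₁ (ℕ.s≤s j≤n)) → all j j≤n
    (inj₂ refl)        → p

-- Elimination of one variable

module Elimination (ℓ : ℕ) {n : ℕ} (Γ : List (Lin (suc n))) (Κ : List (Congruence (suc n))) where

  -- The box condition on the first coordinate, with `x < t` as `0 ≤ t - 1 - x`. As members of `Γ⁺`
  -- these two guarantee that a walk along the first axis is stopped by some constraint.
  lower upper : Lin (suc n)
  lower = (1ℤ ∷ Vec.replicate n 0ℤ) , []
  upper = (-1ℤ ∷ Vec.replicate n 0ℤ) , (-1ℤ ∷ 1ℤ ∷ [])

  Γ⁺ : List (Lin (suc n))
  Γ⁺ = lower ∷ upper ∷ Γ

  lead : Lin (suc n) → ℤ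
  lead (a , p) = Vec.head a

  rest : Lin (suc n) → Lin n
  rest (a , p) = Vec.tail a , p

  ⟦⟧-∷ : ∀ l t x z → ⟦ l ⟧ t (x ∷ z) ≡ lead l * x + ⟦ rest l ⟧ t z
  ⟦⟧-∷ ((a ∷ as) , p) t x z = ℤ.+-assoc (a * x) (as · z) (p ⟨ + t ⟩)

  lower-⟦⟧ : ∀ t x z → ⟦ lower ⟧ t (x ∷ z) ≡ x
  lower-⟦⟧ t x z = trans (cong (λ s → 1ℤ * x + s + 0ℤ) (0-· z)) (lemma x)
    where
    lemma : ∀ x → 1ℤ * x + 0ℤ + 0ℤ ≡ x
    lemma = solve-∀

  upper-⟦⟧ : ∀ t x z → ⟦ upper ⟧ t (x ∷ z) ≡ + t - (1ℤ + x)
  upper-⟦⟧ t x z = trans (cong (λ s → -1ℤ * x + s + _) (0-· z)) (lemma x (+ t))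
    where
    lemma : ∀ x t → -1ℤ * x + 0ℤ + (-1ℤ + t * (1ℤ + t * 0ℤ)) ≡ t - (1ℤ + x)
    lemma = solve-∀

  System⁺ : ℕ → Vec ℤ (suc n) → Set
  System⁺ t x = Box t (Vec.tail x) × Nonneg Γ⁺ t x × Divisible Κ t x

  system⁺⇒system : ∀ t x → System⁺ t x → System Γ Κ t x
  system⁺⇒system t (x ∷ z) (box , lo ∷ hi ∷ Γ≥0 , Κ∣) =
    ( subst (0ℤ ≤_) (lower-⟦⟧ t x z) lo
    , ℤ.suc[i]≤j⇒i<j (ℤ.0≤i-j⇒j≤i (subst (0ℤ ≤_) (upper-⟦⟧ t x z) hi))) ∷ box
    , Γ≥0 , Κ∣

  system⇒system⁺ : ∀ t x → System Γ Κ t x → System⁺ t x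
  system⇒system⁺ t (x ∷ z) ((0≤x , x<t) ∷ box , Γ≥0 , Κ∣) = box ,
    subst (0ℤ ≤_) (sym (lower-⟦⟧ t x z)) 0≤x ∷
    subst (0ℤ ≤_) (sym (upper-⟦⟧ t x z)) (ℤ.i≤j⇒0≤j-i (ℤ.i<j⇒suc[i]≤j x<t)) ∷ Γ≥0
    , Κ∣

  -- The condition on `lead b` belongs to the set, so a constraint that does not involve the first
  -- coordinate contributes an empty slab.
  Slab : Lin (suc n) → ℕ → ℕ → Vec ℤ (suc n) → Set
  Slab b k t x = System⁺ t x × lead b ≢ 0ℤ × ⟦ b ⟧ t x ≡ + k

  -- Fixing the slack of b at k determines the first coordinate; clearing
  -- denominators with the square of its coefficient keeps all signs.
  module Slabs (b : Lin (suc n)) (k : ℕ) (b₀≢0 : lead b ≢ 0ℤ) where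

    private
      b₀ = lead b
      instance
        _ : ℤ.NonZero b₀
        _ = ℤ.≢-nonZero b₀≢0
        _ : ℤ.NonZero (b₀ * b₀)
        _ = ℤ.≢-nonZero (*≢0 b₀≢0 b₀≢0)
        _ : ℤ.Positive (b₀ * b₀)
        _ = ℤ.positive (i*i>0 b₀)
        _ : ℤ.NonNegative (b₀ * b₀)
        _ = ℤ.nonNegative (i*i≥0 b₀)

    excess : Lin n
    excess = combLin 1ℤ (rest b) 1ℤ (Vec.replicate n 0ℤ , constant (- + k))

    excess-⟦⟧ : ∀ t z → ⟦ excess ⟧ t z ≡ ⟦ rest b ⟧ t z - + k
    excess-⟦⟧ t z = trans (combLin-⟦⟧ 1ℤ (rest b) 1ℤ (Vec.replicate n 0ℤ , constant (- + k)) t z)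
      (trans (cong (λ s → 1ℤ * ⟦ rest b ⟧ t z + 1ℤ * s)
        (cong₂ _+_ (0-· z) (constant-eval (- + k) (+ t)))) (lemma (⟦ rest b ⟧ t z) (+ k)))
      where
      lemma : ∀ B k → 1ℤ * B + 1ℤ * (0ℤ + - k) ≡ B - k
      lemma = solve-∀

    -- The form `c` at `x = - excess / b₀`, multiplied by `b₀ * b₀`.
    substituted : Lin (suc n) → Lin n
    substituted c = combLin (b₀ * b₀) (rest c) (- (b₀ * lead c)) excess

    substituted-⟦⟧ : ∀ c t x z → b₀ * x + ⟦ excess ⟧ t z ≡ 0ℤ →
      ⟦ substituted c ⟧ t z ≡ b₀ * b₀ * ⟦ c ⟧ t (x ∷ z)
    substituted-⟦⟧ c t x z eq =
      trans (combLin-⟦⟧ (b₀ * b₀) (rest c) (- (b₀ * lead c)) excess t z)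
      (trans (lemma b₀ (lead c) x (⟦ rest c ⟧ t z) (⟦ excess ⟧ t z))
      (trans (cong₂ (λ s u → b₀ * b₀ * s - b₀ * lead c * u) (sym (⟦⟧-∷ c t x z)) eq)
        (lemma′ b₀ (lead c) (⟦ c ⟧ t (x ∷ z)))))
      where
      lemma : ∀ b c x C E → b * b * C + - (b * c) * E ≡ b * b * (c * x + C) - b * c * (b * x + E)
      lemma = solve-∀
      lemma′ : ∀ b c X → b * b * X - b * c * 0ℤ ≡ b * b * X
      lemma′ = solve-∀

    Γ′ : List (Lin n)
    Γ′ = List.map substituted Γ⁺

    reduce : Congruence (suc n) → Congruence n
    reduce (q ⋮ c) = _⋮_ (q * (b₀ * b₀)) (substituted c)
      {{ℤ.≢-nonZero (*≢0 (nonZero⁻¹ q) (nonZero⁻¹ (b₀ * b₀)))}}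

    -- The new congruence says that the eliminated coordinate `- excess / b₀` is an integer. The old
    -- moduli are multiplied by `b₀ * b₀` because their forms are.
    Κ′ : List (Congruence n)
    Κ′ = (b₀ ⋮ excess) ∷ List.map reduce Κ

    lift : ℕ → Vec ℤ n → Vec ℤ (suc n)
    lift t z = - quot (⟦ excess ⟧ t z) b₀ ∷ z

    lift-eq : ∀ t z → b₀ ∣ ⟦ excess ⟧ t z → b₀ * (- quot (⟦ excess ⟧ t z) b₀) + ⟦ excess ⟧ t z ≡ 0ℤ
    lift-eq t z b₀∣ = trans (cong (λ s → b₀ * (- quot (⟦ excess ⟧ t z) b₀) + s) (quot-exact b₀∣)) (lemma b₀ _)
      where
      lemma : ∀ b q → b * (- q) + q * b ≡ 0ℤ
      lemma = solve-∀

    slack-eq : ∀ t x z → b₀ * x + ⟦ excess ⟧ t z ≡ ⟦ b ⟧ t (x ∷ z) - + k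
    slack-eq t x z = trans (cong (λ s → b₀ * x + s) (excess-⟦⟧ t z))
      (trans (sym (ℤ.+-assoc (b₀ * x) _ _)) (cong (_- + k) (sym (⟦⟧-∷ b t x z))))

    substituted-∣ : ∀ c t x z → b₀ * x + ⟦ excess ⟧ t z ≡ 0ℤ →
      ⟦ substituted c ⟧ t z ≡ ⟦ c ⟧ t (x ∷ z) * (b₀ * b₀)
    substituted-∣ c t x z eq = trans (substituted-⟦⟧ c t x z eq) (ℤ.*-comm (b₀ * b₀) _)

    lift-slab : ∀ t z → System Γ′ Κ′ t z → Slab b k t (lift t z)
    lift-slab t z (box , Γ≥0 , b₀∣ ∷ Κ∣) =
      ( box
      , ListAll.map (λ {c} 0≤ → ℤ.*-cancelˡ-≤-pos 0ℤ _ (b₀ * b₀)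
          (subst₂ _≤_ (sym (ℤ.*-zeroʳ (b₀ * b₀))) (substituted-⟦⟧ c t _ z eq) 0≤)) (ListAll.map⁻ Γ≥0)
      , ListAll.map (λ {κ} q∣ → *-cancelʳ-∣ (b₀ * b₀)
          (subst (modulus κ * (b₀ * b₀) ∣_) (substituted-∣ (form κ) t _ z eq) q∣)) (ListAll.map⁻ Κ∣))
      , b₀≢0
      , ℤ.i-j≡0⇒i≡j _ _ (trans (sym (slack-eq t _ z)) eq)
      where eq = lift-eq t z b₀∣

    slab-lift : ∀ t x → Slab b k t x → ∃[ z ] System Γ′ Κ′ t z × lift t z ≡ x
    slab-lift t (x ∷ z) ((box , Γ≥0 , Κ∣) , _ , slack) = z ,
      ( box
      , ListAll.map⁺ (ListAll.map (λ {c} 0≤ → subst₂ _≤_ (ℤ.*-zeroʳ (b₀ * b₀)) (sym (substituted-⟦⟧ c t x z eq))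
          (ℤ.*-monoˡ-≤-nonNeg (b₀ * b₀) 0≤)) Γ≥0)
      , b₀∣ ∷ ListAll.map⁺ (ListAll.map (λ {κ} q∣ → subst (modulus κ * (b₀ * b₀) ∣_)
          (sym (substituted-∣ (form κ) t x z eq)) (*-monoˡ-∣ (b₀ * b₀) q∣)) Κ∣))
      , cong (_∷ z) (ℤ.*-cancelˡ-≡ b₀ _ x (+-cancelʳ (⟦ excess ⟧ t z) _ _ (trans (lift-eq t z b₀∣) (sym eq))))
      where
      eq : b₀ * x + ⟦ excess ⟧ t z ≡ 0ℤ
      eq = trans (slack-eq t x z) (ℤ.i≡j⇒i-j≡0 slack)
      b₀∣ : b₀ ∣ ⟦ excess ⟧ t z
      b₀∣ = ∣m+n∣m⇒∣n (subst (b₀ ∣_) (sym eq) (divides 0ℤ refl)) (∣m⇒∣m*n x ∣-refl)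

    -- The objective is substituted like a constraint; its linear part is `w`, and its constant term
    -- is the same for both points and cancels.
    lift-mono : ∀ t v → ∃[ w ] ∀ {z z′} → System Γ′ Κ′ t z → System Γ′ Κ′ t z′ →
      w · z ≤ w · z′ → v · lift t z ≤ v · lift t z′
    lift-mono t v = proj₁ objective , λ {z} {z′} z∈ z′∈ w≤ → ℤ.*-cancelˡ-≤-pos _ _ (b₀ * b₀)
      (subst₂ _≤_ (value z z∈) (value z′ z′∈) (ℤ.+-monoˡ-≤ (proj₂ objective ⟨ + t ⟩) w≤))
      where
      objective : Lin n
      objective = substituted (v , [])
      value : ∀ z → System Γ′ Κ′ t z → ⟦ objective ⟧ t z ≡ b₀ * b₀ * (v · lift t z)
      value z (_ , _ , b₀∣ ∷ _) = trans (substituted-⟦⟧ (v , []) t _ z (lift-eq t z b₀∣))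
        (cong (b₀ * b₀ *_) (ℤ.+-identityʳ _))

    lift-rep : ∀ {D} g → All (Rep D) g → (∀ t → D t → System Γ′ Κ′ t (at g t)) →
      ∃[ h ] All (Rep D) h × ∀ t → D t → at h t ≡ lift t (at g t)
    lift-rep {D} g rg g∈ = (λ t → - quot (⟦ excess ⟧ t (at g t)) b₀) ∷ g , rep ∷ rg , λ _ _ → refl
      where
      rep : Rep D (λ t → - quot (⟦ excess ⟧ t (at g t)) b₀)
      rep = rep-cancel b₀ b₀≢0 (rep-cong
        (λ t t∈D → trans (ℤ.-1*i≡-i _) (sym (inverse (lift-eq t (at g t) (ListAll.head (proj₂ (proj₂ (g∈ t t∈D))))))))
        (rep-* (rep-const -1ℤ) (rep-⟦⟧ excess g rg)))
        where
        inverse : ∀ {i j} → i + j ≡ 0ℤ → i ≡ - j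
        inverse {i} {j} eq = trans (lemma i j) (trans (cong (_- j) eq) (ℤ.+-identityˡ (- j)))
          where
          lemma : ∀ i j → i ≡ i + j - j
          lemma = solve-∀

    good-slab : Good ℓ (System Γ′ Κ′) → Good ℓ (Slab b k)
    good-slab = good-image ℓ lift lift-slab slab-lift
      (λ t _ _ eq → Vec.∷-injectiveʳ eq) lift-mono lift-rep

  period : List (Congruence (suc n)) → ℤ
  period []      = 1ℤ
  period (κ ∷ Κ) = modulus κ * period Κ

  period≢0 : ∀ Κ → period Κ ≢ 0ℤ
  period≢0 []      ()
  period≢0 ((q ⋮ c) ∷ Κ) = *≢0 (nonZero⁻¹ q) (period≢0 Κ)

  modulus∣period : ∀ Κ → ListAll (λ κ → modulus κ ∣ period Κ) Κ
  modulus∣period []      = []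
  modulus∣period (κ ∷ Κ) = ∣m⇒∣m*n (period Κ) ∣-refl ∷
    ListAll.map (∣n⇒∣m*n (modulus κ)) (modulus∣period Κ)

  -- A step of one period changes the value of `b` by at most `|lead b| * |period Κ|`, so the last
  -- `ℓ` points before `b` turns negative have values below `ℓ` times this amount.
  thickness : Lin (suc n) → ℕ
  thickness b = ∣ lead b ∣ ℕ.* ∣ period Κ ∣ ℕ.* ℓ

  NearBoundary : ℕ → Vec ℤ (suc n) → Set
  NearBoundary t x = Any (λ b → Any (λ k → Slab b k t x) (upTo (thickness b))) Γ⁺

  -- Move along the first axis in steps of the period, in the direction that
  -- does not decrease v, until some constraint b fails: the last ℓ points
  -- before that have slack below the thickness of b.
  module Walk (t : ℕ) (v₀ : ℤ) (v : Vec ℤ n) (x₀ : ℤ) (z : Vec ℤ n) (x∈ : System⁺ t (x₀ ∷ z))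
    (δ : ℤ) (δ≢0 : δ ≢ 0ℤ) (∣δ∣≡ : ∣ δ ∣ ≡ ∣ period Κ ∣) (period∣δ : period Κ ∣ δ) (v₀δ≥0 : 0ℤ ≤ v₀ * δ) where

    walk : ℕ → Vec ℤ (suc n)
    walk j = (x₀ + + j * δ) ∷ z

    walk-⟦⟧ : ∀ l j → ⟦ l ⟧ t (walk j) ≡ ⟦ l ⟧ t (x₀ ∷ z) + + j * (lead l * δ)
    walk-⟦⟧ l j = trans (⟦⟧-∷ l t _ z) (trans (lemma (lead l) x₀ (+ j) δ (⟦ rest l ⟧ t z))
      (cong (λ s → s + + j * (lead l * δ)) (sym (⟦⟧-∷ l t x₀ z))))
      where
      lemma : ∀ l x j d L → l * (x + j * d) + L ≡ l * x + L + j * (l * d)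
      lemma = solve-∀

    walk-zero : walk 0 ≡ x₀ ∷ z
    walk-zero = cong (_∷ z) (trans (cong (λ s → x₀ + s) (ℤ.*-zeroˡ δ)) (ℤ.+-identityʳ x₀))

    walk-injective : ∀ {i j} → walk i ≡ walk j → i ≡ j
    walk-injective {i} {j} eq = ℤ.+-injective (ℤ.*-cancelʳ-≡ (+ i) (+ j) δ {{ℤ.≢-nonZero δ≢0}}
      (+-cancelˡ x₀ _ _ (Vec.∷-injectiveˡ eq)))

    feasible? : Unary.Decidable (λ j → Nonneg Γ⁺ t (walk j))
    feasible? j = ListAll.all? (λ l → 0ℤ ℤ.≤? ⟦ l ⟧ t (walk j)) Γ⁺

    -- The first coordinate starts in `[0, t)` and moves by at least 1 in a fixed direction, so
    -- after `t` steps it is outside.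
    walk-leaves : ¬ Nonneg Γ⁺ t (walk t)
    walk-leaves (lo ∷ hi ∷ _) with ℤ.<-cmp δ 0ℤ
    ... | tri≈ _ δ≡0 _ = δ≢0 δ≡0
    ... | tri> _ _ δ>0 = ℤ.<⇒≱ (begin-strict
        x₀ + + t * δ                  <⟨ ℤ.suc[i]≤j⇒i<j (ℤ.0≤i-j⇒j≤i (subst (0ℤ ≤_) (upper-⟦⟧ t (x₀ + + t * δ) z) hi)) ⟩
        + t                           ≡⟨ ℤ.*-identityʳ (+ t) ⟨
        + t * 1ℤ                      ≤⟨ ℤ.*-monoˡ-≤-nonNeg (+ t) (ℤ.i<j⇒suc[i]≤j δ>0) ⟩
        + t * δ                       ≡⟨ ℤ.+-identityˡ _ ⟨
        0ℤ + + t * δ                  ∎)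
        (ℤ.+-monoˡ-≤ (+ t * δ) 0≤x₀)
      where
      open ℤ.≤-Reasoning
      0≤x₀ : 0ℤ ≤ x₀
      0≤x₀ = proj₁ (All.head (proj₁ (system⁺⇒system t (x₀ ∷ z) x∈)))
    ... | tri< δ<0 _ _ = ℤ.<⇒≱ (begin-strict
        x₀ + + t * δ                  ≤⟨ ℤ.+-monoʳ-≤ x₀ (ℤ.*-monoˡ-≤-nonNeg (+ t) (ℤ.i<j⇒i≤pred[j] δ<0)) ⟩
        x₀ + + t * -1ℤ                <⟨ ℤ.+-monoˡ-< (+ t * -1ℤ) x₀<t ⟩
        + t + + t * -1ℤ               ≡⟨ lemma (+ t) ⟩
        0ℤ                            ∎)
        (subst (0ℤ ≤_) (lower-⟦⟧ t (x₀ + + t * δ) z) lo)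
      where
      open ℤ.≤-Reasoning
      x₀<t : x₀ < + t
      x₀<t = proj₂ (All.head (proj₁ (system⁺⇒system t (x₀ ∷ z) x∈)))
      lemma : ∀ t → t + t * -1ℤ ≡ 0ℤ
      lemma = solve-∀

    last-feasible : ∃[ J ] (∀ j → j ℕ.≤ J → Nonneg Γ⁺ t (walk j)) × ¬ Nonneg Γ⁺ t (walk (suc J))
    last-feasible = first-failure feasible?
      (subst (Nonneg Γ⁺ t) (sym walk-zero) (proj₁ (proj₂ x∈))) t walk-leaves

    J = proj₁ last-feasible
    feasible = proj₁ (proj₂ last-feasible)

    violated : ∃[ b ] b ∈ Γ⁺ × ¬ (0ℤ ≤ ⟦ b ⟧ t (walk (suc J)))
    violated = find (ListAll.¬All⇒Any¬ (λ l → 0ℤ ℤ.≤? ⟦ l ⟧ t (walk (suc J))) Γ⁺ (proj₂ (proj₂ last-feasible)))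

    b = proj₁ violated
    b∈Γ⁺ = proj₁ (proj₂ violated)

    drop : ℤ
    drop = - (lead b * δ)

    slack-last : ℤ
    slack-last = ⟦ b ⟧ t (walk J)

    slack-last≥0 : 0ℤ ≤ slack-last
    slack-last≥0 = ListAll.lookup (feasible J ℕ.≤-refl) b∈Γ⁺

    slack-last<drop : slack-last < drop
    slack-last<drop = ℤ.≰⇒> λ drop≤ → proj₂ (proj₂ violated) (subst (0ℤ ≤_) (sym next) (ℤ.i≤j⇒0≤j-i drop≤))
      where
      next : ⟦ b ⟧ t (walk (suc J)) ≡ slack-last - drop
      next = trans (walk-⟦⟧ b (suc J)) (trans (lemma (⟦ b ⟧ t (x₀ ∷ z)) (+ J) (lead b * δ))
        (cong (_- drop) (sym (walk-⟦⟧ b J))))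
        where
        lemma : ∀ B J d → B + (1ℤ + J) * d ≡ B + J * d - (- d)
        lemma = solve-∀

    drop>0 : 0ℤ < drop
    drop>0 = ℤ.≤-<-trans slack-last≥0 slack-last<drop

    -- A constraint that fails along the walk must involve the first coordinate; this is what makes
    -- its slabs solvable for it.
    lead≢0 : lead b ≢ 0ℤ
    lead≢0 eq = ℤ.<-irrefl (sym (trans (cong (λ s → - (s * δ)) eq) (lemma δ))) drop>0
      where
      lemma : ∀ d → - (0ℤ * d) ≡ 0ℤ
      lemma = solve-∀

    drop≡ : drop ≡ + (∣ lead b ∣ ℕ.* ∣ period Κ ∣)
    drop≡ = trans (sym (ℤ.0≤i⇒+∣i∣≡i (ℤ.<⇒≤ drop>0)))
      (cong +_ (trans (ℤ.∣-i∣≡∣i∣ (lead b * δ)) (trans (ℤ.abs-* (lead b) δ) (cong (∣ lead b ∣ ℕ.*_) ∣δ∣≡))))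

    slack-back : ∀ i → i ℕ.≤ J → ⟦ b ⟧ t (walk (J ∸ i)) ≡ slack-last + + i * drop
    slack-back i i≤J = trans (walk-⟦⟧ b (J ∸ i))
      (trans (cong (λ s → ⟦ b ⟧ t (x₀ ∷ z) + s * (lead b * δ)) (sym (trans (ℤ.m-n≡m⊖n J i) (ℤ.⊖-≥ i≤J))))
      (trans (lemma (⟦ b ⟧ t (x₀ ∷ z)) (+ J) (+ i) (lead b * δ))
      (cong (λ s → s + + i * drop) (sym (walk-⟦⟧ b J)))))
      where
      lemma : ∀ B J i d → B + (J - i) * d ≡ B + J * d + i * (- d)
      lemma = solve-∀

    walk-∈ : ∀ j → j ℕ.≤ J → System⁺ t (walk j)
    walk-∈ j j≤J = proj₁ x∈ , feasible j j≤J , ListAll.zipWith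
      (λ {κ} (q∣period , q∣) → subst (modulus κ ∣_) (sym (walk-⟦⟧ (form κ) j))
        (∣m∣n⇒∣m+n q∣ (∣n⇒∣m*n (+ j) (∣n⇒∣m*n (lead (form κ)) (∣-trans q∣period period∣δ)))))
      (modulus∣period Κ , proj₂ (proj₂ x∈))

    near : ∀ i → i ℕ.≤ J → i ℕ.< ℓ → NearBoundary t (walk (J ∸ i))
    near i i≤J i<ℓ = lose b∈Γ⁺ (lose (∈-upTo⁺ small)
      (walk-∈ (J ∸ i) (ℕ.m∸n≤m J i) , lead≢0 , sym (ℤ.0≤i⇒+∣i∣≡i slack≥0)))
      where
      slack = ⟦ b ⟧ t (walk (J ∸ i))
      slack≥0 : 0ℤ ≤ slack
      slack≥0 = ListAll.lookup (feasible (J ∸ i) (ℕ.m∸n≤m J i)) b∈Γ⁺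
      small : ∣ slack ∣ ℕ.< thickness b
      small = ℤ.drop‿+<+ (begin-strict
        + ∣ slack ∣                  ≡⟨ ℤ.0≤i⇒+∣i∣≡i slack≥0 ⟩
        slack                        ≡⟨ slack-back i i≤J ⟩
        slack-last + + i * drop      <⟨ ℤ.+-monoˡ-< (+ i * drop) slack-last<drop ⟩
        drop + + i * drop            ≡⟨ lemma drop (+ i) ⟩
        drop * + suc i               ≤⟨ ℤ.*-monoˡ-≤-nonNeg drop {{ℤ.nonNegative (ℤ.<⇒≤ drop>0)}} (ℤ.+≤+ i<ℓ) ⟩
        drop * + ℓ                   ≡⟨ cong (_* + ℓ) drop≡ ⟩
        + (∣ lead b ∣ ℕ.* ∣ period Κ ∣) * + ℓ ≡⟨ ℤ.pos-* (∣ lead b ∣ ℕ.* ∣ period Κ ∣) ℓ ⟨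
        + thickness b                ∎)
        where
        open ℤ.≤-Reasoning
        lemma : ∀ d i → d + i * d ≡ d * (1ℤ + i)
        lemma = solve-∀

    improves : ∀ j → (v₀ ∷ v) · (x₀ ∷ z) ≤ (v₀ ∷ v) · walk j
    improves j = ≤-of-difference (0≤* {+ j} (ℤ.+≤+ ℕ.z≤n) v₀δ≥0) (lemma v₀ x₀ (+ j) δ (v · z))
      where
      lemma : ∀ v x j d V → v * (x + j * d) + V - (v * x + V) ≡ j * (v * d)
      lemma = solve-∀

    covered : NearBoundary t (x₀ ∷ z) ⊎ Dominated ℓ (NearBoundary t) (v₀ ∷ v) (x₀ ∷ z)
    covered with J ℕ.<? ℓ
    -- A walk shorter than `ℓ` starts at one of the last `ℓ` feasible points, so the starting point
    -- is itself near the boundary.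
    ... | yes J<ℓ = inj₁ (subst (NearBoundary t) (trans (cong walk (ℕ.n∸n≡0 J)) walk-zero) (near J ℕ.≤-refl J<ℓ))
    ... | no J≮ℓ = inj₂
      ( applyUpTo (λ i → walk (J ∸ i)) ℓ
      , Unique.applyUpTo⁺₁ _ ℓ (λ {i} {j} i<j j<ℓ eq → ℕ.<⇒≢ i<j
          (ℕ.∸-cancelˡ-≡ (ℕ.≤-trans (ℕ.<⇒≤ (ℕ.<-trans i<j j<ℓ)) ℓ≤J) (ℕ.≤-trans (ℕ.<⇒≤ j<ℓ) ℓ≤J) (walk-injective eq)))
      , List.length-applyUpTo _ ℓ
      , ListAll.applyUpTo⁺₁ _ ℓ (λ {i} i<ℓ → near i (ℕ.≤-trans (ℕ.<⇒≤ i<ℓ) ℓ≤J) i<ℓ , improves (J ∸ i)))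
      where
      ℓ≤J : ℓ ℕ.≤ J
      ℓ≤J = ℕ.≮⇒≥ J≮ℓ

  near-boundary-covers : ∀ t → Covers ℓ (System⁺ t) (NearBoundary t)
  near-boundary-covers t (v₀ ∷ v) (x₀ ∷ z) x∈ with ℤ.≤-total 0ℤ (v₀ * period Κ)
  ... | inj₁ ≥0 = Walk.covered t v₀ v x₀ z x∈ (period Κ) (period≢0 Κ) refl ∣-refl ≥0
  ... | inj₂ ≤0 = Walk.covered t v₀ v x₀ z x∈ (- period Κ) (λ eq → period≢0 Κ (ℤ.neg-injective eq))
    (ℤ.∣-i∣≡∣i∣ (period Κ)) (∣m⇒∣-m ∣-refl)
    (subst (0ℤ ≤_) (ℤ.neg-distribʳ-* v₀ (period Κ)) (ℤ.neg-mono-≤ ≤0))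

  near-boundary-⊆ : ∀ t → NearBoundary t ⊆ System⁺ t
  near-boundary-⊆ t near = proj₁ (proj₂ (Any.satisfied (proj₂ (Any.satisfied near))))

good-system : ∀ ℓ {n} (Γ : List (Lin n)) (Κ : List (Congruence n)) → Good ℓ (System Γ Κ)
good-system ℓ {zero} Γ Κ = piecewise-map point
  (decided-× {λ t → Nonneg Γ t []}
    (decided-All {P = λ l t → 0ℤ ≤ ⟦ l ⟧ t []} nonneg Γ)
    (decided-All {P = λ κ t → modulus κ ∣ ⟦ form κ ⟧ t []} divisible Κ))
  where
  nonneg : (l : Lin 0) → Piecewise (Decided (λ t → 0ℤ ≤ ⟦ l ⟧ t []))
  nonneg ([] , p) = decided-cong {λ t → 0ℤ ≤ p ⟨ + t ⟩}
    (λ t → subst (0ℤ ≤_) (sym (ℤ.+-identityˡ _))) (λ t → subst (0ℤ ≤_) (ℤ.+-identityˡ _)) (decided-nonneg p)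
  divisible : (κ : Congruence 0) → Piecewise (Decided (λ t → modulus κ ∣ ⟦ form κ ⟧ t []))
  divisible (q ⋮ ([] , p)) = decided-cong {λ t → q ∣ p ⟨ + t ⟩}
    (λ t → subst (q ∣_) (sym (ℤ.+-identityˡ _))) (λ t → subst (q ∣_) (ℤ.+-identityˡ _)) (decided-divides q p)
  point : ∀ D → Decided (λ t → Nonneg Γ t [] × Divisible Κ t []) D → GoodOn ℓ (System Γ Κ) D
  point D (inj₁ x) = [] ∷ [] , [] ∷ [] , λ t t∈D → ([] , x t t∈D) ∷ [] , λ { v [] _ → inj₁ (here refl) }
  point D (inj₂ x) = [] , [] , λ t t∈D → [] , λ { v [] (_ , z∈) → contradiction z∈ (x t t∈D) }
good-system ℓ {suc n} Γ Κ = good-cover ℓ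
  (0 , λ t _ → (λ {x} near → system⁺⇒system t x (near-boundary-⊆ t near)) ,
    λ v x x∈ → near-boundary-covers t v x (system⇒system⁺ t x x∈))
  (good-⋃ ℓ Γ⁺ λ b → good-⋃ ℓ (upTo (thickness b)) λ k → slab b k)
  where
  open Elimination ℓ Γ Κ
  slab : ∀ b k → Good ℓ (Slab b k)
  slab b k with lead b ℤ.≟ 0ℤ
  ... | yes b₀≡0 = good-∅ ℓ λ t x (_ , b₀≢0 , _) → b₀≢0 b₀≡0
  ... | no b₀≢0  = Slabs.good-slab b k b₀≢0 (good-system ℓ (Slabs.Γ′ b k b₀≢0) (Slabs.Κ′ b k b₀≢0))

-- Equations with polynomial coefficients

-- A list of vectors stands for a polynomial in t whose coefficients are affine
-- forms in z; the first entry of each vector is the constant term.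
at-point : ∀ {n} → List (Vec ℤ (suc n)) → Vec ℤ n → Poly ℤ
at-point H z = List.map (_· (1ℤ ∷ z)) H

-- The integer is the carry received from the lower coefficients already treated.
Equation : ℕ → Set
Equation n = List (Vec ℤ (suc n)) × ℤ

Holds : ∀ {n} → Equation n → ℕ → Vec ℤ n → Set
Holds (H , q) t z = at-point H z ⟨ + t ⟩ + q ≡ 0ℤ

SystemWith : ∀ {n} → List (Lin n) → List (Equation n) → ℕ → Vec ℤ n → Set
SystemWith Γ E t z = System Γ [] t z × ListAll (λ e → Holds e t z) E

integersUpTo : ℕ → List ℤ
integersUpTo n = List.map +_ (upTo (suc n)) ++ List.map (λ i → - + i) (upTo (suc n))

∈-integersUpTo : ∀ i n → ∣ i ∣ ℕ.≤ n → i ∈ integersUpTo n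
∈-integersUpTo (+ m)     n m≤n = ∈-++⁺ˡ (∈-map⁺ +_ (∈-upTo⁺ (ℕ.s≤s m≤n)))
∈-integersUpTo -[1+ m ] n m<n = ∈-++⁺ʳ (List.map +_ (upTo (suc n))) (∈-map⁺ (λ i → - + i) (∈-upTo⁺ (ℕ.s≤s m<n)))

-- The constant term h · (1 ∷ z) + q of an equation is a multiple q′ t of t; the
-- carry q′ is bounded independently of t because all digits are below t.
module Carry {n : ℕ} (h : Vec ℤ (suc n)) (q : ℤ) where

  -- Together these two inequalities express the equation `h · (1 ∷ z) + q = q′ t`, as linear
  -- systems contain no equations; `q′` is a fixed integer in each case, so the coefficients of `z`
  -- stay free of `t`.
  carries≤ carries≥ : ℤ → Lin n
  carries≤ q′ = Vec.tail h , (Vec.head h + q) ∷ - q′ ∷ []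
  carries≥ q′ = combLin -1ℤ (carries≤ q′) 0ℤ (carries≤ q′)

  carries : List ℤ
  carries = integersUpTo (∥ h ∥ ℕ.+ ∣ q ∣)

  carries≤-⟦⟧ : ∀ q′ t z → ⟦ carries≤ q′ ⟧ t z ≡ h · (1ℤ ∷ z) + q - q′ * + t
  carries≤-⟦⟧ q′ t z = lemma′ h refl
    where
    lemma : ∀ h₀ A q q′ t → A + (h₀ + q + t * (- q′ + t * 0ℤ)) ≡ h₀ * 1ℤ + A + q - q′ * t
    lemma = solve-∀
    lemma′ : ∀ k → k ≡ h → ⟦ carries≤ q′ ⟧ t z ≡ h · (1ℤ ∷ z) + q - q′ * + t
    lemma′ (h₀ ∷ hs) refl = lemma h₀ (hs · z) q q′ (+ t)

  carries≥-⟦⟧ : ∀ q′ t z → ⟦ carries≥ q′ ⟧ t z ≡ - ⟦ carries≤ q′ ⟧ t z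
  carries≥-⟦⟧ q′ t z = trans (combLin-⟦⟧ -1ℤ (carries≤ q′) 0ℤ (carries≤ q′) t z) (lemma (⟦ carries≤ q′ ⟧ t z))
    where
    lemma : ∀ L → -1ℤ * L + 0ℤ * L ≡ - L
    lemma = solve-∀

  module _ (Γ : List (Lin n)) (H : List (Vec ℤ (suc n))) (E : List (Equation n)) where

    carried : ℤ → ℕ → Vec ℤ n → Set
    carried q′ = SystemWith (carries≤ q′ ∷ carries≥ q′ ∷ Γ) ((H , q′) ∷ E)

    carried⇒ : ∀ t z → Any (λ q′ → carried q′ t z) carries → SystemWith Γ ((h ∷ H , q) ∷ E) t z
    carried⇒ t z some with Any.satisfied some
    ... | q′ , (box , ≥0 ∷ ≤0 ∷ Γ≥0 , _) , eq ∷ E≡ = (box , Γ≥0 , []) , (begin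
        h · (1ℤ ∷ z) + + t * X + q                        ≡⟨ lemma (h · (1ℤ ∷ z)) (+ t) X q q′ ⟩
        (h · (1ℤ ∷ z) + q - q′ * + t) + + t * (X + q′)    ≡⟨ cong₂ (λ u w → u + + t * w) (trans (sym (carries≤-⟦⟧ q′ t z)) L≡0) eq ⟩
        0ℤ + + t * 0ℤ                                     ≡⟨ cong (λ w → 0ℤ + w) (ℤ.*-zeroʳ (+ t)) ⟩
        0ℤ                                                ∎) ∷ E≡
      where
      open ≡-Reasoning
      X = at-point H z ⟨ + t ⟩
      L≡0 : ⟦ carries≤ q′ ⟧ t z ≡ 0ℤ
      L≡0 = ℤ.≤-antisym (ℤ.neg-cancel-≤ (subst (0ℤ ≤_) (carries≥-⟦⟧ q′ t z) ≤0)) ≥0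
      lemma : ∀ U t X q q′ → U + t * X + q ≡ (U + q - q′ * t) + t * (X + q′)
      lemma = solve-∀

    ⇒carried : ∀ t z → 1 ℕ.≤ t → SystemWith Γ ((h ∷ H , q) ∷ E) t z → Any (λ q′ → carried q′ t z) carries
    ⇒carried t@(suc _) z 1≤t ((box , Γ≥0 , _) , eq ∷ E≡) = lose (∈-integersUpTo q′ _ q′≤)
      ( ( box
        , ℤ.≤-reflexive (sym L≡0)
          ∷ ℤ.≤-reflexive (sym (trans (carries≥-⟦⟧ q′ t z) (cong -_ L≡0)))
          ∷ Γ≥0
        , [])
      , ℤ.+-inverseʳ X ∷ E≡)
      where
      X = at-point H z ⟨ + t ⟩
      -- The equation reads `u + t * X = 0`, which forces the carry.
      q′ = - X
      u = h · (1ℤ ∷ z) + q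
      u≡ : u ≡ q′ * + t
      u≡ = trans (lemma (h · (1ℤ ∷ z)) (+ t) X q) (trans (cong (λ w → w + q′ * + t) eq) (ℤ.+-identityˡ _))
        where
        lemma : ∀ U t X q → U + q ≡ (U + t * X + q) + (- X) * t
        lemma = solve-∀
      L≡0 : ⟦ carries≤ q′ ⟧ t z ≡ 0ℤ
      L≡0 = trans (carries≤-⟦⟧ q′ t z) (trans (cong (_- q′ * + t) u≡) (ℤ.+-inverseʳ (q′ * + t)))
      entries≤ : All (λ i → ∣ i ∣ ℕ.≤ t) (1ℤ ∷ z)
      entries≤ = 1≤t ∷ All.map (λ (0≤i , i<t) → ∣i∣≤ (ℤ.≤-trans ℤ.neg-≤-pos 0≤i) (ℤ.<⇒≤ i<t)) box
      q′≤ : ∣ q′ ∣ ℕ.≤ ∥ h ∥ ℕ.+ ∣ q ∣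
      q′≤ = ℕ.*-cancelʳ-≤ ∣ q′ ∣ _ t (begin
        ∣ q′ ∣ ℕ.* t                      ≡⟨ ℤ.abs-* q′ (+ t) ⟨
        ∣ q′ * + t ∣                      ≡⟨ cong ∣_∣ u≡ ⟨
        ∣ u ∣                             ≤⟨ ℤ.∣i+j∣≤∣i∣+∣j∣ (h · (1ℤ ∷ z)) q ⟩
        ∣ h · (1ℤ ∷ z) ∣ ℕ.+ ∣ q ∣        ≤⟨ ℕ.+-mono-≤ (∣·∣≤ h (1ℤ ∷ z) t entries≤) (ℕ.m≤m*n ∣ q ∣ t) ⟩
        ∥ h ∥ ℕ.* t ℕ.+ ∣ q ∣ ℕ.* t       ≡⟨ ℕ.*-distribʳ-+ t ∥ h ∥ ∣ q ∣ ⟨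
        (∥ h ∥ ℕ.+ ∣ q ∣) ℕ.* t           ∎)
        where open ℕ.≤-Reasoning

module _ (ℓ : ℕ) {n : ℕ} where

  -- Each step consumes one coefficient of one equation and adds two inequalities to `Γ`, branching
  -- over the finitely many carries. An equation whose coefficients are exhausted leaves the
  -- condition that its carry is 0.
  good-equations : ∀ (E : List (Equation n)) Γ → Good ℓ (SystemWith Γ E)
  good-equation : ∀ H q (E : List (Equation n)) Γ → Good ℓ (SystemWith Γ ((H , q) ∷ E))

  good-equations []            Γ = good-ext ℓ (λ t z∈ → z∈ , []) (λ t → proj₁) (good-system ℓ Γ [])
  good-equations ((H , q) ∷ E) Γ = good-equation H q E Γ

  good-equation [] q E Γ with q ℤ.≟ 0ℤ
  ... | yes refl = good-ext ℓ (λ t (z∈ , E≡) → z∈ , refl ∷ E≡) (λ { t (z∈ , _ ∷ E≡) → z∈ , E≡ }) (good-equations E Γ)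
  ... | no q≢0   = good-∅ ℓ λ { t z (_ , eq ∷ _) → q≢0 (trans (sym (ℤ.+-identityˡ q)) eq) }
  good-equation (h ∷ H) q E Γ = good-cover ℓ
    (1 , λ t 1≤t → (λ {z} → carried⇒ Γ H E t z) , λ v z z∈ → inj₁ (⇒carried Γ H E t z 1≤t z∈))
    (good-⋃ ℓ carries λ q′ → good-equation H q′ E (carries≤ q′ ∷ carries≥ q′ ∷ Γ))
    where open Carry h q

-- One column of a transposition: a vector of polynomials becomes a polynomial with vector
-- coefficients, the shorter side being padded with zeros.
cons-coefficients : ∀ {n} → Poly ℤ → List (Vec ℤ n) → List (Vec ℤ (suc n))
cons-coefficients []      []      = []
cons-coefficients []      (v ∷ H) = (0ℤ ∷ v) ∷ cons-coefficients [] H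
cons-coefficients (a ∷ p) []      = (a ∷ Vec.replicate _ 0ℤ) ∷ cons-coefficients p []
cons-coefficients (a ∷ p) (v ∷ H) = (a ∷ v) ∷ cons-coefficients p H

cons-coefficients-eval : ∀ {n} p (H : List (Vec ℤ n)) x z t →
  List.map (_· (x ∷ z)) (cons-coefficients p H) ⟨ t ⟩ ≡ p ⟨ t ⟩ * x + List.map (_· z) H ⟨ t ⟩
cons-coefficients-eval []      []      x z t = lemma x
  where
  lemma : ∀ x → 0ℤ ≡ 0ℤ * x + 0ℤ
  lemma = solve-∀
cons-coefficients-eval []      (v ∷ H) x z t =
  trans (cong (λ s → 0ℤ * x + v · z + t * s) (cons-coefficients-eval [] H x z t))
    (lemma x (v · z) t (List.map (_· z) H ⟨ t ⟩))
  where
  lemma : ∀ x V t H → 0ℤ * x + V + t * (0ℤ * x + H) ≡ 0ℤ * x + (V + t * H)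
  lemma = solve-∀
cons-coefficients-eval (a ∷ p) []      x z t =
  trans (cong₂ (λ r s → a * x + r + t * s) (0-· z) (cons-coefficients-eval p [] x z t)) (lemma a x t (p ⟨ t ⟩))
  where
  lemma : ∀ a x t P → a * x + 0ℤ + t * (P * x + 0ℤ) ≡ (a + t * P) * x + 0ℤ
  lemma = solve-∀
cons-coefficients-eval (a ∷ p) (v ∷ H) x z t =
  trans (cong (λ s → a * x + v · z + t * s) (cons-coefficients-eval p H x z t))
    (lemma a x (v · z) t (p ⟨ t ⟩) (List.map (_· z) H ⟨ t ⟩))
  where
  lemma : ∀ a x V t P H → a * x + V + t * (P * x + H) ≡ (a + t * P) * x + (V + t * H)
  lemma = solve-∀

coefficients : ∀ {n} → Vec (Poly ℤ) n → List (Vec ℤ n)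
coefficients []      = []
coefficients (p ∷ P) = cons-coefficients p (coefficients P)

evalVec : ∀ {n} → Vec (Poly ℤ) n → ℕ → Vec ℤ n
evalVec P t = Vec.map _⟨ + t ⟩ P

coefficients-eval : ∀ {n} (P : Vec (Poly ℤ) n) z t → List.map (_· z) (coefficients P) ⟨ + t ⟩ ≡ evalVec P t · z
coefficients-eval []      []      t = refl
coefficients-eval (p ∷ P) (x ∷ z) t = trans (cons-coefficients-eval p (coefficients P) x z (+ t))
  (cong (λ s → p ⟨ + t ⟩ * x + s) (coefficients-eval P z t))

-- Digits in base t

undigits : ∀ {e} → ℕ → Vec ℤ e → ℤ
undigits t []      = 0ℤ
undigits t (d ∷ u) = d + + t * undigits t u

digits : ∀ t e m → m ℕ.< t ^ e → ∃[ u ] Box t u × undigits {e} t u ≡ + m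
digits t zero zero _ = [] , [] , refl
digits t zero (suc m) (ℕ.s≤s ())
digits t@(suc _) (suc e) m m<t^[1+e] =
  let u , box , eq = digits t e (m / t) (ℕ.m<n*o⇒m/o<n (subst (m ℕ.<_) (ℕ.*-comm t (t ^ e)) m<t^[1+e]))
  in + (m % t) ∷ u , (ℤ.+≤+ ℕ.z≤n , ℤ.+<+ (ℕ.m%n<n m t)) ∷ box ,
     trans (cong (λ s → + (m % t) + + t * s) eq)
     (trans (cong (λ s → + (m % t) + s) (trans (sym (ℤ.pos-* t (m / t))) (cong +_ (ℕ.*-comm t (m / t)))))
     (trans (sym (ℤ.pos-+ (m % t) _)) (cong +_ (sym (ℕ.m≡m%n+[m/n]*n m t)))))

undigits-nonneg : ∀ {e} t (u : Vec ℤ e) → Box t u → 0ℤ ≤ undigits t u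
undigits-nonneg t []      []                = ℤ.≤-refl
undigits-nonneg t (d ∷ u) ((0≤d , _) ∷ box) = 0≤+ 0≤d (0≤* {+ t} (ℤ.+≤+ ℕ.z≤n) (undigits-nonneg t u box))

undigits-< : ∀ {e} t (u : Vec ℤ e) → Box t u → undigits t u < + (t ^ e)
undigits-< t []      []                  = ℤ.+<+ (ℕ.s≤s ℕ.z≤n)
undigits-< {suc e} t (d ∷ u) ((_ , d<t) ∷ box) = begin-strict
  d + + t * undigits t u              <⟨ ℤ.+-monoˡ-< (+ t * undigits t u) d<t ⟩
  + t + + t * undigits t u            ≡⟨ lemma (+ t) (undigits t u) ⟩
  + t * (1ℤ + undigits t u)           ≤⟨ ℤ.*-monoˡ-≤-nonNeg (+ t) (ℤ.i<j⇒suc[i]≤j (undigits-< t u box)) ⟩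
  + t * + (t ^ e)                     ≡⟨ ℤ.pos-* t (t ^ e) ⟨
  + (t ^ suc e)                       ∎
  where
  open ℤ.≤-Reasoning
  lemma : ∀ t U → t + t * U ≡ t * (1ℤ + U)
  lemma = solve-∀

-- If `l < k`, then `b + t * l < t * (1 + l) ≤ a + t * k`. Used in both directions, this identifies
-- the higher digits of two equal numbers.
leading-≤ : ∀ t {a b} k l → 0ℤ ≤ a → b < + t → a + + t * k ≡ b + + t * l → k ≤ l
leading-≤ t {a} {b} k l 0≤a b<t eq = ℤ.≮⇒≥ λ l<k → ℤ.<-irrefl refl (begin-strict
  b + + t * l            <⟨ ℤ.+-monoˡ-< (+ t * l) b<t ⟩
  + t + + t * l          ≡⟨ lemma (+ t) l ⟩
  0ℤ + + t * (1ℤ + l)    ≤⟨ ℤ.+-mono-≤ 0≤a (ℤ.*-monoˡ-≤-nonNeg (+ t) (ℤ.i<j⇒suc[i]≤j l<k)) ⟩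
  a + + t * k            ≡⟨ eq ⟩
  b + + t * l            ∎)
  where
  open ℤ.≤-Reasoning
  lemma : ∀ t l → t + t * l ≡ 0ℤ + t * (1ℤ + l)
  lemma = solve-∀

undigits-injective : ∀ {e} t (u u′ : Vec ℤ e) → Box t u → Box t u′ → undigits t u ≡ undigits t u′ → u ≡ u′
undigits-injective t [] [] _ _ _ = refl
undigits-injective t (d ∷ u) (d′ ∷ u′) ((0≤d , d<t) ∷ box) ((0≤d′ , d′<t) ∷ box′) eq =
  cong₂ _∷_ (+-cancelʳ (+ t * U) d d′ (trans eq (cong (λ s → d′ + + t * s) (sym U≡U′)))) (undigits-injective t u u′ box box′ U≡U′)
  where
  U = undigits t u
  U′ = undigits t u′
  U≡U′ : U ≡ U′
  U≡U′ = ℤ.≤-antisym (leading-≤ t U U′ 0≤d d′<t eq) (leading-≤ t U′ U 0≤d′ d<t (sym eq))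

rep-undigits : ∀ {D e} (g : Curve e) → All (Rep D) g → Rep D (λ t → undigits t (at g t))
rep-undigits []      []        = rep-const 0ℤ
rep-undigits {D} (u ∷ g) (ru ∷ rg) = rep-+ ru (rep-* (rep-cong {D} (λ t _ → lemma (+ t)) (rep-poly (0ℤ ∷ 1ℤ ∷ []))) (rep-undigits g rg))
  where
  lemma : ∀ t → 0ℤ + t * (1ℤ + t * 0ℤ) ≡ t
  lemma = solve-∀

-- The polynomials `p`, `t p`, `t² p` and so on: the coefficients that the digits of a variable
-- inherit from its coefficient `p`.
shifts : ∀ e → Poly ℤ → Vec (Poly ℤ) e
shifts zero    p = []
shifts (suc e) p = p ∷ shifts e (0ℤ ∷ p)

shifts-eval : ∀ e p t (u : Vec ℤ e) → evalVec (shifts e p) t · u ≡ p ⟨ + t ⟩ * undigits t u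
shifts-eval zero    p t []      = sym (ℤ.*-zeroʳ (p ⟨ + t ⟩))
shifts-eval (suc e) p t (d ∷ u) = trans (cong (λ s → p ⟨ + t ⟩ * d + s) (shifts-eval e (0ℤ ∷ p) t u))
  (lemma (p ⟨ + t ⟩) d (+ t) (undigits t u))
  where
  lemma : ∀ P d t U → P * d + (0ℤ + t * P) * U ≡ P * (d + t * U)
  lemma = solve-∀

module Digits (e : ℕ) where

  unpack : ∀ {n} → ℕ → Vec ℤ (n ℕ.* e) → Vec ℤ n
  unpack {zero}  t z = []
  unpack {suc n} t z = undigits t (Vec.take e z) ∷ unpack t (Vec.drop e z)

  pack-row : ∀ {n} → Vec (Poly ℤ) n → Vec (Poly ℤ) (n ℕ.* e)
  pack-row []      = []
  pack-row (p ∷ P) = shifts e p Vec.++ pack-row P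

  ++-· : ∀ {m k} (u : Vec ℤ m) (v : Vec ℤ k) z → (u Vec.++ v) · z ≡ u · Vec.take m z + v · Vec.drop m z
  ++-· []      v z       = sym (ℤ.+-identityˡ _)
  ++-· (x ∷ u) v (y ∷ z) = trans (cong (λ s → x * y + s) (++-· u v z)) (sym (ℤ.+-assoc (x * y) _ _))

  pack-row-eval : ∀ {n} (P : Vec (Poly ℤ) n) t z → evalVec (pack-row P) t · z ≡ evalVec P t · unpack t z
  pack-row-eval []      t [] = refl
  pack-row-eval (p ∷ P) t z = trans (cong (_· z) (Vec.map-++ _⟨ + t ⟩ (shifts e p) (pack-row P)))
    (trans (++-· (evalVec (shifts e p) t) (evalVec (pack-row P) t) z)
    (cong₂ _+_ (shifts-eval e p t (Vec.take e z)) (pack-row-eval P t (Vec.drop e z))))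

  take-++ : ∀ {m k} (u : Vec ℤ m) (v : Vec ℤ k) → Vec.take m (u Vec.++ v) ≡ u
  take-++ []      v = refl
  take-++ (x ∷ u) v = cong (x ∷_) (take-++ u v)

  drop-++ : ∀ {m k} (u : Vec ℤ m) (v : Vec ℤ k) → Vec.drop m (u Vec.++ v) ≡ v
  drop-++ []      v = refl
  drop-++ (x ∷ u) v = drop-++ u v

  InPowerBox : ∀ {n} → ℕ → Vec ℤ n → Set
  InPowerBox t = All (λ i → 0ℤ ≤ i × i < + (t ^ e))

  unpack-box : ∀ {n} t (z : Vec ℤ (n ℕ.* e)) → Box t z → InPowerBox t (unpack {n} t z)
  unpack-box {zero}  t z box = []
  unpack-box {suc n} t z box =
    (undigits-nonneg t (Vec.take e z) (All.take⁺ e box) , undigits-< t (Vec.take e z) (All.take⁺ e box))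
    ∷ unpack-box {n} t (Vec.drop e z) (All.drop⁺ e box)

  pack : ∀ {n} t (x : Vec ℤ n) → InPowerBox t x → ∃[ z ] Box t z × unpack {n} t z ≡ x
  pack t []      []                    = [] , [] , refl
  pack t (+ m ∷ x) ((_ , ℤ.+<+ m<) ∷ x<) =
    let u , boxᵤ , equ = digits t e m m< ; z , boxz , eqz = pack t x x<
    in u Vec.++ z , All.++⁺ boxᵤ boxz ,
       cong₂ _∷_ (trans (cong (undigits t) (take-++ u z)) equ) (trans (cong (unpack t) (drop-++ u z)) eqz)

  unpack-injective : ∀ {n} t {z z′ : Vec ℤ (n ℕ.* e)} → Box t z → Box t z′ → unpack {n} t z ≡ unpack t z′ → z ≡ z′
  unpack-injective {zero}  t {[]} {[]} _ _ _ = refl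
  unpack-injective {suc n} t {z} {z′} box box′ eq =
    trans (sym (Vec.take++drop≡id e z)) (trans (cong₂ Vec._++_
      (undigits-injective t _ _ (All.take⁺ e box) (All.take⁺ e box′) (Vec.∷-injectiveˡ eq))
      (unpack-injective {n} t (All.drop⁺ e box) (All.drop⁺ e box′) (Vec.∷-injectiveʳ eq)))
    (Vec.take++drop≡id e z′))

  unpack-rep : ∀ {D n} (g : Curve (n ℕ.* e)) → All (Rep D) g →
    ∃[ h ] All (Rep D) h × ∀ t → at h t ≡ unpack {n} t (at g t)
  unpack-rep {n = zero}  g rg = [] , [] , λ _ → refl
  unpack-rep {n = suc n} g rg =
    let h , rh , eq = unpack-rep {n = n} (Vec.drop e g) (All.drop⁺ e rg)
    in (λ t → undigits t (at (Vec.take e g) t)) ∷ h , rep-undigits (Vec.take e g) (All.take⁺ e rg) ∷ rh , λ t →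
       cong₂ _∷_ (cong (undigits t) (sym (Vec.take-map (λ u → u t) e g)))
         (trans (eq t) (cong (unpack t) (sym (Vec.drop-map (λ u → u t) e g))))

  Solutions : ∀ {n} → List (Vec (Poly ℤ) n × Poly ℤ) → ℕ → Vec ℤ n → Set
  Solutions E t x = InPowerBox t x × ListAll (λ (P , b) → evalVec P t · x ≡ b ⟨ + t ⟩) E

  -- The right-hand side becomes the coefficient `- b` of the constant entry 1, and the initial
  -- carry is 0.
  to-equation : ∀ {n} → Vec (Poly ℤ) n × Poly ℤ → Equation (n ℕ.* e)
  to-equation (P , b) = coefficients (scale -1ℤ b ∷ pack-row P) , 0ℤ

  to-equation-value : ∀ {n} (P : Vec (Poly ℤ) n) b t z →
    at-point (proj₁ (to-equation (P , b))) z ⟨ + t ⟩ + 0ℤ ≡ evalVec P t · unpack t z - b ⟨ + t ⟩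
  to-equation-value P b t z = trans (cong (_+ 0ℤ) (trans (coefficients-eval (scale -1ℤ b ∷ pack-row P) (1ℤ ∷ z) t)
      (cong₂ (λ r s → r * 1ℤ + s) (scale-eval -1ℤ b (+ t)) (pack-row-eval P t z))))
    (lemma (b ⟨ + t ⟩) (evalVec P t · unpack t z))
    where
    lemma : ∀ b X → -1ℤ * b * 1ℤ + X + 0ℤ ≡ X - b
    lemma = solve-∀

  constants-eval : ∀ {n} (v : Vec ℤ n) t → evalVec (Vec.map constant v) t ≡ v
  constants-eval []      t = refl
  constants-eval (a ∷ v) t = cong₂ _∷_ (constant-eval a (+ t)) (constants-eval v t)

  good-solutions : ∀ ℓ {n} (E : List (Vec (Poly ℤ) n × Poly ℤ)) → Good ℓ (Solutions E)
  good-solutions ℓ {n} E = good-image ℓ unpack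
    (λ t z ((box , _) , E≡) → unpack-box t z box ,
      ListAll.map (λ {(P , b)} eq → ℤ.i-j≡0⇒i≡j _ _ (trans (sym (to-equation-value P b t z)) eq)) (ListAll.map⁻ E≡))
    (λ t x (x< , E≡) → let z , box , eq = pack t x x< in z ,
      ((box , [] , []) , ListAll.map⁺ (ListAll.map (λ {(P , b)} eq′ → trans (to-equation-value P b t z)
        (ℤ.i≡j⇒i-j≡0 (trans (cong (evalVec P t ·_) eq) eq′))) E≡)) , eq)
    (λ t z∈ z′∈ eq → unpack-injective t (proj₁ (proj₁ z∈)) (proj₁ (proj₁ z′∈)) eq)
    -- The pulled-back objective has entries `v` times powers of `t`; at a fixed `t` this is an
    -- ordinary integer vector.
    (λ t v → evalVec (pack-row (Vec.map constant v)) t , λ {z} {z′} _ _ →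
      subst₂ _≤_ (objective t v z) (objective t v z′))
    (λ g rg _ → let h , rh , eq = unpack-rep g rg in h , rh , λ t _ → eq t)
    (good-equations ℓ (List.map to-equation E) [])
    where
    objective : ∀ t v z → evalVec (pack-row (Vec.map constant v)) t · z ≡ v · unpack t z
    objective t v z = trans (pack-row-eval (Vec.map constant v) t z) (cong (_· unpack t z) (constants-eval v t))

-- Size of solutions

entries≤∥∥ : ∀ {n} (p : Vec ℤ n) → All (λ i → ∣ i ∣ ℕ.≤ ∥ p ∥) p
entries≤∥∥ []      = []
entries≤∥∥ (i ∷ p) = ℕ.m≤m+n ∣ i ∣ ∥ p ∥ ∷ All.map (λ ≤p → ℕ.≤-trans ≤p (ℕ.m≤n+m ∥ p ∥ ∣ i ∣)) (entries≤∥∥ p)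

∣·∣≤∥∥*∥∥ : ∀ {n} (a p : Vec ℤ n) → ∣ a · p ∣ ℕ.≤ ∥ a ∥ ℕ.* ∥ p ∥
∣·∣≤∥∥*∥∥ a p = ∣·∣≤ a p ∥ p ∥ (entries≤∥∥ p)

∥comb∥≤ : ∀ {n} j (p : Vec ℤ n) k q → ∥ comb j p k q ∥ ℕ.≤ ∣ j ∣ ℕ.* ∥ p ∥ ℕ.+ ∣ k ∣ ℕ.* ∥ q ∥
∥comb∥≤ j []      k []      = ℕ.z≤n
∥comb∥≤ j (x ∷ p) k (y ∷ q) = begin
  ∣ j * x + k * y ∣ ℕ.+ ∥ comb j p k q ∥
    ≤⟨ ℕ.+-mono-≤ (ℤ.∣i+j∣≤∣i∣+∣j∣ (j * x) (k * y)) (∥comb∥≤ j p k q) ⟩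
  (∣ j * x ∣ ℕ.+ ∣ k * y ∣) ℕ.+ (∣ j ∣ ℕ.* ∥ p ∥ ℕ.+ ∣ k ∣ ℕ.* ∥ q ∥)
    ≡⟨ cong₂ (λ u v → (u ℕ.+ v) ℕ.+ (∣ j ∣ ℕ.* ∥ p ∥ ℕ.+ ∣ k ∣ ℕ.* ∥ q ∥)) (ℤ.abs-* j x) (ℤ.abs-* k y) ⟩
  (∣ j ∣ ℕ.* ∣ x ∣ ℕ.+ ∣ k ∣ ℕ.* ∣ y ∣) ℕ.+ (∣ j ∣ ℕ.* ∥ p ∥ ℕ.+ ∣ k ∣ ℕ.* ∥ q ∥)
    ≡⟨ lemma (∣ j ∣) (∣ x ∣) (∥ p ∥) (∣ k ∣) (∣ y ∣) (∥ q ∥) ⟩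
  ∣ j ∣ ℕ.* (∣ x ∣ ℕ.+ ∥ p ∥) ℕ.+ ∣ k ∣ ℕ.* (∣ y ∣ ℕ.+ ∥ q ∥) ∎
  where
  open ℕ.≤-Reasoning
  lemma : ∀ j x p k y q → (j ℕ.* x ℕ.+ k ℕ.* y) ℕ.+ (j ℕ.* p ℕ.+ k ℕ.* q) ≡ j ℕ.* (x ℕ.+ p) ℕ.+ k ℕ.* (y ℕ.+ q)
  lemma = ℕ.solve-∀

-- A list of items stands for the vector Σ k p.
Items : ℕ → Set
Items n = List (ℕ × Vec ℤ n)

module _ {n : ℕ} where

  -- The represented vector is never formed: it is compared with others through its products with
  -- all `b`.
  value : Vec ℤ n → Items n → ℤ
  value b []            = 0ℤ
  value b ((k , p) ∷ I) = + k * (b · p) + value b I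

  weight : Items n → ℕ
  weight []            = 0
  weight ((k , p) ∷ I) = k ℕ.* ∥ p ∥ ℕ.+ weight I

  value-++ : ∀ b I J → value b (I ++ J) ≡ value b I + value b J
  value-++ b []            J = sym (ℤ.+-identityˡ _)
  value-++ b ((k , p) ∷ I) J = trans (cong (λ s → + k * (b · p) + s) (value-++ b I J)) (sym (ℤ.+-assoc (+ k * (b · p)) _ _))

  weight-++ : ∀ I J → weight (I ++ J) ≡ weight I ℕ.+ weight J
  weight-++ []            J = refl
  weight-++ ((k , p) ∷ I) J = trans (cong (k ℕ.* ∥ p ∥ ℕ.+_) (weight-++ I J)) (sym (ℕ.+-assoc (k ℕ.* ∥ p ∥) _ _))

  ∣value∣≤ : ∀ b I → ∣ value b I ∣ ℕ.≤ ∥ b ∥ ℕ.* weight I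
  ∣value∣≤ b []            = ℕ.z≤n
  ∣value∣≤ b ((k , p) ∷ I) = begin
    ∣ + k * (b · p) + value b I ∣                        ≤⟨ ℤ.∣i+j∣≤∣i∣+∣j∣ (+ k * (b · p)) (value b I) ⟩
    ∣ + k * (b · p) ∣ ℕ.+ ∣ value b I ∣                  ≡⟨ cong (ℕ._+ ∣ value b I ∣) (ℤ.abs-* (+ k) (b · p)) ⟩
    k ℕ.* ∣ b · p ∣ ℕ.+ ∣ value b I ∣                    ≤⟨ ℕ.+-mono-≤ (ℕ.*-monoʳ-≤ k (∣·∣≤∥∥*∥∥ b p)) (∣value∣≤ b I) ⟩
    k ℕ.* (∥ b ∥ ℕ.* ∥ p ∥) ℕ.+ ∥ b ∥ ℕ.* weight I       ≡⟨ lemma k ∥ b ∥ ∥ p ∥ (weight I) ⟩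
    ∥ b ∥ ℕ.* (k ℕ.* ∥ p ∥ ℕ.+ weight I)                 ∎
    where
    open ℕ.≤-Reasoning
    lemma : ∀ k b p w → k ℕ.* (b ℕ.* p) ℕ.+ b ℕ.* w ≡ b ℕ.* (k ℕ.* p ℕ.+ w)
    lemma = ℕ.solve-∀

  Closed : Pred (Vec ℤ n) 0ℓ → Set
  Closed C = ∀ {j k p q} → 0ℤ < j → 0ℤ < k → C p → C q → C (comb j p k q)

  -- One row a is eliminated by trading items p, q on which a has opposite
  -- signs for copies of w = |a q| p + |a p| q, which a annihilates.
  module Balance (C : Pred (Vec ℤ n) 0ℓ) (closed : Closed C) (a : Vec ℤ n) (Δ : ℕ) where

    -- `D` bounds `|a · p|` for short `p`, hence both coefficients of a traded vector `w`, whose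
    -- norm is then at most `2 D Δ`. `Δ′` leaves room for these vectors and for short ones that `a`
    -- annihilates already.
    D Δ′ : ℕ
    D  = ∥ a ∥ ℕ.* Δ
    Δ′ = Δ ℕ.+ 2 ℕ.* (D ℕ.* Δ)

    Short : Vec ℤ n → Set
    Short p = C p × ∥ p ∥ ℕ.≤ Δ

    Aligned : ℤ → Vec ℤ n → Set
    Aligned s p = Short p × 0ℤ < s * (a · p)

    Neutral : Vec ℤ n → Set
    Neutral p = C p × ∥ p ∥ ℕ.≤ Δ′ × a · p ≡ 0ℤ

    -- `stock` keeps the items on which `a` has one common sign, `done` those it annihilates, and
    -- `rest` the remainders of divisions. By `count` the number of items never grows from row to
    -- row, and by `rest-≤` every remainder is paid for by an item of `done`.
    record Balanced (I : Items n) : Set where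
      field
        sign      : ℤ
        ∣sign∣    : ∣ sign ∣ ≡ 1
        stock     : Items n
        done      : Items n
        rest      : Items n
        stock-all : ListAll (Aligned sign ∘ proj₂) stock
        done-all  : ListAll (Neutral ∘ proj₂) done
        same      : ∀ b → value b I ≡ value b stock + value b done + value b rest
        count     : length stock ℕ.+ length done ℕ.≤ length I
        rest-≤    : weight rest ℕ.≤ length done ℕ.* (D ℕ.* Δ)

    open Balanced

    ∣a·∣≤D : ∀ s p → ∣ s ∣ ≡ 1 → Short p → ∣ s * (a · p) ∣ ℕ.≤ D
    ∣a·∣≤D s p ∣s∣≡1 (_ , p≤Δ) = begin
      ∣ s * (a · p) ∣           ≡⟨ ℤ.abs-* s (a · p) ⟩
      ∣ s ∣ ℕ.* ∣ a · p ∣       ≡⟨ cong (ℕ._* ∣ a · p ∣) ∣s∣≡1 ⟩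
      1 ℕ.* ∣ a · p ∣           ≡⟨ ℕ.*-identityˡ ∣ a · p ∣ ⟩
      ∣ a · p ∣                 ≤⟨ ∣·∣≤∥∥*∥∥ a p ⟩
      ∥ a ∥ ℕ.* ∥ p ∥           ≤⟨ ℕ.*-monoʳ-≤ ∥ a ∥ p≤Δ ⟩
      D                         ∎
      where open ℕ.≤-Reasoning

    leftover-≤ : ∀ {A : ℕ} k .{{_ : ℕ.NonZero A}} (p : Vec ℤ n) → A ℕ.≤ D → ∥ p ∥ ℕ.≤ Δ → (k % A) ℕ.* ∥ p ∥ ℕ.≤ D ℕ.* Δ
    leftover-≤ {A} k p A≤D p≤Δ = ℕ.*-mono-≤ (ℕ.≤-trans (ℕ.<⇒≤ (ℕ.m%n<n k A)) A≤D) p≤Δ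

    module Trade {s p q} (∣s∣≡1 : ∣ s ∣ ≡ 1) (p∈ : Aligned (- s) p) (q∈ : Aligned s q) where

      α β : ℤ
      α = s * (a · q)
      β = - s * (a · p)

      A B : ℕ
      A = ∣ α ∣
      B = ∣ β ∣

      instance
        A≢0 : ℕ.NonZero A
        A≢0 = ℕ.≢-nonZero λ eq → ℤ.<-irrefl (sym (ℤ.∣i∣≡0⇒i≡0 eq)) (proj₂ q∈)
        B≢0 : ℕ.NonZero B
        B≢0 = ℕ.≢-nonZero λ eq → ℤ.<-irrefl (sym (ℤ.∣i∣≡0⇒i≡0 eq)) (proj₂ p∈)

      A≡ : + A ≡ α
      A≡ = ℤ.0≤i⇒+∣i∣≡i (ℤ.<⇒≤ (proj₂ q∈))
      B≡ : + B ≡ β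
      B≡ = ℤ.0≤i⇒+∣i∣≡i (ℤ.<⇒≤ (proj₂ p∈))

      A≤D : A ℕ.≤ D
      A≤D = ∣a·∣≤D s q ∣s∣≡1 (proj₁ q∈)
      B≤D : B ℕ.≤ D
      B≤D = ∣a·∣≤D (- s) p (trans (ℤ.∣-i∣≡∣i∣ s) ∣s∣≡1) (proj₁ p∈)

      w : Vec ℤ n
      w = comb α p β q

      w-neutral : Neutral w
      w-neutral = closed (proj₂ q∈) (proj₂ p∈) (proj₁ (proj₁ p∈)) (proj₁ (proj₁ q∈))
        , (begin
            ∥ w ∥                                    ≤⟨ ∥comb∥≤ α p β q ⟩
            A ℕ.* ∥ p ∥ ℕ.+ B ℕ.* ∥ q ∥              ≤⟨ ℕ.+-mono-≤ (ℕ.*-mono-≤ A≤D (proj₂ (proj₁ p∈))) (ℕ.*-mono-≤ B≤D (proj₂ (proj₁ q∈))) ⟩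
            D ℕ.* Δ ℕ.+ D ℕ.* Δ                      ≡⟨ cong (D ℕ.* Δ ℕ.+_) (ℕ.+-identityʳ (D ℕ.* Δ)) ⟨
            2 ℕ.* (D ℕ.* Δ)                          ≤⟨ ℕ.m≤n+m _ Δ ⟩
            Δ′                                       ∎)
        , trans (·-comb a α p β q) (lemma s (a · p) (a · q))
        where
        open ℕ.≤-Reasoning
        lemma : ∀ s P Q → (s * Q) * P + (- s * P) * Q ≡ 0ℤ
        lemma = solve-∀

      w-value : ∀ b → b · w ≡ + A * (b · p) + + B * (b · q)
      w-value b = trans (·-comb b α p β q) (sym (cong₂ (λ u v → u * (b · p) + v * (b · q)) A≡ B≡))

    split-count : ∀ k A .{{_ : ℕ.NonZero A}} → + k ≡ + (k % A) + + (k / A) * + A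
    split-count k A = trans (cong +_ (ℕ.m≡m%n+[m/n]*n k A)) (trans (ℤ.pos-+ (k % A) _)
      (cong (λ s → + (k % A) + s) (ℤ.pos-* (k / A) A)))

    split-count′ : ∀ l c B → c ℕ.* B ℕ.≤ l → + l ≡ + (l ∸ c ℕ.* B) + + c * + B
    split-count′ l c B cB≤l = trans (cong +_ (sym (ℕ.m∸n+n≡m cB≤l))) (trans (ℤ.pos-+ (l ∸ c ℕ.* B) _)
      (cong (λ s → + (l ∸ c ℕ.* B) + s) (ℤ.pos-* c B)))

    -- One copy of `w` uses `A` copies of `p` and `B` copies of `q`. Trading as often as both
    -- supplies allow exhausts one of them up to a remainder: if it is `p`, the rest of the stock is
    -- untouched; if it is `q`, the surplus of `p` meets the next item of the stock.
    absorb : ∀ s → ∣ s ∣ ≡ 1 → ∀ k p → Aligned (- s) p → ∀ S → ListAll (Aligned s ∘ proj₂) S →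
      Balanced ((k , p) ∷ S)
    absorb s ∣s∣≡1 k p p∈ [] [] = record
      -- The old stock is used up, so what is left of `p` forms a stock of the opposite sign.
      { sign = - s ; ∣sign∣ = trans (ℤ.∣-i∣≡∣i∣ s) ∣s∣≡1
      ; stock = (k , p) ∷ [] ; done = [] ; rest = []
      ; stock-all = p∈ ∷ [] ; done-all = []
      ; same = λ b → lemma (+ k * (b · p)) ; count = ℕ.≤-refl ; rest-≤ = ℕ.z≤n }
      where
      lemma : ∀ x → x + 0ℤ ≡ x + 0ℤ + 0ℤ + 0ℤ
      lemma = solve-∀
    absorb s ∣s∣≡1 k p p∈ ((l , q) ∷ S) (q∈ ∷ S∈) = trade (ℕ.≤-total (k / A) (l / B))
      where
      open Trade {s} {p} {q} ∣s∣≡1 p∈ q∈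
      trade : k / A ℕ.≤ l / B ⊎ l / B ℕ.≤ k / A → Balanced ((k , p) ∷ (l , q) ∷ S)
      trade (inj₁ c≤) = record
        { sign = s ; ∣sign∣ = ∣s∣≡1
        ; stock = (l ∸ c ℕ.* B , q) ∷ S ; done = (c , w) ∷ [] ; rest = (k % A , p) ∷ []
        ; stock-all = q∈ ∷ S∈ ; done-all = w-neutral ∷ []
        ; same = λ b → trans
            (cong₂ (λ u v → u * (b · p) + (v * (b · q) + value b S)) (split-count k A) (split-count′ l c B cB≤l))
            (trans (lemma (+ (k % A)) (+ c) (+ A) (b · p) (+ (l ∸ c ℕ.* B)) (+ B) (b · q) (value b S))
              (cong (λ v → (+ (l ∸ c ℕ.* B) * (b · q) + value b S) + (+ c * v + 0ℤ) + (+ (k % A) * (b · p) + 0ℤ)) (sym (w-value b))))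
        ; count = ℕ.≤-reflexive (cong suc (ℕ.+-comm (length S) 1))
        ; rest-≤ = ℕ.+-monoˡ-≤ 0 (leftover-≤ k p A≤D (proj₂ (proj₁ p∈))) }
        where
        c = k / A
        cB≤l : c ℕ.* B ℕ.≤ l
        cB≤l = ℕ.≤-trans (ℕ.*-monoˡ-≤ B c≤) (ℕ.m/n*n≤m l B)
        lemma : ∀ r c A P l B Q S → (r + c * A) * P + ((l + c * B) * Q + S) ≡
          (l * Q + S) + (c * (A * P + B * Q) + 0ℤ) + (r * P + 0ℤ)
        lemma = solve-∀
      trade (inj₂ c≤) = record
        { sign = sign rec ; ∣sign∣ = ∣sign∣ rec
        ; stock = stock rec ; done = (c , w) ∷ done rec ; rest = (l % B , q) ∷ rest rec
        ; stock-all = stock-all rec ; done-all = w-neutral ∷ done-all rec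
        ; same = λ b → trans
            (cong₂ (λ u v → u * (b · p) + (v * (b · q) + value b S)) (split-count′ k c A cA≤k) (split-count l B))
            (trans (lemma (+ (k ∸ c ℕ.* A)) (+ c) (+ A) (b · p) (+ (l % B)) (+ B) (b · q) (value b S))
            (trans (cong₂ (λ u v → u + + c * v + + (l % B) * (b · q)) (same rec b) (sym (w-value b)))
              (lemma′ (value b (stock rec)) (value b (done rec)) (value b (rest rec)) (+ c * (b · w)) (+ (l % B) * (b · q)))))
        ; count = subst (ℕ._≤ suc (suc (length S))) (sym (ℕ.+-suc (length (stock rec)) (length (done rec)))) (ℕ.s≤s (count rec))
        ; rest-≤ = ℕ.+-mono-≤ (leftover-≤ l q B≤D (proj₂ (proj₁ q∈))) (rest-≤ rec) }
        where
        c = l / B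
        cA≤k : c ℕ.* A ℕ.≤ k
        cA≤k = ℕ.≤-trans (ℕ.*-monoˡ-≤ A c≤) (ℕ.m/n*n≤m k A)
        rec = absorb s ∣s∣≡1 (k ∸ c ℕ.* A) p p∈ S S∈
        lemma : ∀ r c A P l B Q S → (r + c * A) * P + ((l + c * B) * Q + S) ≡
          (r * P + S) + c * (A * P + B * Q) + l * Q
        lemma = solve-∀
        lemma′ : ∀ s d r w q → s + d + r + w + q ≡ s + (w + d) + (q + r)
        lemma′ = solve-∀

    balance : ∀ I → ListAll (Short ∘ proj₂) I → Balanced I
    balance [] [] = record
      { sign = 1ℤ ; ∣sign∣ = refl ; stock = [] ; done = [] ; rest = [] ; stock-all = [] ; done-all = []
      ; same = λ b → refl ; count = ℕ.z≤n ; rest-≤ = ℕ.z≤n }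
    balance ((k , p) ∷ I) (p∈ ∷ I∈) = insert (ℤ.<-cmp 0ℤ (s * (a · p)))
      where
      rec = balance I I∈
      s = sign rec
      insert : _ → Balanced ((k , p) ∷ I)
      insert (tri< >0 _ _) = record
        { sign = s ; ∣sign∣ = ∣sign∣ rec ; stock = (k , p) ∷ stock rec ; done = done rec ; rest = rest rec
        ; stock-all = (p∈ , >0) ∷ stock-all rec ; done-all = done-all rec
        ; same = λ b → trans (cong (λ v → + k * (b · p) + v) (same rec b))
            (lemma (+ k * (b · p)) (value b (stock rec)) (value b (done rec)) (value b (rest rec)))
        ; count = ℕ.s≤s (count rec) ; rest-≤ = rest-≤ rec }
        where
        lemma : ∀ x s d r → x + (s + d + r) ≡ (x + s) + d + r
        lemma = solve-∀
      insert (tri≈ _ 0≡ _) = record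
        { sign = s ; ∣sign∣ = ∣sign∣ rec ; stock = stock rec ; done = (k , p) ∷ done rec ; rest = rest rec
        ; stock-all = stock-all rec
        ; done-all = (proj₁ p∈ , ℕ.≤-trans (proj₂ p∈) (ℕ.m≤m+n Δ _) , a·p≡0) ∷ done-all rec
        ; same = λ b → trans (cong (λ v → + k * (b · p) + v) (same rec b))
            (lemma (+ k * (b · p)) (value b (stock rec)) (value b (done rec)) (value b (rest rec)))
        ; count = subst (ℕ._≤ suc (length I)) (sym (ℕ.+-suc (length (stock rec)) (length (done rec)))) (ℕ.s≤s (count rec))
        ; rest-≤ = ℕ.≤-trans (rest-≤ rec) (ℕ.m≤n+m _ (D ℕ.* Δ)) }
        where
        lemma : ∀ x s d r → x + (s + d + r) ≡ s + (x + d) + r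
        lemma = solve-∀
        a·p≡0 : a · p ≡ 0ℤ
        a·p≡0 with ℤ.i*j≡0⇒i≡0∨j≡0 s (sym 0≡)
        ... | inj₂ eq = eq
        ... | inj₁ s≡0 with trans (sym (∣sign∣ rec)) (cong ∣_∣ s≡0)
        ...   | ()
      insert (tri> _ _ <0) = record
        { sign = sign new ; ∣sign∣ = ∣sign∣ new
        ; stock = stock new ; done = done new ++ done rec ; rest = rest new ++ rest rec
        ; stock-all = stock-all new ; done-all = ListAll.++⁺ (done-all new) (done-all rec)
        ; same = λ b → trans (cong (λ v → + k * (b · p) + v) (same rec b))
            (trans (lemma (+ k * (b · p)) (value b (stock rec)) (value b (done rec)) (value b (rest rec)))
            (trans (cong (λ v → v + value b (done rec) + value b (rest rec)) (same new b))
            (trans (lemma′ (value b (stock new)) (value b (done new)) (value b (rest new)) (value b (done rec)) (value b (rest rec)))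
            (cong₂ (λ u v → value b (stock new) + u + v)
              (sym (value-++ b (done new) (done rec))) (sym (value-++ b (rest new) (rest rec)))))))
        ; count = begin
            length (stock new) ℕ.+ length (done new ++ done rec)         ≡⟨ cong (length (stock new) ℕ.+_) (List.length-++ (done new)) ⟩
            length (stock new) ℕ.+ (length (done new) ℕ.+ length (done rec)) ≡⟨ ℕ.+-assoc (length (stock new)) _ _ ⟨
            length (stock new) ℕ.+ length (done new) ℕ.+ length (done rec)   ≤⟨ ℕ.+-monoˡ-≤ (length (done rec)) (count new) ⟩
            suc (length (stock rec) ℕ.+ length (done rec))                   ≤⟨ ℕ.s≤s (count rec) ⟩
            suc (length I)                                                   ∎
        ; rest-≤ = begin
            weight (rest new ++ rest rec)                    ≡⟨ weight-++ (rest new) (rest rec) ⟩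
            weight (rest new) ℕ.+ weight (rest rec)          ≤⟨ ℕ.+-mono-≤ (rest-≤ new) (rest-≤ rec) ⟩
            length (done new) ℕ.* (D ℕ.* Δ) ℕ.+ length (done rec) ℕ.* (D ℕ.* Δ)
                                                             ≡⟨ ℕ.*-distribʳ-+ (D ℕ.* Δ) (length (done new)) (length (done rec)) ⟨
            (length (done new) ℕ.+ length (done rec)) ℕ.* (D ℕ.* Δ)
                                                             ≡⟨ cong (ℕ._* (D ℕ.* Δ)) (List.length-++ (done new)) ⟨
            length (done new ++ done rec) ℕ.* (D ℕ.* Δ)      ∎ }
        where
        open ℕ.≤-Reasoning
        new : Balanced ((k , p) ∷ stock rec)
        new = absorb s (∣sign∣ rec) k p
          (p∈ , subst (0ℤ <_) (ℤ.neg-distribˡ-* s (a · p)) (ℤ.neg-mono-< <0)) (stock rec) (stock-all rec)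
        lemma : ∀ x s d r → x + (s + d + r) ≡ (x + s) + d + r
        lemma = solve-∀
        lemma′ : ∀ s d r d′ r′ → s + d + r + d′ + r′ ≡ s + (d + d′) + (r + r′)
        lemma′ = solve-∀

    -- Nothing cancels in the stock: `k` copies contribute at least `k` to `s * value a S` and at
    -- most `Δ k` to the weight. Knowing the value of `a` on the stock therefore bounds the stock.
    stock-weight : ∀ s S → ListAll (Aligned s ∘ proj₂) S → + weight S ≤ + Δ * (s * value a S)
    stock-weight s []            []        = ℤ.≤-reflexive (sym (lemma s (+ Δ)))
      where
      lemma : ∀ s Δ → Δ * (s * 0ℤ) ≡ 0ℤ
      lemma = solve-∀
    stock-weight s ((k , p) ∷ S) (((_ , p≤Δ) , >0) ∷ S∈) = begin
      + (k ℕ.* ∥ p ∥ ℕ.+ weight S)                        ≡⟨ ℤ.pos-+ (k ℕ.* ∥ p ∥) (weight S) ⟩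
      + (k ℕ.* ∥ p ∥) + + weight S                        ≤⟨ ℤ.+-mono-≤ (ℤ.+≤+ (ℕ.*-monoʳ-≤ k p≤Δ)) (stock-weight s S S∈) ⟩
      + (k ℕ.* Δ) + + Δ * (s * value a S)                 ≡⟨ cong (λ v → v + + Δ * (s * value a S)) (trans (ℤ.pos-* k Δ) (sym (ℤ.*-identityʳ _))) ⟩
      + k * + Δ * 1ℤ + + Δ * (s * value a S)              ≤⟨ ℤ.+-monoˡ-≤ _ (ℤ.*-monoˡ-≤-nonNeg (+ k * + Δ) {{ℤ.nonNegative (0≤* {+ k} {+ Δ} (ℤ.+≤+ ℕ.z≤n) (ℤ.+≤+ ℕ.z≤n))}} (ℤ.i<j⇒suc[i]≤j >0)) ⟩
      + k * + Δ * (s * (a · p)) + + Δ * (s * value a S)   ≡⟨ lemma (+ k) (+ Δ) s (a · p) (value a S) ⟩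
      + Δ * (s * (+ k * (a · p) + value a S))             ∎
      where
      open ℤ.≤-Reasoning
      lemma : ∀ k Δ s P V → k * Δ * (s * P) + Δ * (s * V) ≡ Δ * (s * (k * P + V))
      lemma = solve-∀

    value-neutral : ∀ I → ListAll (Neutral ∘ proj₂) I → value a I ≡ 0ℤ
    value-neutral []            []                  = refl
    value-neutral ((k , p) ∷ I) ((_ , _ , eq) ∷ I∈) =
      trans (cong₂ (λ u v → + k * u + v) eq (value-neutral I I∈)) (trans (ℤ.+-identityʳ _) (ℤ.*-zeroʳ (+ k)))

  -- `σ` bounds the new remainders together with the old one. On the stock `a` takes the value `β`
  -- minus its value on these remainders, which gives the first summand.
  next-bound : ℕ → ℕ → ℕ → ℕ → ℕ → ℕ
  next-bound m α β Δ ρ = Δ ℕ.* (β ℕ.+ α ℕ.* σ) ℕ.+ σ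
    where σ = m ℕ.* (α ℕ.* Δ ℕ.* Δ) ℕ.+ ρ

  next-size : ℕ → ℕ → ℕ
  next-size α Δ = Δ ℕ.+ 2 ℕ.* (α ℕ.* Δ ℕ.* Δ)

  bound : ℕ → List (ℕ × ℕ) → ℕ → ℕ → ℕ
  bound m []             Δ ρ = ρ
  bound m ((α , β) ∷ αβ) Δ ρ = bound m αβ (next-size α Δ) (next-bound m α β Δ ρ)

  -- Invariant: `x` is the sum of `I` and `R`, where `C` records that the items of `I` are
  -- annihilated by all rows treated so far. Once no row is left, an item of `I` would contradict
  -- `pointed`, so `x` equals the bounded part `R`.
  eliminate-rows : ∀ m (rows : List (Vec ℤ n × ℤ)) Δ ρ (C : Pred (Vec ℤ n) 0ℓ) → Closed C →
    (∀ p → C p → ¬ ListAll (λ (a , _) → a · p ≡ 0ℤ) rows) →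
    ∀ x I R → ListAll (λ (_ , p) → C p × ∥ p ∥ ℕ.≤ Δ) I → length I ℕ.≤ m → weight R ℕ.≤ ρ →
    (∀ b → b · x ≡ value b I + value b R) → ListAll (λ (a , β) → a · x ≡ β) rows →
    ∃[ R′ ] weight R′ ℕ.≤ bound m (List.map (λ (a , β) → ∥ a ∥ , ∣ β ∣) rows) Δ ρ × (∀ b → b · x ≡ value b R′)
  eliminate-rows m [] Δ ρ C closed pointed x [] R [] _ R≤ρ eq [] = R , R≤ρ , λ b → trans (eq b) (ℤ.+-identityˡ _)
  eliminate-rows m [] Δ ρ C closed pointed x ((k , p) ∷ I) R ((p∈ , _) ∷ _) _ R≤ρ eq [] = contradiction [] (pointed p p∈)
  eliminate-rows m ((a , β) ∷ rows) Δ ρ C closed pointed x I R I∈ I≤m R≤ρ eq (a·x≡β ∷ rows≡) =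
    eliminate-rows m rows (next-size ∥ a ∥ Δ) (next-bound m ∥ a ∥ ∣ β ∣ Δ ρ) (λ p → C p × a · p ≡ 0ℤ)
      (λ {j} {k} {p} {q} 0<j 0<k (p∈ , a·p) (q∈ , a·q) → closed 0<j 0<k p∈ q∈ ,
        trans (·-comb a j p k q) (trans (cong₂ (λ u v → j * u + k * v) a·p a·q) (lemma₀ j k)))
      (λ p (p∈ , a·p) rows≡0 → pointed p p∈ (a·p ∷ rows≡0))
      x done (stock ++ rest ++ R)
      (ListAll.map (λ (p∈ , p≤ , a·p) → (p∈ , a·p) , p≤) done-all)
      (ℕ.≤-trans (ℕ.m≤n+m _ (length stock)) (ℕ.≤-trans count I≤m))
      weight-≤
      (λ b → trans (eq b) (trans (cong (_+ value b R) (same b))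
        (trans (lemma (value b stock) (value b done) (value b rest) (value b R))
        (cong (λ v → value b done + v) (sym (trans (value-++ b stock (rest ++ R)) (cong (λ v → value b stock + v) (value-++ b rest R))))))))
      rows≡
    where
    open Balance C closed a Δ
    open Balanced (balance I I∈)
    σ = m ℕ.* (D ℕ.* Δ) ℕ.+ ρ
    lemma₀ : ∀ j k → j * 0ℤ + k * 0ℤ ≡ 0ℤ
    lemma₀ = solve-∀
    lemma : ∀ s d r R → s + d + r + R ≡ d + (s + (r + R))
    lemma = solve-∀
    rest++R-≤ : weight (rest ++ R) ℕ.≤ σ
    rest++R-≤ = subst (ℕ._≤ σ) (sym (weight-++ rest R)) (ℕ.+-mono-≤
      (ℕ.≤-trans rest-≤ (ℕ.*-monoˡ-≤ (D ℕ.* Δ) (ℕ.≤-trans (ℕ.m≤n+m _ (length stock)) (ℕ.≤-trans count I≤m)))) R≤ρ)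
    stock-value : value a stock ≡ β - value a (rest ++ R)
    stock-value = trans (lemma₁ (value a stock) (value a rest) (value a R))
      (cong₂ _-_ (sym (trans (sym a·x≡β) (trans (eq a) (cong (_+ value a R)
        (trans (same a) (cong (λ v → value a stock + v + value a rest) (value-neutral done done-all)))))))
        (sym (value-++ a rest R)))
      where
      lemma₁ : ∀ s r R → s ≡ (s + 0ℤ + r + R) - (r + R)
      lemma₁ = solve-∀
    stock-≤ : weight stock ℕ.≤ Δ ℕ.* (∣ β ∣ ℕ.+ ∥ a ∥ ℕ.* σ)
    stock-≤ = ℤ.drop‿+≤+ (begin
      + weight stock                                 ≤⟨ stock-weight sign stock stock-all ⟩
      + Δ * (sign * value a stock)                   ≤⟨ ℤ.*-monoˡ-≤-nonNeg (+ Δ) (i≤∣i∣ (sign * value a stock)) ⟩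
      + Δ * + ∣ sign * value a stock ∣               ≡⟨ ℤ.pos-* Δ _ ⟨
      + (Δ ℕ.* ∣ sign * value a stock ∣)             ≤⟨ ℤ.+≤+ (ℕ.*-monoʳ-≤ Δ abs-≤) ⟩
      + (Δ ℕ.* (∣ β ∣ ℕ.+ ∥ a ∥ ℕ.* σ))              ∎)
      where
      open ℤ.≤-Reasoning
      abs-≤ : ∣ sign * value a stock ∣ ℕ.≤ ∣ β ∣ ℕ.+ ∥ a ∥ ℕ.* σ
      abs-≤ = ℕ.≤-trans (ℕ.≤-reflexive (trans (ℤ.abs-* sign _)
                (trans (cong (ℕ._* ∣ value a stock ∣) ∣sign∣) (trans (ℕ.*-identityˡ _) (cong ∣_∣ stock-value)))))
        (ℕ.≤-trans (ℤ.∣i-j∣≤∣i∣+∣j∣ β (value a (rest ++ R)))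
          (ℕ.+-monoʳ-≤ ∣ β ∣ (ℕ.≤-trans (∣value∣≤ a (rest ++ R)) (ℕ.*-monoʳ-≤ ∥ a ∥ rest++R-≤))))
    weight-≤ : weight (stock ++ rest ++ R) ℕ.≤ next-bound m ∥ a ∥ ∣ β ∣ Δ ρ
    weight-≤ = subst (ℕ._≤ next-bound m ∥ a ∥ ∣ β ∣ Δ ρ) (sym (weight-++ stock (rest ++ R))) (ℕ.+-mono-≤ stock-≤ rest++R-≤)

-- Bounds for nonnegative solutions

ones : ∀ n → Vec ℤ n
ones n = Vec.replicate n 1ℤ

NonnegVec : ∀ {n} → Vec ℤ n → Set
NonnegVec = All (0ℤ ≤_)

NonnegVec-comb : ∀ {n j k} {p q : Vec ℤ n} → 0ℤ ≤ j → 0ℤ ≤ k → NonnegVec p → NonnegVec q → NonnegVec (comb j p k q)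
NonnegVec-comb 0≤j 0≤k []        []        = []
NonnegVec-comb 0≤j 0≤k (≥0 ∷ p≥0) (≥0′ ∷ q≥0) = 0≤+ (0≤* 0≤j ≥0) (0≤* 0≤k ≥0′) ∷ NonnegVec-comb 0≤j 0≤k p≥0 q≥0

-- A nonnegative vector is nonzero exactly when its entries have a positive sum, and in this form
-- closure under positive combinations is immediate.
Positive : ∀ {n} → Vec ℤ n → Set
Positive {n} p = NonnegVec p × 0ℤ < ones n · p

Positive-closed : ∀ {n} → Closed (Positive {n})
Positive-closed {n} {j} {k} {p} {q} 0<j 0<k (p≥0 , p>0) (q≥0 , q>0) =
  NonnegVec-comb (ℤ.<⇒≤ 0<j) (ℤ.<⇒≤ 0<k) p≥0 q≥0 ,
  subst (0ℤ <_) (sym (·-comb (ones n) j p k q)) (ℤ.+-mono-< (0<* 0<j p>0) (0<* 0<k q>0))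
  where
  0<* : ∀ {i j} → 0ℤ < i → 0ℤ < j → 0ℤ < i * j
  0<* {i} {j} 0<i 0<j = subst (_< i * j) (ℤ.*-zeroʳ i) (ℤ.*-monoˡ-<-pos i {{ℤ.positive 0<i}} 0<j)

sum-nonneg : ∀ {n} {x : Vec ℤ n} → NonnegVec x → 0ℤ ≤ ones n · x
sum-nonneg []         = ℤ.≤-refl
sum-nonneg (≥0 ∷ x≥0) = 0≤+ (0≤* {1ℤ} (ℤ.+≤+ ℕ.z≤n) ≥0) (sum-nonneg x≥0)

entries≤sum : ∀ {n} {x : Vec ℤ n} → NonnegVec x → All (λ i → i ≤ ones n · x) x
entries≤sum [] = []
entries≤sum {x = i ∷ x} (≥0 ∷ x≥0) =
  ≤-of-difference (sum-nonneg x≥0) (lemma i _) ∷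
  All.map (λ ≤s → ℤ.≤-trans ≤s (≤-of-difference ≥0 (lemma′ i _))) (entries≤sum x≥0)
  where
  lemma : ∀ i S → 1ℤ * i + S - i ≡ S
  lemma = solve-∀
  lemma′ : ∀ i S → 1ℤ * i + S - S ≡ i
  lemma′ = solve-∀

-- The expansion in the standard basis, from which the elimination of rows starts with items of norm
-- 1 and no remainder.
units : ∀ {n} → Vec ℤ n → Items n
units []      = []
units (i ∷ x) = (∣ i ∣ , 1ℤ ∷ Vec.replicate _ 0ℤ) ∷ List.map (λ (k , p) → k , 0ℤ ∷ p) (units x)

length-units : ∀ {n} (x : Vec ℤ n) → length (units x) ≡ n
length-units []      = refl
length-units (i ∷ x) = cong suc (trans (List.length-map _ (units x)) (length-units x))

value-units : ∀ {n} (b x : Vec ℤ n) → NonnegVec x → value b (units x) ≡ b · x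
value-units []       []      []         = refl
value-units (c ∷ b) (i ∷ x) (≥0 ∷ x≥0) = cong₂ _+_
  (trans (cong₂ (λ u v → u * (c * 1ℤ + v)) (ℤ.0≤i⇒+∣i∣≡i ≥0) (trans (·-comm b _) (0-· b))) (lemma c i))
  (trans (value-pad (units x)) (value-units b x x≥0))
  where
  lemma : ∀ c i → i * (c * 1ℤ + 0ℤ) ≡ c * i
  lemma = solve-∀
  value-pad : ∀ I → value (c ∷ b) (List.map (λ (k , p) → k , 0ℤ ∷ p) I) ≡ value b I
  value-pad []            = refl
  value-pad ((k , p) ∷ I) = cong₂ (λ u v → + k * u + v)
    (trans (cong (_+ b · p) (ℤ.*-zeroʳ c)) (ℤ.+-identityˡ _)) (value-pad I)

∥0∥ : ∀ n → ∥ Vec.replicate n 0ℤ ∥ ≡ 0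
∥0∥ zero    = refl
∥0∥ (suc n) = ∥0∥ n

0-nonneg : ∀ n → NonnegVec (Vec.replicate n 0ℤ)
0-nonneg zero    = []
0-nonneg (suc n) = ℤ.≤-refl ∷ 0-nonneg n

units-positive : ∀ {n} (x : Vec ℤ n) → ListAll (λ (_ , p) → Positive p × ∥ p ∥ ℕ.≤ 1) (units x)
units-positive []      = []
units-positive {suc n} (i ∷ x) =
  ((ℤ.+≤+ ℕ.z≤n ∷ 0-nonneg n ,
     subst (0ℤ <_) (sym (cong (λ s → 1ℤ + s) (trans (·-comm (ones n) _) (0-· (ones n))))) (ℤ.+<+ (ℕ.s≤s ℕ.z≤n))) ,
   ℕ.≤-reflexive (cong suc (∥0∥ n))) ∷
  ListAll.map⁺ (ListAll.map (λ ((p≥0 , p>0) , p≤1) → (ℤ.≤-refl ∷ p≥0 , subst (0ℤ <_) (sym (ℤ.+-identityˡ _)) p>0) , p≤1)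
    (units-positive x))

solution-≤ : ∀ {n} (rows : List (Vec ℤ n × ℤ)) →
  (∀ p → Positive p → ¬ ListAll (λ (a , _) → a · p ≡ 0ℤ) rows) →
  ∀ x → NonnegVec x → ListAll (λ (a , β) → a · x ≡ β) rows →
  All (λ i → i ≤ + (∥ ones n ∥ ℕ.* bound {n} n (List.map (λ (a , β) → ∥ a ∥ , ∣ β ∣) rows) 1 0)) x
solution-≤ {n} rows pointed x x≥0 rows≡ =
  let R , R≤ , eq = eliminate-rows n rows 1 0 Positive Positive-closed pointed x (units x) []
        (units-positive x) (ℕ.≤-reflexive (length-units x)) ℕ.z≤n
        (λ b → sym (trans (ℤ.+-identityʳ _) (value-units b x x≥0))) rows≡
      sum≤ = ℤ.≤-trans (ℤ.≤-reflexive (eq (ones n))) (ℤ.≤-trans (i≤∣i∣ (value (ones n) R))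
               (ℤ.+≤+ (ℕ.≤-trans (∣value∣≤ (ones n) R) (ℕ.*-monoʳ-≤ ∥ ones n ∥ R≤))))
  in All.map (λ i≤ → ℤ.≤-trans i≤ sum≤) (entries≤sum x≥0)

-- Functions bounded by a power of `t`

PolyBounded : (ℕ → ℕ) → Set
PolyBounded g = ∃[ e ] ∀ t → 2 ℕ.≤ t → g t ℕ.≤ t ^ e

1≤^ : ∀ {t} e → 2 ℕ.≤ t → 1 ℕ.≤ t ^ e
1≤^ {t} e 2≤t = ℕ.m^n>0 t {{ℕ.>-nonZero (ℕ.<-trans (ℕ.s≤s ℕ.z≤n) 2≤t)}} e

-- A further factor `t` absorbs the factor 2 of the sum; this is why the bounds start at `t = 2`.
pb-+ : ∀ {g h} → PolyBounded g → PolyBounded h → PolyBounded (λ t → g t ℕ.+ h t)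
pb-+ {g} {h} (d , g≤) (e , h≤) = 1 ℕ.+ (d ℕ.+ e) , λ t 2≤t → begin
  g t ℕ.+ h t                            ≤⟨ ℕ.+-mono-≤ (g≤ t 2≤t) (h≤ t 2≤t) ⟩
  t ^ d ℕ.+ t ^ e                        ≡⟨ cong₂ ℕ._+_ (ℕ.*-identityʳ (t ^ d)) (ℕ.*-identityˡ (t ^ e)) ⟨
  t ^ d ℕ.* 1 ℕ.+ 1 ℕ.* t ^ e            ≤⟨ ℕ.+-mono-≤ (ℕ.*-monoʳ-≤ (t ^ d) (1≤^ e 2≤t)) (ℕ.*-monoˡ-≤ (t ^ e) (1≤^ d 2≤t)) ⟩
  t ^ d ℕ.* t ^ e ℕ.+ t ^ d ℕ.* t ^ e    ≡⟨ cong (λ s → s ℕ.+ s) (sym (ℕ.^-distribˡ-+-* t d e)) ⟩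
  t ^ (d ℕ.+ e) ℕ.+ t ^ (d ℕ.+ e)        ≡⟨ cong (t ^ (d ℕ.+ e) ℕ.+_) (ℕ.+-identityʳ (t ^ (d ℕ.+ e))) ⟨
  2 ℕ.* t ^ (d ℕ.+ e)                    ≤⟨ ℕ.*-monoˡ-≤ (t ^ (d ℕ.+ e)) 2≤t ⟩
  t ^ (1 ℕ.+ (d ℕ.+ e))                  ∎
  where open ℕ.≤-Reasoning

pb-* : ∀ {g h} → PolyBounded g → PolyBounded h → PolyBounded (λ t → g t ℕ.* h t)
pb-* (d , g≤) (e , h≤) = d ℕ.+ e , λ t 2≤t →
  ℕ.≤-trans (ℕ.*-mono-≤ (g≤ t 2≤t) (h≤ t 2≤t)) (ℕ.≤-reflexive (sym (ℕ.^-distribˡ-+-* t d e)))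

pb-id : PolyBounded (λ t → t)
pb-id = 1 , λ t _ → ℕ.≤-reflexive (sym (ℕ.*-identityʳ t))

pb-const : ∀ k → PolyBounded (λ _ → k)
pb-const zero    = 0 , λ _ _ → ℕ.z≤n
pb-const (suc k) = pb-+ (0 , λ _ _ → ℕ.≤-refl) (pb-const k)

pb-≤ : ∀ {g h} → (∀ t → g t ℕ.≤ h t) → PolyBounded h → PolyBounded g
pb-≤ g≤h (e , h≤) = e , λ t 2≤t → ℕ.≤-trans (g≤h t) (h≤ t 2≤t)

pb-poly : ∀ p → PolyBounded (λ t → ∣ p ⟨ + t ⟩ ∣)
pb-poly []      = pb-const 0
pb-poly (a ∷ p) = pb-≤
  (λ t → ℕ.≤-trans (ℤ.∣i+j∣≤∣i∣+∣j∣ a (+ t * p ⟨ + t ⟩)) (ℕ.≤-reflexive (cong (∣ a ∣ ℕ.+_) (ℤ.abs-* (+ t) (p ⟨ + t ⟩)))))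
  (pb-+ (pb-const ∣ a ∣) (pb-* pb-id (pb-poly p)))

pb-∥∥ : ∀ {n} (P : Vec (Poly ℤ) n) → PolyBounded (λ t → ∥ evalVec P t ∥)
pb-∥∥ []      = pb-const 0
pb-∥∥ (p ∷ P) = pb-+ (pb-poly p) (pb-∥∥ P)

rowsAt : ∀ {n} → List (Vec (Poly ℤ) n × Poly ℤ) → ℕ → List (Vec ℤ n × ℤ)
rowsAt E t = List.map (λ (P , b) → evalVec P t , b ⟨ + t ⟩) E

pb-bound : ∀ {n} m (E : List (Vec (Poly ℤ) n × Poly ℤ)) {Δ ρ} → PolyBounded Δ → PolyBounded ρ →
  PolyBounded (λ t → bound {n} m (List.map (λ (a , β) → ∥ a ∥ , ∣ β ∣) (rowsAt E t)) (Δ t) (ρ t))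
pb-bound m []            Δ ρ = ρ
pb-bound m ((P , b) ∷ E) Δ ρ = pb-bound m E
  (pb-+ Δ (pb-* (pb-const 2) αΔΔ))
  (pb-+ (pb-* Δ (pb-+ (pb-poly b) (pb-* (pb-∥∥ P) σ))) σ)
  where
  αΔΔ = pb-* (pb-* (pb-∥∥ P) Δ) Δ
  σ = pb-+ (pb-* (pb-const m) αΔΔ) ρ

power-bound : ∀ {n} (E : List (Vec (Poly ℤ) n × Poly ℤ)) → ∃[ e ] ∀ t → 2 ℕ.≤ t →
  (∀ p → Positive p → ¬ ListAll (λ (a , _) → a · p ≡ 0ℤ) (rowsAt E t)) →
  ∀ x → NonnegVec x → ListAll (λ (a , β) → a · x ≡ β) (rowsAt E t) → All (λ i → i < + (t ^ e)) x
-- One digit more than `t ^ e` requires makes the inequality strict.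
power-bound {n} E = suc e , λ t 2≤t pointed x x≥0 rows≡ → All.map
  (λ i≤ → ℤ.≤-<-trans i≤ (ℤ.+<+ (ℕ.≤-<-trans (≤t^e t 2≤t)
    (ℕ.^-monoʳ-< t 2≤t (ℕ.n<1+n e)))))
  (solution-≤ (rowsAt E t) pointed x x≥0 rows≡)
  where
  pb = pb-* (pb-const ∥ ones n ∥) (pb-bound n E (pb-const 1) (pb-const 0))
  e = proj₁ pb
  ≤t^e = proj₂ pb

-- The ℓ-th largest element

≥-order : DecTotalOrder _ _ _
≥-order = decTotalOrder ℤ.≤-decTotalOrder

open Data.List.Sort ≥-order using () renaming (sort to sort↓; sort-↭ to sort↓-↭; sort-↗ to sort↓-↗)

Descending : List ℤ → Set
Descending = AllPairs (λ x y → y ≤ x)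

descending-unique : ∀ {xs ys} → Descending xs → Descending ys → xs ↭ ys → xs ≡ ys
descending-unique {[]}     {ys}     _ _ p = sym (↭.↭-empty-inv (↭-sym p))
descending-unique {x ∷ xs} {[]}     _ _ p = ↭.↭-empty-inv p
descending-unique {x ∷ xs} {y ∷ ys} (x≥ ∷ dx) (y≥ ∷ dy) p with x≡y
  where
  x≡y : x ≡ y
  x≡y = ℤ.≤-antisym (ListAll.lookup (ℤ.≤-refl ∷ y≥) (↭.∈-resp-↭ p (here refl)))
                    (ListAll.lookup (ℤ.≤-refl ∷ x≥) (↭.∈-resp-↭ (↭-sym p) (here refl)))
... | refl = cong (x ∷_) (descending-unique dx dy (↭.drop-∷ p))

-- A sort with visible comparisons, which can be repeated on curves; it agrees with `sort↓` because
-- a descending rearrangement is unique. New elements go behind equal ones, so ties do not disturb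
-- the leading entries.
insert : ℤ → List ℤ → List ℤ
insert x []       = x ∷ []
insert x (w ∷ ws) with x ℤ.≤? w
... | yes _ = w ∷ insert x ws
... | no _  = x ∷ w ∷ ws

insertAll : List ℤ → List ℤ → List ℤ
insertAll xs ws = List.foldr insert ws xs

insert-↭ : ∀ x ws → insert x ws ↭ x ∷ ws
insert-↭ x [] = ↭.refl
insert-↭ x (w ∷ ws) with x ℤ.≤? w
... | yes _ = ↭-trans (↭.prep w (insert-↭ x ws)) (↭.swap w x ↭.refl)
... | no _  = ↭.refl

insertAll-↭ : ∀ xs ws → insertAll xs ws ↭ xs ++ ws
insertAll-↭ []       ws = ↭.refl
insertAll-↭ (x ∷ xs) ws = ↭-trans (insert-↭ x (insertAll xs ws)) (↭.prep x (insertAll-↭ xs ws))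

insert-descending : ∀ x {ws} → Descending ws → Descending (insert x ws)
insert-descending x {[]}     []        = [] ∷ []
insert-descending x {w ∷ ws} (w≥ ∷ ws≥) with x ℤ.≤? w
... | yes x≤w = ↭.All-resp-↭ (↭-sym (insert-↭ x ws)) (x≤w ∷ w≥) ∷ insert-descending x ws≥
... | no x≰w  = (w≤x ∷ ListAll.map (λ ≤w → ℤ.≤-trans ≤w w≤x) w≥) ∷ w≥ ∷ ws≥
  where w≤x = ℤ.<⇒≤ (ℤ.≰⇒> x≰w)

insertAll-descending : ∀ xs {ws} → Descending ws → Descending (insertAll xs ws)
insertAll-descending []       ws≥ = ws≥
insertAll-descending (x ∷ xs) ws≥ = insert-descending x (insertAll-descending xs ws≥)

sort↓-unique : ∀ {xs ws} → Descending ws → ws ↭ xs → sort↓ xs ≡ ws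
sort↓-unique {xs} ws≥ p = descending-unique
  (Sorted⇒AllPairs (DecTotalOrder.totalOrder ≥-order) (sort↓-↗ xs)) ws≥ (↭-trans (sort↓-↭ xs) (↭-sym p))

isort : List ℤ → List ℤ
isort xs = insertAll xs []

isort-↭ : ∀ xs → isort xs ↭ xs
isort-↭ xs = subst (isort xs ↭_) (List.++-identityʳ xs) (insertAll-↭ xs [])

Top : ℕ → ℤ → List ℤ → Set
Top k x ws = k ℕ.≤ length ws × ListAll (x ≤_) (List.take k ws)

top-pred : ∀ {k x ws} → Top (suc k) x ws → Top k x ws
top-pred {zero}  _ = ℕ.z≤n , []
top-pred {suc k} {ws = w ∷ ws} (ℕ.s≤s k≤ , x≤w ∷ all) =
  let k≤′ , all′ = top-pred {k} {ws = ws} (k≤ , all) in ℕ.s≤s k≤′ , x≤w ∷ all′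

top-insert : ∀ k {x} y {ws} → Top k x ws → Top k x (insert y ws)
top-insert zero    y top = ℕ.z≤n , []
top-insert (suc k) y {w ∷ ws} (ℕ.s≤s k≤ , x≤w ∷ all) with y ℤ.≤? w
... | yes _   = let k≤′ , all′ = top-insert k y (k≤ , all) in ℕ.s≤s k≤′ , x≤w ∷ all′
... | no y≰w = let k≤′ , all′ = top-pred {k} {ws = w ∷ ws} (ℕ.s≤s k≤ , x≤w ∷ all)
               in ℕ.s≤s k≤′ , ℤ.≤-trans x≤w (ℤ.<⇒≤ (ℤ.≰⇒> y≰w)) ∷ all′

top-insertAll : ∀ k {x} ys {ws} → Top k x ws → Top k x (insertAll ys ws)
top-insertAll k []       top = top
top-insertAll k (y ∷ ys) top = top-insert k y (top-insertAll k ys top)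

-- The new element passes every entry that is at least as large, so `k` such leading entries stay in
-- place.
take-insert : ∀ k {x ws} → Top k x ws → List.take k (insert x ws) ≡ List.take k ws
take-insert zero    _ = refl
take-insert (suc k) {x} {w ∷ ws} (ℕ.s≤s k≤ , x≤w ∷ all) with x ℤ.≤? w
... | yes _   = cong (w ∷_) (take-insert k (k≤ , all))
... | no x≰w = contradiction x≤w x≰w

take-insertAll : ∀ k {ws} xs → ListAll (λ x → Top k x ws) xs → List.take k (insertAll xs ws) ≡ List.take k ws
take-insertAll k []       []          = refl
take-insertAll k (x ∷ xs) (top ∷ tops) =
  trans (take-insert k (top-insertAll k xs top)) (take-insertAll k xs tops)

entry : ∀ {A : Set} → ℕ → List A → Maybe A
entry k xs = List.head (List.drop k xs)

entry-take : ∀ {A : Set} k (xs : List A) → entry k (List.take (suc k) xs) ≡ entry k xs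
entry-take k       []       = refl
entry-take zero    (x ∷ xs) = refl
entry-take (suc k) (x ∷ xs) = entry-take k xs

remove : ∀ {A : Set} {xs : List A} {g} → Unique xs → g ∈ xs → ∃[ ys ] xs ↭ g ∷ ys × Unique (g ∷ ys)
remove {xs = x ∷ xs} (x∉ ∷ u) (here refl) = xs , ↭.refl , x∉ ∷ u
remove {xs = x ∷ xs} {g} (x∉ ∷ u) (there g∈) with remove u g∈
... | ys , p , g∉ ∷ uys with ↭.All-resp-↭ p x∉
... | x≢g ∷ x∉ys = x ∷ ys , ↭-trans (↭.prep x p) (↭.swap x g ↭.refl) , (≢-sym x≢g ∷ g∉) ∷ (x∉ys ∷ uys)

complement : ∀ {A : Set} {xs gs : List A} → Unique xs → Unique gs → ListAll (_∈ xs) gs →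
  ∃[ rest ] xs ↭ gs ++ rest × ListAll (_∉ gs) rest
complement {xs = xs} {[]} u [] [] = xs , ↭.refl , ListAll.universal (λ _ ()) xs
complement {xs = xs} {g ∷ gs} u (g∉gs ∷ ugs) (g∈ ∷ gs⊆) with remove u g∈
... | ys , p , g∉ys ∷ uys with complement {xs = ys} {gs} uys ugs (ListAll.zipWith shrink (g∉gs , gs⊆))
  where
  shrink : ∀ {y} → g ≢ y × y ∈ xs → y ∈ ys
  shrink (g≢y , y∈) with ↭.∈-resp-↭ p y∈
  ... | here y≡g  = contradiction (sym y≡g) g≢y
  ... | there y∈′ = y∈′
... | rest , q , rest∉ = rest , ↭-trans p (↭.prep g q) ,
  ListAll.zipWith (λ { (g≢z , z∉gs) (here z≡g) → g≢z (sym z≡g) ; (g≢z , z∉gs) (there z∈) → z∉gs z∈ })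
    (ListAll.++⁻ʳ gs (↭.All-resp-↭ q g∉ys) , rest∉)

-- The `ℓ` values of `ys`, sorted alone, are all at least `v · z`, and inserting the remaining
-- values never lowers the first `ℓ` entries.
top-of-subset : ∀ {n} ℓ (v : Vec ℤ n) z gs ys → Unique gs → Unique ys → length ys ≡ ℓ →
  ListAll (λ y → y ∈ gs × v · z ≤ v · y) ys → Top ℓ (v · z) (isort (List.map (v ·_) gs))
top-of-subset ℓ v z gs ys ugs uys len all =
  let others , p , _ = complement ugs uys (ListAll.map proj₁ all)
      vs = List.map (v ·_)
      q : insertAll (vs others) (isort (vs ys)) ↭ vs gs
      q = ↭-trans (insertAll-↭ (vs others) (isort (vs ys)))
          (↭-trans (↭.++⁺ˡ (vs others) (isort-↭ (vs ys)))
          (↭-trans (↭.++-comm (vs others) (vs ys))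
          (subst (_↭ vs gs) (List.map-++ (v ·_) ys others) (↭.map⁺ (v ·_) (↭-sym p)))))
      eq : insertAll (vs others) (isort (vs ys)) ≡ isort (vs gs)
      eq = descending-unique (insertAll-descending (vs others) (insertAll-descending (vs ys) []))
             (insertAll-descending (vs gs) []) (↭-trans q (↭-sym (isort-↭ (vs gs))))
      length≡ : length (isort (vs ys)) ≡ ℓ
      length≡ = trans (↭.↭-length (isort-↭ (vs ys))) (trans (List.length-map (v ·_) ys) len)
      all≥ : ListAll (v · z ≤_) (isort (vs ys))
      all≥ = ↭.All-resp-↭ (↭-sym (isort-↭ (vs ys))) (ListAll.map⁺ (ListAll.map proj₂ all))
  in subst (Top ℓ (v · z)) eq (top-insertAll ℓ (vs others)
       (ℕ.≤-reflexive (sym length≡) , ListAll.take⁺ ℓ all≥))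

-- A point outside `gs` is dominated by `ℓ` distinct points of `gs`, so inserting its value leaves
-- the first `ℓ` sorted values of `gs` unchanged.
nthLargest-cover : ∀ {n} ℓ → .{{_ : ℕ.NonZero ℓ}} → (v : Vec ℤ n) (xs gs : List (Vec ℤ n)) → Unique xs → Unique gs →
  ListAll (_∈ xs) gs → Covers ℓ (_∈ xs) (_∈ gs) →
  nthLargest ℓ (List.map (v ·_) xs) ≡ entry (ℕ.pred ℓ) (isort (List.map (v ·_) gs))
nthLargest-cover (suc ℓ) v xs gs uxs ugs gs⊆xs cover =
  trans (cong (entry ℓ) sorted)
  (trans (sym (entry-take ℓ _)) (trans (cong (entry ℓ) (take-insertAll (suc ℓ) (vs others) tops)) (entry-take ℓ _)))
  where
  vs = List.map (v ·_)
  others = proj₁ (complement uxs ugs gs⊆xs)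
  p = proj₁ (proj₂ (complement uxs ugs gs⊆xs))
  others∉ = proj₂ (proj₂ (complement uxs ugs gs⊆xs))
  sorted : sort↓ (vs xs) ≡ insertAll (vs others) (isort (vs gs))
  sorted = sort↓-unique (insertAll-descending (vs others) (insertAll-descending (vs gs) []))
    (↭-trans (insertAll-↭ (vs others) (isort (vs gs)))
    (↭-trans (↭.++⁺ˡ (vs others) (isort-↭ (vs gs)))
    (↭-trans (↭.++-comm (vs others) (vs gs))
    (subst (_↭ vs xs) (List.map-++ (v ·_) gs others) (↭.map⁺ (v ·_) (↭-sym p))))))
  others⊆xs : ListAll (_∈ xs) others
  others⊆xs = ListAll.tabulate λ z∈ → ↭.∈-resp-↭ (↭-sym p) (∈-++⁺ʳ gs z∈)
  tops : ListAll (λ x → Top (suc ℓ) x (isort (vs gs))) (vs others)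
  tops = ListAll.map⁺ (ListAll.zipWith (λ {z} (z∈xs , z∉gs) → case cover v z z∈xs of λ where
      (inj₁ z∈gs)                   → contradiction z∈gs z∉gs
      (inj₂ (ys , uys , len , all)) → top-of-subset (suc ℓ) v z gs ys ugs uys len all)
    (others⊆xs , others∉))

-- Deduplication and sorting of finitely many curves, for large t

From : ℕ → Domain → Domain
From N D t = N ℕ.≤ t × D t

from-⊔ˡ : ∀ M N {t} {X : Set} → M ⊔ N ℕ.≤ t × X → M ℕ.≤ t × X
from-⊔ˡ M N (≤t , t∈D) = ℕ.m⊔n≤o⇒m≤o M N ≤t , t∈D

from-⊔ʳ : ∀ M N {t} {X : Set} → M ⊔ N ℕ.≤ t × X → N ℕ.≤ t × X
from-⊔ʳ M N (≤t , t∈D) = ℕ.m⊔n≤o⇒n≤o M N ≤t , t∈D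

rep-difference : ∀ {D u v} → Rep D u → Rep D v → Rep D (λ t → u t - v t)
rep-difference {u = u} {v} ru rv = rep-cong (λ t _ → cong (λ s → u t + s) (ℤ.-1*i≡-i (v t)))
  (rep-+ ru (rep-* (rep-const -1ℤ) rv))

curves-equal : ∀ {D n} (g h : Curve n) → All (Rep D) g → All (Rep D) h →
  ∃[ N ] Decided (λ t → at g t ≡ at h t) (From N D)
curves-equal []      []      []        []        = 0 , inj₁ λ _ _ → refl
curves-equal (u ∷ g) (v ∷ h) (ru ∷ rg) (rv ∷ rh)
  with rep-sign (rep-difference ru rv) | curves-equal g h rg rh
... | M , inj₁ u≡v | N , inj₁ g≡h = M ⊔ N , inj₁ λ t t∈ →
  cong₂ _∷_ (ℤ.i-j≡0⇒i≡j _ _ (u≡v t (from-⊔ˡ M N t∈))) (g≡h t (from-⊔ʳ M N t∈))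
... | M , inj₁ _ | N , inj₂ g≢h = N , inj₂ λ t t∈ eq → g≢h t t∈ (Vec.∷-injectiveʳ eq)
... | M , inj₂ (inj₁ u>v) | _ = M , inj₂ λ t t∈ eq →
  ℤ.<-irrefl (sym (ℤ.i≡j⇒i-j≡0 (Vec.∷-injectiveˡ eq))) (u>v t t∈)
... | M , inj₂ (inj₂ u<v) | _ = M , inj₂ λ t t∈ eq →
  ℤ.<-irrefl (ℤ.i≡j⇒i-j≡0 (Vec.∷-injectiveˡ eq)) (u<v t t∈)

curve-member : ∀ {D n} (g : Curve n) G → All (Rep D) g → ListAll (All (Rep D)) G →
  ∃[ N ] Decided (λ t → at g t ∈ values G t) (From N D)
curve-member g []      rg []        = 0 , inj₂ λ _ _ ()
curve-member g (h ∷ G) rg (rh ∷ rG) with curves-equal g h rg rh | curve-member g G rg rG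
... | N , inj₁ eq | _ = N , inj₁ λ t t∈ → here (eq t t∈)
... | M , inj₂ g≢h | N , inj₁ g∈ = N , inj₁ λ t t∈ → there (g∈ t t∈)
... | M , inj₂ g≢h | N , inj₂ g∉ = M ⊔ N , inj₂ λ t t∈ → λ
  { (here eq)   → g≢h t (from-⊔ˡ M N t∈) eq
  ; (there g∈)  → g∉ t (from-⊔ʳ M N t∈) g∈ }

-- Values are counted once per point, so each point must be listed once. Two curves agree for all
-- large `t` of the domain or for none, which allows whole curves to be dropped.
dedupe : ∀ {D n} (G : List (Curve n)) → ListAll (All (Rep D)) G →
  ∃[ N ] ∃[ H ] ListAll (All (Rep D)) H × ∀ t → From N D t →
    Unique (values H t) × (∀ {z} → z ∈ values H t → z ∈ values G t) × (∀ {z} → z ∈ values G t → z ∈ values H t)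
dedupe []      []        = 0 , [] , [] , λ t _ → [] , (λ z∈ → z∈) , (λ z∈ → z∈)
dedupe (g ∷ G) (rg ∷ rG) with dedupe G rG
... | M , H , rH , good with curve-member g H rg rH
... | N , inj₁ g∈ = M ⊔ N , H , rH , λ t t∈ →
  let u , H⊆G , G⊆H = good t (from-⊔ˡ M N t∈)
  in u , (λ z∈ → there (H⊆G z∈)) , λ { (here refl) → g∈ t (from-⊔ʳ M N t∈) ; (there z∈) → G⊆H z∈ }
... | N , inj₂ g∉ = M ⊔ N , g ∷ H , rg ∷ rH , λ t t∈ →
  let u , H⊆G , G⊆H = good t (from-⊔ˡ M N t∈)
  in ListAll.tabulate (λ {z} z∈ g≡z → g∉ t (from-⊔ʳ M N t∈) (subst (_∈ values H t) (sym g≡z) z∈)) ∷ u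
   , (λ { (here eq) → here eq ; (there z∈) → there (H⊆G z∈) })
   , (λ { (here eq) → here eq ; (there z∈) → there (G⊆H z∈) })

valuesℤ : List (ℕ → ℤ) → ℕ → List ℤ
valuesℤ W t = List.map (λ u → u t) W

insert-yes : ∀ {x w} ws → x ≤ w → insert x (w ∷ ws) ≡ w ∷ insert x ws
insert-yes {x} {w} ws x≤w with x ℤ.≤? w
... | yes _   = refl
... | no x≰w = contradiction x≤w x≰w

insert-no : ∀ {x w} ws → w < x → insert x (w ∷ ws) ≡ x ∷ w ∷ ws
insert-no {x} {w} ws w<x with x ℤ.≤? w
... | yes x≤w = contradiction x≤w (ℤ.<⇒≱ w<x)
... | no _    = refl

-- Each comparison made by `insert` has a constant outcome for large `t`, as the difference of two
-- represented functions has an eventually constant sign.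
curve-insert : ∀ {D} u W → Rep D u → ListAll (Rep D) W →
  ∃[ N ] ∃[ W′ ] ListAll (Rep D) W′ × ∀ t → From N D t → valuesℤ W′ t ≡ insert (u t) (valuesℤ W t)
curve-insert u []      ru []        = 0 , u ∷ [] , ru ∷ [] , λ _ _ → refl
curve-insert {D} u (w ∷ W) ru (rw ∷ rW) with rep-sign (rep-difference rw ru) | curve-insert u W ru rW
... | M , inj₁ w≡u | N , W′ , rW′ , eq = M ⊔ N , w ∷ W′ , rw ∷ rW′ , λ t t∈ →
  trans (cong (w t ∷_) (eq t (from-⊔ʳ M N t∈)))
    (sym (insert-yes (valuesℤ W t) (ℤ.≤-reflexive (sym (ℤ.i-j≡0⇒i≡j _ _ (w≡u t (from-⊔ˡ M N t∈)))))))
... | M , inj₂ (inj₁ w>u) | N , W′ , rW′ , eq = M ⊔ N , w ∷ W′ , rw ∷ rW′ , λ t t∈ →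
  trans (cong (w t ∷_) (eq t (from-⊔ʳ M N t∈)))
    (sym (insert-yes (valuesℤ W t) (ℤ.0≤i-j⇒j≤i (ℤ.<⇒≤ (w>u t (from-⊔ˡ M N t∈))))))
... | M , inj₂ (inj₂ w<u) | _ = M , u ∷ w ∷ W , ru ∷ rw ∷ rW , λ t t∈ →
  sym (insert-no (valuesℤ W t) (ℤ.≰⇒> λ u≤w → ℤ.<⇒≱ (w<u t t∈) (ℤ.i≤j⇒0≤j-i u≤w)))

curve-sort : ∀ {D} W → ListAll (Rep D) W →
  ∃[ N ] ∃[ W′ ] ListAll (Rep D) W′ × ∀ t → From N D t → valuesℤ W′ t ≡ isort (valuesℤ W t)
curve-sort []      []        = 0 , [] , [] , λ _ _ → refl
curve-sort (u ∷ W) (ru ∷ rW) =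
  let M , W₁ , r₁ , eq₁ = curve-sort W rW
      N , W₂ , r₂ , eq₂ = curve-insert u W₁ ru r₁
  in M ⊔ N , W₂ , r₂ , λ t t∈ → trans (eq₂ t (from-⊔ʳ M N t∈)) (cong (insert (u t)) (eq₁ t (from-⊔ˡ M N t∈)))

entry-map : ∀ {A B : Set} (φ : A → B) k xs → entry k (List.map φ xs) ≡ Maybe.map φ (entry k xs)
entry-map φ zero    []       = refl
entry-map φ zero    (x ∷ xs) = refl
entry-map φ (suc k) []       = refl
entry-map φ (suc k) (x ∷ xs) = entry-map φ k xs

entry-all : ∀ {A : Set} {P : A → Set} k {xs} → ListAll P xs → MaybeAll P (entry k xs)
entry-all zero    []       = MaybeAll.nothing
entry-all zero    (p ∷ ps) = MaybeAll.just p
entry-all (suc k) []       = MaybeAll.nothing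
entry-all (suc k) (p ∷ ps) = entry-all k ps

RepMaybe : (F : ℕ → Maybe ℤ → Set) → Domain → Set
RepMaybe F D = ∃[ w ] MaybeAll (Rep D) w × ∀ t → D t → F t (Maybe.map (λ u → u t) w)

repMaybe-anti : ∀ {F} → Antitone (RepMaybe F)
repMaybe-anti E⊆D (w , rw , eq) = w , MaybeAll.map (λ {u} → rep-anti {u} E⊆D) rw , λ t t∈E → eq t (E⊆D t∈E)

-- Ranging over all enumerations without repetition makes the result independent of how the points
-- at each `t` happen to be listed.
IsNthLargest : ∀ {n} (ℓ : ℕ) → .{{ℕ.NonZero ℓ}} → (P : Vec (Poly ℤ) n) → (ℕ → Pred (Vec ℤ n) 0ℓ) → ℕ → Maybe ℤ → Set
IsNthLargest ℓ P S t w = ∀ xs → Unique xs → (∀ x → x ∈ xs → S t x) → (∀ x → S t x → x ∈ xs) →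
  nthLargest ℓ (List.map (Vec.map _⟨ + t ⟩ P ·_) xs) ≡ w

-- On one piece the deduplicated and sorted list of curves has a fixed length, so the wanted entry
-- is one curve throughout or is missing throughout; the latter is the constituent -∞.
good⇒nthLargest : ∀ {n} ℓ → .{{_ : ℕ.NonZero ℓ}} → (P : Vec (Poly ℤ) n) {S : ℕ → Pred (Vec ℤ n) 0ℓ} →
  Good ℓ S → Piecewise (RepMaybe (IsNthLargest ℓ P S))
good⇒nthLargest {n} ℓ P {S} = piecewise-eventually (goodOn-anti ℓ {S = S}) step (repMaybe-anti {IsNthLargest ℓ P S})
  where
  step : ∀ {D} → GoodOn ℓ S D → ∃[ N ] RepMaybe (IsNthLargest ℓ P S) (λ t → N ℕ.≤ t × D t)
  step {D} (G , rG , good) = M ⊔ N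
    , entry (ℕ.pred ℓ) W′
    , MaybeAll.map (λ {u} → rep-anti {u} proj₂) (entry-all (ℕ.pred ℓ) rW′)
    , λ t t∈ xs uxs xs⊆S S⊆xs →
      let G⊆S , S▷G = good t (proj₂ t∈)
          uH , H⊆G , G⊆H = unique t (from-⊔ˡ M N t∈)
          v = Vec.map _⟨ + t ⟩ P
          covers : Covers ℓ (_∈ xs) (_∈ values H t)
          covers v z z∈ = case S▷G v z (xs⊆S z z∈) of λ where
            (inj₁ z∈G) → inj₁ (G⊆H z∈G)
            (inj₂ dom) → inj₂ (dominated-⊆ ℓ {v = v} G⊆H dom)
      in trans (nthLargest-cover ℓ v xs (values H t) uxs uH
                 (ListAll.tabulate (λ {z} z∈ → S⊆xs z (ListAll.lookup G⊆S (H⊆G z∈)))) covers)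
         (trans (cong (entry (ℕ.pred ℓ)) (trans (cong isort (objective-values t H)) (sym (sorted t (from-⊔ʳ M N t∈)))))
           (entry-map (λ u → u t) (ℕ.pred ℓ) W′))
    where
    deduped = dedupe G rG
    M = proj₁ deduped
    H = proj₁ (proj₂ deduped)
    rH = proj₁ (proj₂ (proj₂ deduped))
    unique = proj₂ (proj₂ (proj₂ deduped))
    objective : Curve n → ℕ → ℤ
    objective g t = Vec.map _⟨ + t ⟩ P · at g t
    ordered = curve-sort (List.map objective H) (ListAll.map⁺ (ListAll.map (λ {g} rg → rep-· P g rg) rH))
    N = proj₁ ordered
    W′ = proj₁ (proj₂ ordered)
    rW′ = proj₁ (proj₂ (proj₂ ordered))
    sorted = proj₂ (proj₂ (proj₂ ordered))
    objective-values : ∀ t H → List.map (Vec.map _⟨ + t ⟩ P ·_) (values H t) ≡ valuesℤ (List.map objective H) t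
    objective-values t []      = refl
    objective-values t (g ∷ H) = cong (_ ∷_) (objective-values t H)

-- Integer points of the real polyhedra

rows : ∀ {m n} → Vec (Vec (Poly ℤ) n) m → Vec (Poly ℤ) m → List (Vec (Poly ℤ) n × Poly ℤ)
rows []      []       = []
rows (P ∷ A) (b ∷ bs) = (P , b) ∷ rows A bs

Feasible : ∀ {n} → List (Vec (Poly ℤ) n × Poly ℤ) → ℕ → Vec ℤ n → Set
Feasible E t x = NonnegVec x × ListAll (λ (a , β) → a · x ≡ β) (rowsAt E t)

nonneg⇒real : ∀ {n} {x : Vec ℤ n} → NonnegVec x → All (ι 0ℤ ℝ.≤_) (Vec.map ι x)
nonneg⇒real []         = []
nonneg⇒real (0≤i ∷ x≥0) = const-mono-≤ (/1-mono-≤ 0≤i) ∷ nonneg⇒real x≥0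

real⇒nonneg : ∀ {n} (x : Vec ℤ n) → All (ι 0ℤ ℝ.≤_) (Vec.map ι x) → NonnegVec x
real⇒nonneg []      []          = []
real⇒nonneg (i ∷ x) (0≤i ∷ x≥0) = /1-cancel-≤ (const-cancel-≤ 0≤i) ∷ real⇒nonneg x x≥0

module _ {n : ℕ} (t : ℕ) (x : Vec ℤ n) where

  rowValue : Vec (Poly ℤ) n → ℝ
  rowValue P = dot ℝ-rawRing (Vec.map ι (evalVec P t)) (Vec.map ι x)

  RealRows : ∀ {m} → Vec (Vec (Poly ℤ) n) m → Vec (Poly ℤ) m → Set
  RealRows A b = Pointwise _≈_ (mulVec ℝ-rawRing (Vec.map (Vec.map ι) (Vec.map (Vec.map _⟨ + t ⟩) A)) (Vec.map ι x))
    (Vec.map ι (Vec.map _⟨ + t ⟩ b))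

  rows⇒real : ∀ {m} (A : Vec (Vec (Poly ℤ) n) m) b → ListAll (λ (a , β) → a · x ≡ β) (rowsAt (rows A b) t) → RealRows A b
  rows⇒real []      []       []         = []
  rows⇒real (P ∷ A) (b ∷ bs) (eq ∷ eqs) =
    constant-≈ {rowValue P} (dot-ι (evalVec P t) x) (cong (ℚ._/ 1) eq) ∷ rows⇒real A bs eqs

  real⇒rows : ∀ {m} (A : Vec (Vec (Poly ℤ) n) m) b → RealRows A b → ListAll (λ (a , β) → a · x ≡ β) (rowsAt (rows A b) t)
  real⇒rows []      []       []         = []
  real⇒rows (P ∷ A) (b ∷ bs) (eq ∷ eqs) =
    /1-injective (constant-≈⁻ {rowValue P} (dot-ι (evalVec P t) x) eq) ∷ real⇒rows A bs eqs

module _ {m n : ℕ} (A : Vec (Vec (Poly ℤ) n) m) (b : Vec (Poly ℤ) m) where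

  feasible⇒real : ∀ t x → Feasible (rows A b) t x → IntegerPoints (R A b (+ t)) x
  feasible⇒real t x (x≥0 , rows≡) = nonneg⇒real x≥0 , rows⇒real t x A b rows≡

  real⇒feasible : ∀ t x → IntegerPoints (R A b (+ t)) x → Feasible (rows A b) t x
  real⇒feasible t x (x≥0 , rows≈) = real⇒nonneg x x≥0 , real⇒rows t x A b rows≈

  -- A recession direction p makes x + k p feasible for every k.
  bounded⇒pointed : ∀ t → Bounded (R A b (+ t)) → ∀ x → Feasible (rows A b) t x →
    ∀ p → Positive p → ¬ ListAll (λ (a , _) → a · p ≡ 0ℤ) (rowsAt (rows A b) t)
  bounded⇒pointed t (M , bounded) x (x≥0 , rows≡) p (p≥0 , p>0) rows≡0 =
    ℕ.<⇒≱ (ℕ.n<1+n (∥ ones n ∥ ℕ.* N)) (ℤ.drop‿+≤+ (begin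
      + k                          ≡⟨ ℤ.*-identityʳ (+ k) ⟨
      + k * 1ℤ                     ≤⟨ ℤ.*-monoˡ-≤-nonNeg (+ k) (ℤ.i<j⇒suc[i]≤j p>0) ⟩
      + k * (ones n · p)           ≡⟨ ℤ.+-identityˡ _ ⟨
      0ℤ + + k * (ones n · p)      ≤⟨ ℤ.+-monoˡ-≤ (+ k * (ones n · p)) (sum-nonneg x≥0) ⟩
      ones n · x + + k * (ones n · p) ≡⟨ cong (_+ + k * (ones n · p)) (ℤ.*-identityˡ (ones n · x)) ⟨
      1ℤ * (ones n · x) + + k * (ones n · p) ≡⟨ ·-comb (ones n) 1ℤ x (+ k) p ⟨
      ones n · y                   ≤⟨ i≤∣i∣ (ones n · y) ⟩
      + ∣ ones n · y ∣             ≤⟨ ℤ.+≤+ (∣·∣≤ (ones n) y N (entries≤N y y≥0 (bounded _ (feasible⇒real t y y-feasible)))) ⟩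
      + (∥ ones n ∥ ℕ.* N)         ∎))
    where
    open ℤ.≤-Reasoning
    N = proj₁ (archimedean M)
    ≤N = proj₂ (archimedean M)
    -- The entries of `y` sum to at least `k`, which is one more than entries bounded by `N` allow.
    k = suc (∥ ones n ∥ ℕ.* N)
    y = comb 1ℤ x (+ k) p
    y≥0 : NonnegVec y
    y≥0 = NonnegVec-comb {j = 1ℤ} {+ k} (ℤ.+≤+ ℕ.z≤n) (ℤ.+≤+ ℕ.z≤n) x≥0 p≥0
    y-feasible : Feasible (rows A b) t y
    y-feasible = y≥0 , ListAll.zipWith (λ {(a , β)} (a·x , a·p) →
      trans (·-comb a 1ℤ x (+ k) p) (trans (cong₂ (λ u v → 1ℤ * u + + k * v) a·x a·p) (lemma β (+ k)))) (rows≡ , rows≡0)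
      where
      lemma : ∀ β k → 1ℤ * β + k * 0ℤ ≡ β
      lemma = solve-∀
    entries≤N : ∀ {l} (y : Vec ℤ l) → NonnegVec y → All (λ r → ℝ.- M ℝ.≤ r × r ℝ.≤ M) (Vec.map ι y) →
      All (λ i → ∣ i ∣ ℕ.≤ N) y
    entries≤N []      []          []              = []
    entries≤N (i ∷ y) (0≤i ∷ y≥0) ((_ , i≤M) ∷ y≤M) =
      ≤N ∣ i ∣ (subst (λ j → ι j ℝ.≤ M) (sym (ℤ.0≤i⇒+∣i∣≡i 0≤i)) i≤M) ∷ entries≤N y y≥0 y≤M

  good-feasible : ∀ ℓ → (∀ t → 0ℤ < t → Bounded (R A b t)) → Good ℓ (Feasible (rows A b))
  good-feasible ℓ bounded = good-cover ℓ
    (2 , λ t 2≤t →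
      (λ (box , rows≡) → All.map proj₁ box , ListAll.map⁺ rows≡) ,
      λ v x x∈@(x≥0 , rows≡) → inj₁
        ( All.zip (x≥0 , below t 2≤t
            -- Boundedness excludes recession directions only where some point exists; the point `x`
            -- whose size is being estimated serves as that point.
            (bounded⇒pointed t (bounded (+ t) (ℤ.+<+ (ℕ.≤-trans (ℕ.s≤s ℕ.z≤n) 2≤t))) x x∈) x x≥0 rows≡)
        , ListAll.map⁻ rows≡))
    (good-solutions ℓ (rows A b))
    where
    e = proj₁ (power-bound (rows A b))
    below = proj₂ (power-bound (rows A b))
    open Digits e using (good-solutions)

-- Constituent polynomials over the reals, and the theorem

realPoly : ℚ → Poly ℤ → Poly ℝ
realPoly q = List.map (λ a → const (a ℚ./ 1 ℚ.* q))

-- All reals involved are constant sequences, so the evaluation is an exact identity of rationals at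
-- every index `k`.
realPoly-eval : ∀ q p t k → seq (eval ℝ-rawRing (realPoly q p) (ι t)) k ≡ p ⟨ t ⟩ ℚ./ 1 ℚ.* q
realPoly-eval q []      t k = sym (ℚ.*-zeroˡ q)
realPoly-eval q (a ∷ p) t k = trans (cong (λ s → a ℚ./ 1 ℚ.* q ℚ.+ t ℚ./ 1 ℚ.* s) (realPoly-eval q p t k))
  (trans (factor (a ℚ./ 1) q (t ℚ./ 1) (p ⟨ t ⟩ ℚ./ 1))
  (cong (ℚ._* q) (trans (cong (a ℚ./ 1 ℚ.+_) (/1-* t (p ⟨ t ⟩))) (/1-+ a (t * p ⟨ t ⟩)))))
  where
  open +-*-Solver
  factor : ∀ a q t P → a ℚ.* q ℚ.+ t ℚ.* (P ℚ.* q) ≡ (a ℚ.+ t ℚ.* P) ℚ.* q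
  factor = solve 4 (λ a q t P → a :* q :+ t :* (P :* q) := (a :+ t :* P) :* q) refl

rep⇒real : ∀ {D u} → Rep D u → ∃[ p ] ∀ t → D t → ι (u t) ≈ eval ℝ-rawRing p (ι (+ t))
rep⇒real {D} {u} (m , m≢0 , p , eq) = realPoly q p , λ t t∈D →
  ≈-sym {limit t} {ι (u t)} (constant-≈ {limit t} (realPoly-eval q p (+ t)) (begin
    p ⟨ + t ⟩ ℚ./ 1 ℚ.* q                  ≡⟨ cong (λ s → s ℚ./ 1 ℚ.* q) (eq t t∈D) ⟨
    (m * u t) ℚ./ 1 ℚ.* q                  ≡⟨ cong (ℚ._* q) (/1-* m (u t)) ⟨
    m ℚ./ 1 ℚ.* (u t ℚ./ 1) ℚ.* q          ≡⟨ rearrange (m ℚ./ 1) (u t ℚ./ 1) q ⟩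
    m ℚ./ 1 ℚ.* q ℚ.* (u t ℚ./ 1)          ≡⟨ cong (ℚ._* (u t ℚ./ 1)) (ℚ.*-inverseʳ (m ℚ./ 1)) ⟩
    ℚ.1ℚ ℚ.* (u t ℚ./ 1)                   ≡⟨ ℚ.*-identityˡ _ ⟩
    u t ℚ./ 1                              ∎))
  where
  open ≡-Reasoning
  open +-*-Solver
  instance
    _ : ℚ.NonZero (m ℚ./ 1)
    _ = ℚ.≢-nonZero (λ eq → m≢0 (/1-injective eq))
  q = ℚ.1/ (m ℚ./ 1)
  limit : ℕ → ℝ
  limit t = eval ℝ-rawRing (realPoly q p) (ι (+ t))
  rearrange : ∀ m u q → m ℚ.* u ℚ.* q ≡ m ℚ.* q ℚ.* u
  rearrange = solve 3 (λ m u q → m :* u :* q := m :* q :* u) refl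

upper-bound : ∀ (N : ℕ → ℕ) d → ∃[ M ] ∀ r → r ℕ.< d → N r ℕ.≤ M
upper-bound N zero    = 0 , λ r ()
upper-bound N (suc d) = let M , ≤M = upper-bound N d in M ⊔ N d , λ r r<1+d →
  case ℕ.m≤n⇒m<n∨m≡n (ℕ.≤-pred r<1+d) of λ where
    (inj₁ r<d)  → ℕ.≤-trans (≤M r r<d) (ℕ.m≤m⊔n M (N d))
    (inj₂ refl) → ℕ.m≤n⊔m M (N d)

piecewise⇒quasi-polynomial : ∀ {F} (g : ∀ t → 0ℤ < t → ℤ ₋) →
  (∀ t t>0 w → F t w → g (+ t) t>0 ≡ w) → Piecewise (RepMaybe F) →
  EventuallyQuasiPolynomial (0ℤ <_) (λ t t>0 → Maybe.map ι (g t t>0))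
piecewise⇒quasi-polynomial {F} g g≡ (d , d≢0 , piece) =
  (1ℤ , λ t → ℤ.suc[i]≤j⇒i<j) , d , d≢0 , (λ i → poly (Fin.toℕ i)) , + M , eventually
  where
  open InfimumEquality _≈_ using (_≈₋_; [_]; ⊥₋≈⊥₋)
  instance _ = d≢0
  M = proj₁ (upper-bound (proj₁ ∘ piece) d)
  ≤M = proj₂ (upper-bound (proj₁ ∘ piece) d)
  toReal : ∀ {D} (w : Maybe (ℕ → ℤ)) → MaybeAll (Rep D) w → ∃[ P ] ∀ t → D t →
    Maybe.map ι (Maybe.map (λ u → u t) w) ≈₋ Maybe.map (λ p → eval ℝ-rawRing p (ι (+ t))) P
  toReal nothing  nothing  = nothing , λ _ _ → ⊥₋≈⊥₋
  toReal (just u) (just ru) = let p , eq = rep⇒real ru in just p , λ t t∈D → [ eq t t∈D ]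
  poly : ℕ → Poly ℝ ₋
  poly r = let _ , w , rw , _ = piece r in proj₁ (toReal w rw)
  eventually : ∀ t → + M ≤ t → (t>0 : 0ℤ < t) → Maybe.map ι (g t t>0) ≈₋
    Maybe.map (λ p → eval ℝ-rawRing p (ι t)) (poly (Fin.toℕ (Fin.fromℕ< (ℤ.n%ℕd<d t d))))
  eventually (+ t) (ℤ.+≤+ M≤t) t>0 with Fin.toℕ (Fin.fromℕ< (ℤ.n%ℕd<d (+ t) d)) | Fin.toℕ-fromℕ< (ℤ.n%ℕd<d (+ t) d)
  ... | _ | refl =
    let N , w , rw , F≡ = piece (t % d)
        t∈ = ℕ.≤-trans (≤M (t % d) (ℕ.m%n<n t d)) M≤t , refl
    in subst (λ v → Maybe.map ι v ≈₋ Maybe.map (λ p → eval ℝ-rawRing p (ι (+ t))) (proj₁ (toReal w rw)))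
         (sym (g≡ t t>0 _ (F≡ t t∈))) (proj₂ (toReal w rw) t t∈)

theorem1p4 :
    (n m : ℕ) → .{{ℕ.NonZero n}} → .{{ℕ.NonZero m}} →
    (c : Vec (Poly ℤ) n) (A : Vec (Vec (Poly ℤ) n) m) (b : Vec (Poly ℤ) m) →
    (bounded : ∀ t → 0ℤ ℤ.< t → Bounded (R A b t)) →
    (ℓ : ℕ) → .{{ _ : ℕ.NonZero ℓ }} →
    EventuallyQuasiPolynomial (0ℤ ℤ.<_) (λ t t>0 → Maybe.map ι (f c A b bounded ℓ t t>0))
theorem1p4 n m c A b bounded ℓ = piecewise⇒quasi-polynomial {IsNthLargest ℓ c (Feasible (rows A b))} (f c A b bounded ℓ)
  (λ t t>0 w isNth → let xs , unique , member = enumerate _ _ (bounded (+ t) t>0) in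
    isNth xs unique
      (λ x x∈ → real⇒feasible A b t x (Equivalence.to (member x) x∈))
      (λ x x∈ → Equivalence.from (member x) (feasible⇒real A b t x x∈)))
  (good⇒nthLargest ℓ c (good-feasible A b ℓ bounded))
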